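{- Let $d>1$ be a squarefree integer and let $R$ be the ring of integers of $\mathbb{Q}(\sqrt d)\subset\mathbb{R}$. Let $u\in R$ be a unit of norm $1$ with $u>0$ and $u\neq1$, and let $\Delta=(\Delta_n)_{n\geqslant1}$ with $\Delta_n=N_{\mathbb{Q}(\sqrt d)/\mathbb{Q}}(u^n-1)$. If $u<\frac16$ or $u>6$, then $Z(\Delta)\leqslant6$. For all other such units $u$, one of the following holds: (1) $u=3+2\sqrt2$ or $u=3-2\sqrt2$, where $Z(\Delta)=2$; (2) $u=2+\sqrt3$ or $u=2-\sqrt3$, where $Z(\Delta)=6$ and the only terms without a primitive prime divisor are $\Delta_4$ and $\Delta_6$; (3) $u=\frac{3+\sqrt5}{2}$ or $u=\frac{3-\sqrt5}{2}$, where $Z(\Delta)=12$ and the only terms without a primitive prime divisor are $\Delta_6$, $\Delta_{10}$ and $\Delta_{12}$; (4) $u=\frac{5+\sqrt{21}}{2}$ or $u=\frac{5-\sqrt{21}}{2}$, where $Z(\Delta)=6$ and the only term without a primitive prime divisor is $\Delta_6$.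
   Context: For an integer sequence $A=(a_n)_{n\geqslant1}$, a prime $p$ dividing a term $a_n$ is called a primitive prime divisor of $a_n$ if $p$ does not divide $a_m$ for any $m<n$ with $a_m\neq0$. The Zsigmondy bound of $A$ is $Z(A)=\max\{n: a_n\text{ does not have a primitive prime divisor}\}$ if this set is finite, and $Z(A)=\infty$ otherwise. $N_{\mathbb{Q}(\sqrt d)/\mathbb{Q}}$ denotes the field norm.
   Formalization: In case (3) the terms without a primitive prime divisor are given as Δ_1, Δ_6, Δ_10 and Δ_12: since Δ_1 = −1 has no prime divisor, it has no primitive prime divisor, so the list as printed omits it. -}

module Defs where

open import Algebra.Bundles using (RawRing)
import Algebra.Definitions.RawSemiring as RawSemiringDefinitions
open import Data.Integer as ℤ using (ℤ; +_; 0ℤ)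
import Data.Integer.Divisibility as ℤ
open import Data.List using (List; []; _∷_)
open import Data.List.Membership.Propositional using (_∈_)
open import Data.Nat as ℕ using (ℕ)
import Data.Nat.Divisibility as ℕ
open import Data.Nat.Primality using (Prime)
open import Data.Product using (∃; ∃-syntax; _×_)
open import Data.Rational as ℚ using (ℚ; 0ℚ; 1ℚ)
open import Data.Sum using (_⊎_)
open import Function.Bundles using (_⇔_)
open import Level using (0ℓ)
open import Relation.Binary.PropositionalEquality using (_≡_; _≢_)
open import Relation.Nullary using (¬_)

Squarefree : ℕ → Set
Squarefree d = ∀ k → k ℕ.* k ℕ.∣ d → k ≡ 1

-- The field ℚ(√d), for d not a perfect square:  a ⊕ b √d  is a + b√d.
-- Under that assumption the pair (a , b) is determined by the number, so
-- propositional equality is the equality of the field.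
infix 4 _⊕_√d
record ℚ[√_] (d : ℕ) : Set where
  constructor _⊕_√d
  field
    rat : ℚ
    irr : ℚ

module _ {d : ℕ} where

  fromℚ : ℚ → ℚ[√ d ]
  fromℚ q = q ⊕ 0ℚ √d

  fromℤ : ℤ → ℚ[√ d ]
  fromℤ k = fromℚ (k ℚ./ 1)

  0# 1# : ℚ[√ d ]
  0# = fromℚ 0ℚ
  1# = fromℚ 1ℚ

  infixl 6 _+_ _-_
  infixl 7 _*_
  infix  8 -_

  -_ : ℚ[√ d ] → ℚ[√ d ]
  - (a ⊕ b √d) = (ℚ.- a) ⊕ (ℚ.- b) √d

  _+_ _*_ : ℚ[√ d ] → ℚ[√ d ] → ℚ[√ d ]
  (a ⊕ b √d) + (a′ ⊕ b′ √d) = (a ℚ.+ a′) ⊕ (b ℚ.+ b′) √d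
  (a ⊕ b √d) * (a′ ⊕ b′ √d) =
    (a ℚ.* a′ ℚ.+ (+ d ℚ./ 1) ℚ.* (b ℚ.* b′)) ⊕ (a ℚ.* b′ ℚ.+ b ℚ.* a′) √d

  _-_ : ℚ[√ d ] → ℚ[√ d ] → ℚ[√ d ]
  x - y = x + (- y)

  rawRing : RawRing 0ℓ 0ℓ
  rawRing = record
    { Carrier = ℚ[√ d ]
    ; _≈_ = _≡_
    ; _+_ = _+_
    ; _*_ = _*_
    ; -_ = -_
    ; 0# = 0#
    ; 1# = 1#
    }

  open RawSemiringDefinitions (RawRing.rawSemiring rawRing) public using (_^_)

  -- The determinant of multiplication by a + b√d, whose matrix in the basis
  -- 1, √d has rows (a, db) and (b, a).
  norm : ℚ[√ d ] → ℚ
  norm (a ⊕ b √d) = a ℚ.* a ℚ.- (+ d ℚ./ 1) ℚ.* (b ℚ.* b)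

  -- c₀ ∷ c₁ ∷ … ∷ cₖ₋₁ ∷ []  stands for the monic polynomial
  -- c₀ + c₁X + … + cₖ₋₁Xᵏ⁻¹ + Xᵏ.
  evalMonic : List ℤ → ℚ[√ d ] → ℚ[√ d ]
  evalMonic []       x = 1#
  evalMonic (c ∷ cs) x = fromℤ c + x * evalMonic cs x

  -- Membership in the ring of integers, the integral closure of ℤ in ℚ(√d).
  Integral : ℚ[√ d ] → Set
  Integral x = ∃[ cs ] evalMonic cs x ≡ 0#

  -- Units of the ring of integers (not of the field).
  IsUnit : ℚ[√ d ] → Set
  IsUnit x = Integral x × ∃[ y ] Integral y × x * y ≡ 1#

  -- Positivity in ℝ of a + b√d, where √d > 0 is the real number given by the
  -- Dedekind cut of the positive rationals l , r with l² < d < r².  As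
  -- t ↦ a + bt is affine, a + b√d > 0 exactly when some rational interval
  -- [ l , r ] around √d has a + bl > 0 and a + br > 0.
  Positive : ℚ[√ d ] → Set
  Positive (a ⊕ b √d) = ∃[ l ] ∃[ r ]
      (0ℚ ℚ.< l × l ℚ.* l ℚ.< (+ d ℚ./ 1))
    × (0ℚ ℚ.< r × (+ d ℚ./ 1) ℚ.< r ℚ.* r)
    × 0ℚ ℚ.< a ℚ.+ b ℚ.* l
    × 0ℚ ℚ.< a ℚ.+ b ℚ.* r

  infix 4 _<_
  _<_ : ℚ[√ d ] → ℚ[√ d ] → Set
  x < y = Positive (y - x)

-- A sequence (aₙ)ₙ≥₁ is a function ℕ → ℤ whose value at 0 is never used.

PrimitivePrimeDivisor : (ℕ → ℤ) → ℕ → ℕ → Set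
PrimitivePrimeDivisor a n p =
    Prime p
  × + p ℤ.∣ a n
  × (∀ m → 1 ℕ.≤ m → m ℕ.< n → a m ≢ 0ℤ → ¬ (+ p ℤ.∣ a m))

NoPrimitive : (ℕ → ℤ) → ℕ → Set
NoPrimitive a n = 1 ℕ.≤ n × ¬ ∃ (PrimitivePrimeDivisor a n)

-- The relation "Z(a) is finite and equals z"; Z(a) = ∞ is the case where no
-- such z exists.  If every term has a primitive prime divisor, the maximum of
-- the empty set is read as 0.
Z[_]≡_ : (ℕ → ℤ) → ℕ → Set
Z[ a ]≡ z = (∀ n → NoPrimitive a n → n ℕ.≤ z) × (z ≡ 0 ⊎ NoPrimitive a z)

Z[_]≤_ : (ℕ → ℤ) → ℕ → Set
Z[ a ]≤ b = ∃[ z ] Z[ a ]≡ z × z ℕ.≤ b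

NoPrimitiveExactlyAt : (ℕ → ℤ) → List ℕ → Set
NoPrimitiveExactlyAt a ns = ∀ n → NoPrimitive a n ⇔ n ∈ ns

-- Let t be the trace of u, so that −Δₙ = uⁿ + u⁻ⁿ − 2 is an integer sequence
-- δₙ depending on z = t − 2 only.  It is a strong divisibility sequence,
-- gcd (δₐ, δ_b) = δ_gcd(a,b), and a prime divisor of δₙ that is not primitive
-- divides δ_{n/q} for some prime q ∣ n.  Hence such a prime that divides
-- G = δₙ / lcm (δ_{n/q}) divides δₙ / δ_{n/q}, which is q² modulo δ_{n/q}, and
-- equals q.  As every odd prime q divides δ_{q−1} or δ_{q+1}, for n > 6 other
-- than 12 only one q can occur, and q³ ∤ G.  On the other hand inclusion and
-- exclusion writes G as ∏ δ_{n/d}^μ(d), which is at least u^φ(n) / 5 up to 1.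
-- Only finitely many (t, n) survive the comparison with q².

module Submission where

-- In ℚ(√u), δₙ is the square of u^(n/2) - u^(-n/2), a number outside the ring. That D divides δₙ
-- thus only says that D divides a square, and for composite D the gcd law cannot be read off a
-- linear recurrence; quadratic integral equations replace it. The growth estimate avoids real
-- numbers as well: uᵉ becomes V_{N+e} / V_N for large N, so that every inequality is one between
-- natural numbers. The constant 5 is the largest integer that the tightest case allows: for t = 3
-- and q = 3, where only φ(n) ≥ 4 is used, 5 · 3² + 1 = 46 must stay below V₄ = 47. Hence the care
-- with the infinite products behind it. The index 12 stands apart because 2 and 3 can both divide G
-- there, which is then (t² - 3)²; the prime factors of t² - 3 settle it. The index 10 is left out
-- for t = 3 only, where Δ₁₀ has no primitive prime divisor. Integrality refers to an arbitrary
-- monic polynomial, so that t is an integer also has to be proved.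

-- The sequence δ and its product formulas

module LucasSequence where

  open import Data.Nat using (ℕ; zero; suc; _+_; _*_)
  open import Data.Nat.Properties
  open import Data.Nat.Tactic.RingSolver using (solve-∀)
  open import Relation.Binary.PropositionalEquality using (_≡_; sym; trans; cong; cong₂; module ≡-Reasoning)

  mutual
    δ : ℕ → ℕ → ℕ
    δ z zero    = 0
    δ z (suc n) = δ z n + z * R z n

    -- The sum of uʲ over -n ≤ j ≤ n, so that z times it is the difference of consecutive δ.
    -- Building δ from its differences stays in ℕ, where the three-term recurrence would subtract.
    R : ℕ → ℕ → ℕ
    R z zero    = 1
    R z (suc n) = R z n + V z (suc n)

    V : ℕ → ℕ → ℕ
    V z n = 2 + δ z n

  V-rec : ∀ z n → V z (2 + n) + V z n ≡ (z + 2) * V z (1 + n)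
  V-rec z n = identity z (δ z n) (R z n)
    where
    identity : ∀ z d r → 2 + (d + z * r + z * (r + (2 + (d + z * r)))) + (2 + d) ≡ (z + 2) * (2 + (d + z * r))
    identity = solve-∀

  -- Multiply out uᵐ⁺ᵇ + u⁻ᵐ⁻ᵇ and uᵇ + u⁻ᵇ; the indices m + 2b and m avoid a difference of indices.
  -- In the induction the two earlier instances are taken at 2 + m and 1 + m, because all three then
  -- share the factor V at m + b + 2 and only the recurrences at both ends remain.
  V-product : ∀ z b m → V z (m + b + b) + V z m ≡ V z (m + b) * V z b
  V-product z zero m = trans (cong (λ k → V z k + V z m) (trans (+-identityʳ (m + 0)) (+-identityʳ m)))
      (trans (identity (V z m)) (cong (λ k → V z k * 2) (sym (+-identityʳ m))))
    where
    identity : ∀ v → v + v ≡ v * 2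
    identity = solve-∀
  V-product z (suc zero) m = trans (cong (λ k → V z k + V z m) (trans (cong (_+ 1) (+-comm m 1))
      (cong suc (+-comm m 1))))
    (trans (trans (V-rec z m) (identity z (V z (1 + m)))) (cong (λ k → V z k * V z 1) (sym (+-comm m 1))))
    where
    identity : ∀ z v → (z + 2) * v ≡ v * (2 + (0 + z * 1))
    identity = solve-∀
  V-product z (suc (suc b)) m = step z b m (V-product z b (2 + m)) (V-product z (suc b) (suc m))
    where
    step : ∀ z b m → V z (2 + m + b + b) + V z (2 + m) ≡ V z (2 + m + b) * V z b →
           V z (suc m + suc b + suc b) + V z (suc m) ≡ V z (suc m + suc b) * V z (suc b) →
           V z (m + suc (suc b) + suc (suc b)) + V z m ≡ V z (m + suc (suc b)) * V z (suc (suc b))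
    step z b m h₀ h₁ = +-cancelʳ-≡ (X * V z b) _ _ (begin
      V z (m + suc (suc b) + suc (suc b)) + V z m + X * V z b
        ≡⟨ cong (λ k → V z k + V z m + X * V z b) (index₁ m b) ⟩
      V z (2 + e) + V z m + X * V z b
        ≡⟨ cong (λ x → V z (2 + e) + V z m + x) ih₀ ⟨
      V z (2 + e) + V z m + (V z e + V z (2 + m))
        ≡⟨ swap (V z (2 + e)) (V z m) (V z e) (V z (2 + m)) ⟩
      (V z (2 + e) + V z e) + (V z (2 + m) + V z m)
        ≡⟨ cong₂ _+_ (V-rec z e) (V-rec z m) ⟩
      (z + 2) * V z (1 + e) + (z + 2) * V z (1 + m)
        ≡⟨ *-distribˡ-+ (z + 2) (V z (1 + e)) (V z (1 + m)) ⟨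
      (z + 2) * (V z (1 + e) + V z (1 + m))
        ≡⟨ cong ((z + 2) *_) ih₁ ⟩
      (z + 2) * (X * V z (suc b))
        ≡⟨ move z X (V z (suc b)) ⟩
      X * ((z + 2) * V z (suc b))
        ≡⟨ cong (X *_) (V-rec z b) ⟨
      X * (V z (2 + b) + V z b)
        ≡⟨ *-distribˡ-+ X (V z (2 + b)) (V z b) ⟩
      X * V z (2 + b) + X * V z b ∎)
      where
      open ≡-Reasoning
      X = V z (m + suc (suc b))
      e = 2 + m + b + b
      index₁ : ∀ m b → m + suc (suc b) + suc (suc b) ≡ 2 + (2 + m + b + b)
      index₁ = solve-∀
      index₂ : ∀ m b → suc m + suc b ≡ m + suc (suc b)
      index₂ = solve-∀
      index₃ : ∀ m b → 2 + m + b ≡ m + suc (suc b)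
      index₃ = solve-∀
      index₄ : ∀ m b → suc m + suc b + suc b ≡ 1 + (2 + m + b + b)
      index₄ = solve-∀
      swap : ∀ a b c d → a + b + (c + d) ≡ a + c + (d + b)
      swap = solve-∀
      move : ∀ z x y → (z + 2) * (x * y) ≡ x * ((z + 2) * y)
      move = solve-∀
      ih₀ : V z e + V z (2 + m) ≡ X * V z b
      ih₀ = trans h₀ (cong (λ k → V z k * V z b) (index₃ m b))
      ih₁ : V z (1 + e) + V z (1 + m) ≡ X * V z (suc b)
      ih₁ = trans (cong (λ k → V z k + V z (1 + m)) (sym (index₄ m b)))
           (trans h₁ (cong (λ k → V z k * V z (suc b)) (index₂ m b)))

  δ-sum : ∀ z b m → δ z (m + b + b) + δ z m ≡ δ z (m + b) * δ z b + 2 * δ z (m + b) + 2 * δ z b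
  δ-sum z b m = +-cancelˡ-≡ 4 _ _ (trans (lhs (δ z (m + b + b)) (δ z m)) (trans (V-product z b m) (rhs (δ z (m + b))
      (δ z b))))
    where
    lhs : ∀ x y → 4 + (x + y) ≡ (2 + x) + (2 + y)
    lhs = solve-∀
    rhs : ∀ x y → (2 + x) * (2 + y) ≡ 4 + (x * y + 2 * x + 2 * y)
    rhs = solve-∀

  -- δ z (m + 2b) · δ z m = (δ z (m + b) − δ z b)²
  δ-product : ∀ z b m → δ z (m + b + b) * δ z m + 2 * (δ z (m + b) * δ z b) ≡ δ z (m + b) * δ z (m + b) + δ z b * δ z
      b
  δ-product z b m = finish (δ z (m + b + b)) (δ z m) (δ z (m + b)) (δ z b) (δ z (m + b + m + b)) (δ z (b + b))
    (V-product z b m)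
    (trans (cong (λ i → V z i + V z (b + b)) (index₁ b m)) (trans (V-product z m (b + b)) (cong (λ i → V z i * V z m)
        (index₂ b m))))
    (trans (cong (λ i → V z i + 2) (index₃ b m)) (V-product z (m + b) 0))
    (V-product z b 0)
    where
    index₁ : ∀ b m → m + b + m + b ≡ b + b + m + m
    index₁ = solve-∀
    index₂ : ∀ b m → b + b + m ≡ m + b + b
    index₂ = solve-∀
    index₃ : ∀ b m → m + b + m + b ≡ m + b + (m + b)
    index₃ = solve-∀
    finish : ∀ y x a d s r → (2 + y) + (2 + x) ≡ (2 + a) * (2 + d) → (2 + s) + (2 + r) ≡ (2 + y) * (2 + x) →
             (2 + s) + 2 ≡ (2 + a) * (2 + a) → (2 + r) + 2 ≡ (2 + d) * (2 + d) →
             y * x + 2 * (a * d) ≡ a * a + d * d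
    finish y x a d s r e₁ e₂ e₃ e₄ = +-cancelʳ-≡ (12 + 2 * x + 2 * y + 4 * a + 4 * d) _ _ (begin
      y * x + 2 * (a * d) + (12 + 2 * x + 2 * y + 4 * a + 4 * d)
        ≡⟨ id₁ y x a d ⟩
      (2 + y) * (2 + x) + 2 * ((2 + a) * (2 + d))
        ≡⟨ cong₂ (λ p q → p + 2 * q) (sym e₂) (sym e₁) ⟩
      (2 + s) + (2 + r) + 2 * ((2 + y) + (2 + x))
        ≡⟨ id₂ y x s r ⟩
      ((2 + s) + 2) + ((2 + r) + 2) + (2 * x + 2 * y + 4)
        ≡⟨ cong₂ (λ p q → p + q + (2 * x + 2 * y + 4)) e₃ e₄ ⟩
      (2 + a) * (2 + a) + (2 + d) * (2 + d) + (2 * x + 2 * y + 4)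
        ≡⟨ id₃ y x a d ⟩
      a * a + d * d + (12 + 2 * x + 2 * y + 4 * a + 4 * d) ∎)
      where
      open ≡-Reasoning
      id₁ : ∀ y x a d → y * x + 2 * (a * d) + (12 + 2 * x + 2 * y + 4 * a + 4 * d) ≡ (2 + y) * (2 + x) + 2 *
          ((2 + a) * (2 + d))
      id₁ = solve-∀
      id₂ : ∀ y x s r → (2 + s) + (2 + r) + 2 * ((2 + y) + (2 + x)) ≡ ((2 + s) + 2) + ((2 + r) + 2) + (2 * x + 2 * y
          + 4)
      id₂ = solve-∀
      id₃ : ∀ y x a d → (2 + a) * (2 + a) + (2 + d) * (2 + d) + (2 * x + 2 * y + 4) ≡ a * a + d * d + (12 + 2 * x + 2
          * y + 4 * a + 4 * d)
      id₃ = solve-∀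

-- Strong divisibility, composition and expansions at u = 1

module StrongDivisibility where

  open import Data.Nat using (ℕ; zero; suc; _+_; _*_; _∸_; NonZero)
  open import Data.Nat.Coprimality using (Coprime; coprime-divisor; GCD≡1⇒coprime)
  open import Data.Nat.Divisibility
  open import Data.Nat.GCD using (gcd; gcd[m,n]∣m; gcd[m,n]∣n; gcd-greatest; GCD; gcd-GCD; GCD-*; module Bézout; gcd[m,n]≢0)
  open import Data.Nat.Properties
  open import Data.Nat.Tactic.RingSolver using (solve-∀)
  open import Data.Product using (∃-syntax; _×_; _,_; proj₁; proj₂)
  open import Data.Sum using (inj₁; inj₂)
  open import Relation.Binary.PropositionalEquality using (_≡_; refl; sym; trans; cong; cong₂; subst; subst₂; module ≡-Reasoning)
  open LucasSequence

  ∣m+n∣n⇒∣m : ∀ {i m n} → i ∣ m + n → i ∣ n → i ∣ m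
  ∣m+n∣n⇒∣m {i} {m} {n} i∣m+n = ∣m+n∣m⇒∣n (subst (i ∣_) (+-comm m n) i∣m+n)

  record CoprimeParts (m n : ℕ) : Set where
    field
      g m′ n′ : ℕ
      {{g≢0}} : NonZero g
      m≡ : m ≡ m′ * g
      n≡ : n ≡ n′ * g
      coprime : Coprime m′ n′

  coprimeParts : ∀ m n .{{_ : NonZero m}} → CoprimeParts m n
  coprimeParts m n = parts (gcd[m,n]∣m m n) (gcd[m,n]∣n m n)
    where
    instance
      gcd≢0 : NonZero (gcd m n)
      gcd≢0 = Data.Nat.≢-nonZero (gcd[m,n]≢0 m n (inj₁ (Data.Nat.≢-nonZero⁻¹ m)))
    parts : gcd m n ∣ m → gcd m n ∣ n → CoprimeParts m n
    parts (divides m′ m≡) (divides n′ n≡) = record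
      { g = gcd m n ; m′ = m′ ; n′ = n′ ; m≡ = m≡ ; n≡ = n≡
      ; coprime = GCD≡1⇒coprime (GCD-* (subst₂ (λ i j → GCD i j (1 * gcd m n)) m≡ n≡
          (subst (GCD m n) (sym (*-identityˡ (gcd m n))) (gcd-GCD m n)))) }

  -- Y is a root of the monic polynomial Y² − (Y + Z) Y + Y Z, so Y / D is
  -- integral over ℤ.
  ∣sum∧²∣product⇒∣ : ∀ D Y Z → D ∣ Y + Z → D * D ∣ Y * Z → D ∣ Y
  ∣sum∧²∣product⇒∣ zero    Y Z 0∣Y+Z _ = subst (0 ∣_) (sym (m+n≡0⇒m≡0 Y (0∣⇒≡0 0∣Y+Z))) ∣-refl
  ∣sum∧²∣product⇒∣ D@(suc _) Y Z (divides s Y+Z≡) (divides e YZ≡) = subst₂ _∣_ (sym m≡) (sym n≡) (*-monoˡ-∣ g m′∣n′)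
    where
    open CoprimeParts (coprimeParts D Y)
    identity₁ : ∀ y z → y * y + y * z ≡ y * (y + z)
    identity₁ = solve-∀
    identity₂ : ∀ n′ s m′ g → n′ * g * (s * (m′ * g)) ≡ g * g * (m′ * (n′ * s))
    identity₂ = solve-∀
    identity₃ : ∀ n′ g e m′ → n′ * g * (n′ * g) + e * (m′ * g * (m′ * g)) ≡ g * g * (n′ * n′ + m′ * (e * m′))
    identity₃ = solve-∀
    key : n′ * n′ + m′ * (e * m′) ≡ m′ * (n′ * s)
    key = *-cancelˡ-≡ _ _ (g * g) {{m*n≢0 g g {{g≢0}} {{g≢0}}}} (begin
      g * g * (n′ * n′ + m′ * (e * m′)) ≡⟨ identity₃ n′ g e m′ ⟨
      n′ * g * (n′ * g) + e * (m′ * g * (m′ * g)) ≡⟨ cong₂ (λ y d → y * y + e * (d * d)) n≡ m≡ ⟨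
      Y * Y + e * (D * D) ≡⟨ cong (Y * Y +_) YZ≡ ⟨
      Y * Y + Y * Z ≡⟨ identity₁ Y Z ⟩
      Y * (Y + Z) ≡⟨ cong (Y *_) Y+Z≡ ⟩
      Y * (s * D) ≡⟨ cong₂ (λ y d → y * (s * d)) n≡ m≡ ⟩
      n′ * g * (s * (m′ * g)) ≡⟨ identity₂ n′ s m′ g ⟩
      g * g * (m′ * (n′ * s)) ∎)
      where open ≡-Reasoning
    m′∣n′ : m′ ∣ n′
    m′∣n′ = coprime-divisor coprime (∣m+n∣n⇒∣m (subst (m′ ∣_) (sym key) (m∣m*n (n′ * s))) (m∣m*n (e * m′)))

  -- One step forward and one step back in an arithmetic progression of difference b. With A and B
  -- the two given terms, the outer terms have the sum AB + 2A + 2B, a multiple of D, and the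
  -- product (A - B)², a multiple of D². Bézout's identity needs just these two steps.
  δ-∣-steps : ∀ {D} z b m → D ∣ δ z (m + b) → D ∣ δ z b → D ∣ δ z (m + b + b) × D ∣ δ z m
  δ-∣-steps {D} z b m D∣a D∣b = ∣sum∧²∣product⇒∣ D Y Z D∣Y+Z D²∣YZ ,
    ∣sum∧²∣product⇒∣ D Z Y (subst (D ∣_) (+-comm Y Z) D∣Y+Z) (subst (D * D ∣_) (*-comm Y Z) D²∣YZ)
    where
    Y = δ z (m + b + b)
    Z = δ z m
    A = δ z (m + b)
    B = δ z b
    D∣Y+Z : D ∣ Y + Z
    D∣Y+Z = subst (D ∣_) (sym (δ-sum z b m))
      (∣m∣n⇒∣m+n (∣m∣n⇒∣m+n (∣m⇒∣m*n B D∣a) (∣n⇒∣m*n 2 D∣a)) (∣n⇒∣m*n 2 D∣b))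
    D²∣YZ : D * D ∣ Y * Z
    D²∣YZ = ∣m+n∣n⇒∣m (subst (D * D ∣_) (sym (δ-product z b m)) (∣m∣n⇒∣m+n (*-pres-∣ D∣a D∣a) (*-pres-∣ D∣b D∣b)))
      (∣n⇒∣m*n 2 (*-pres-∣ D∣a D∣b))

  δ-∣-+ : ∀ {D} z a b → D ∣ δ z a → D ∣ δ z b → D ∣ δ z (a + b)
  δ-∣-+ {D} z a b D∣a D∣b with ≤-total b a
  ... | inj₁ b≤a = subst (λ i → D ∣ δ z (i + b)) (m∸n+n≡m b≤a)
    (proj₁ (δ-∣-steps z b (a ∸ b) (subst (λ i → D ∣ δ z i) (sym (m∸n+n≡m b≤a)) D∣a) D∣b))
  ... | inj₂ a≤b = subst (λ i → D ∣ δ z i) (trans (cong (_+ a) (m∸n+n≡m a≤b)) (+-comm b a))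
    (proj₁ (δ-∣-steps z a (b ∸ a) (subst (λ i → D ∣ δ z i) (sym (m∸n+n≡m a≤b)) D∣b) D∣a))

  δ-∣-* : ∀ {D} z k b → D ∣ δ z b → D ∣ δ z (k * b)
  δ-∣-* {D} z zero    b D∣b = D ∣0
  δ-∣-* {D} z (suc k) b D∣b = δ-∣-+ z b (k * b) D∣b (δ-∣-* z k b D∣b)

  δ-mono-∣ : ∀ z {m n} → m ∣ n → δ z m ∣ δ z n
  δ-mono-∣ z {m} (divides k refl) = δ-∣-* z k m ∣-refl

  δ-∣-gcd : ∀ {D} z a b → D ∣ δ z a → D ∣ δ z b → D ∣ δ z (gcd a b)
  δ-∣-gcd {D} z a b D∣a D∣b with Bézout.identity (gcd-GCD a b)
  ... | Bézout.+- x y eq = proj₂ (δ-∣-steps z (y * b) (gcd a b) (subst (λ i → D ∣ δ z i) (sym eq) (δ-∣-* z x a D∣a))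
      (δ-∣-* z y b D∣b))
  ... | Bézout.-+ x y eq = proj₂ (δ-∣-steps z (x * a) (gcd a b) (subst (λ i → D ∣ δ z i) (sym eq) (δ-∣-* z y b D∣b))
      (δ-∣-* z x a D∣a))

  gcd-δ : ∀ z a b → gcd (δ z a) (δ z b) ≡ δ z (gcd a b)
  gcd-δ z a b = ∣-antisym (δ-∣-gcd z a b (gcd[m,n]∣m (δ z a) (δ z b)) (gcd[m,n]∣n (δ z a) (δ z b)))
    (gcd-greatest (δ-mono-∣ z (gcd[m,n]∣m a b)) (δ-mono-∣ z (gcd[m,n]∣n a b)))

  -- The trace of uᵐ is 2 + `δ z m`, so passing from u to uᵐ replaces the parameter z by `δ z m`.
  V-compose : ∀ z m j → V z (j * m) ≡ V (δ z m) j
  V-compose z m zero = refl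
  V-compose z m (suc zero) = trans (cong (V z) (*-identityˡ m)) (cong (2 +_) (sym (*-identityʳ (δ z m))))
  V-compose z m (suc (suc j)) = +-cancelʳ-≡ (V z (j * m)) _ _ (begin
    V z (m + (m + j * m)) + V z (j * m) ≡⟨ cong (λ i → V z i + V z (j * m)) (index m (j * m)) ⟩
    V z (j * m + m + m) + V z (j * m) ≡⟨ V-product z m (j * m) ⟩
    V z (j * m + m) * V z m ≡⟨ cong (λ i → V z i * V z m) (+-comm (j * m) m) ⟩
    V z (suc j * m) * V z m ≡⟨ cong (_* V z m) (V-compose z m (suc j)) ⟩
    V x (suc j) * (2 + x) ≡⟨ *-comm (V x (suc j)) (2 + x) ⟩
    (2 + x) * V x (suc j) ≡⟨ cong (_* V x (suc j)) (+-comm 2 x) ⟩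
    (x + 2) * V x (suc j) ≡⟨ V-rec x j ⟨
    V x (2 + j) + V x j ≡⟨ cong (V x (2 + j) +_) (V-compose z m j) ⟨
    V x (2 + j) + V z (j * m) ∎)
    where
    open ≡-Reasoning
    x = δ z m
    index : ∀ m k → m + (m + k) ≡ k + m + m
    index = solve-∀

  δ-compose : ∀ z m j → δ z (j * m) ≡ δ (δ z m) j
  δ-compose z m j = +-cancelˡ-≡ 2 _ _ (V-compose z m j)

  -- At m = 1, `δ-product` says that z times the left side is the square of δ_{b+1} - δ_b, which is
  -- z · R_b by definition.
  δ-odd : ∀ z b .{{_ : NonZero z}} → δ z (1 + b + b) ≡ z * (R z b * R z b)
  δ-odd z b = *-cancelʳ-≡ _ _ z (+-cancelʳ-≡ (2 * ((δ z b + z * R z b) * δ z b)) _ _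
    (trans (cong (λ i → δ z (1 + b + b) * i + 2 * ((δ z b + z * R z b) * δ z b)) (sym (*-identityʳ z)))
    (trans (δ-product z b 1) (identity z (δ z b) (R z b)))))
    where
    identity : ∀ z d r → (d + z * r) * (d + z * r) + d * d ≡ z * (r * r) * z + 2 * ((d + z * r) * d)
    identity = solve-∀

  sumSquares : ℕ → ℕ
  sumSquares zero    = 0
  sumSquares (suc b) = sumSquares b + suc b * suc b

  6*sumSquares : ∀ b → 6 * sumSquares b ≡ b * (1 + b) * (1 + b + b)
  6*sumSquares zero    = refl
  6*sumSquares (suc b) = trans (*-distribˡ-+ 6 (sumSquares b) (suc b * suc b)) (trans (cong (_+ 6 * (suc b * suc b))
      (6*sumSquares b)) (identity b))
    where
    identity : ∀ b → b * (1 + b) * (1 + b + b) + 6 * ((1 + b) * (1 + b)) ≡ (1 + b) * (2 + b) * (1 + (1 + b) + (1 + b))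
    identity = solve-∀

  -- Taylor expansions at z = 0, that is at u = 1, where V_j begins with 2 + j² z. The linear term
  -- of `R` is made explicit because, for p = 2b + 1 dividing z, the value of `R` is wanted modulo
  -- p².
  δ-expansion : ∀ z b → ∃[ e ] δ z b ≡ b * b * z + z * z * e
  R-expansion : ∀ z b → ∃[ e ] R z b ≡ (1 + b + b) + z * sumSquares b + z * z * e
  δ-expansion z zero = 0 , sym (*-zeroʳ (z * z))
  δ-expansion z (suc b) with δ-expansion z b | R-expansion z b
  ... | e , δ≡ | e′ , R≡ = e + sumSquares b + z * e′ , trans (cong₂ (λ d r → d + z * r) δ≡ R≡) (identity z b
      (sumSquares b) e e′)
    where
    identity : ∀ z b s e e′ → b * b * z + z * z * e + z * (1 + b + b + z * s + z * z * e′) ≡ (1 + b) * (1 + b) * z +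
        z * z * (e + s + z * e′)
    identity = solve-∀
  R-expansion z zero = 0 , identity z
    where
    identity : ∀ z → 1 ≡ 1 + z * 0 + z * z * 0
    identity = solve-∀
  R-expansion z (suc b) with R-expansion z b | δ-expansion z b
  ... | e , R≡ | e′ , δ≡ = e + e′ + sumSquares b + z * e , trans (cong₂ (λ d r → r + (2 + (d + z * r))) δ≡ R≡)
      (identity z b (sumSquares b) e e′)
    where
    identity : ∀ z b s e e′ → 1 + b + b + z * s + z * z * e + (2 + (b * b * z + z * z * e′ + z * (1 + b + b + z * s +
        z * z * e)))
             ≡ 1 + (1 + b) + (1 + b) + z * (s + (1 + b) * (1 + b)) + z * z * (e + e′ + s + z * e)
    identity = solve-∀

  δ-two : ∀ z → δ z 2 ≡ z * (4 + z)
  δ-two = identity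
    where
    identity : ∀ z → 0 + z * 1 + z * (1 + (2 + (0 + z * 1))) ≡ z * (4 + z)
    identity = solve-∀

-- Every odd prime q divides δ_{q-1} or δ_{q+1}

module RankOfApparition where

  open import Data.Empty using (⊥-elim)
  open import Data.Nat using (ℕ; zero; suc; _+_; _*_; _^_; _<_; z≤n; s≤s; ∣_-_∣)
  open import Data.Nat.Combinatorics using (_C_; nCk+nC[k+1]≡[n+1]C[k+1]; nCn≡1; nC1≡n; k>n⇒nCk≡0)
  open import Data.Nat.Divisibility
  open import Data.Nat.Primality using (Prime; euclidsLemma; prime[2]; prime⇒irreducible; ¬prime[1]; ¬prime[0])
  open import Data.Nat.Properties
  open import Data.Nat.Tactic.RingSolver using (solve-∀)
  open import Data.Product using (∃-syntax; _,_; proj₁; proj₂)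
  open import Data.Sum using (_⊎_; inj₁; inj₂; swap)
  open import Function using (_∘_)
  open import Relation.Binary.PropositionalEquality using (_≡_; _≢_; refl; sym; trans; cong; cong₂; subst; module ≡-Reasoning)
  open LucasSequence
  open StrongDivisibility

  nC0≡1 : ∀ n → n C 0 ≡ 1
  nC0≡1 zero = refl
  nC0≡1 (suc n) = refl

  C-absorption : ∀ n k → suc k * (suc n C suc k) ≡ suc n * (n C k)
  C-absorption n zero = trans (*-identityˡ _) (trans (nC1≡n (suc n)) (sym (trans (cong (suc n *_) (nC0≡1 n))
      (*-identityʳ (suc n)))))
  C-absorption zero (suc k) = trans (cong (suc (suc k) *_) (k>n⇒nCk≡0 {1} {suc (suc k)} (s≤s (s≤s z≤n))))
      (trans (*-zeroʳ (suc (suc k))) (sym (cong (1 *_) (k>n⇒nCk≡0 {0} {suc k} (s≤s z≤n)))))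
  C-absorption (suc n) (suc k) = begin
    suc (suc k) * (suc (suc n) C suc (suc k)) ≡⟨ cong (suc (suc k) *_) (nCk+nC[k+1]≡[n+1]C[k+1] (suc n) (suc k)) ⟨
    suc (suc k) * ((suc n C suc k) + (suc n C suc (suc k))) ≡⟨ *-distribˡ-+ (suc (suc k)) (suc n C suc k) _ ⟩
    (suc n C suc k) + suc k * (suc n C suc k) + suc (suc k) * (suc n C suc (suc k)) ≡⟨ cong₂ (λ i j → (suc n C suc k)
        + i + j) (C-absorption n k) (C-absorption n (suc k)) ⟩
    (suc n C suc k) + suc n * (n C k) + suc n * (n C suc k) ≡⟨ +-assoc (suc n C suc k) _ _ ⟩
    (suc n C suc k) + (suc n * (n C k) + suc n * (n C suc k)) ≡⟨ cong ((suc n C suc k) +_) (*-distribˡ-+ (suc n)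
        (n C k) _) ⟨
    (suc n C suc k) + suc n * ((n C k) + (n C suc k)) ≡⟨ cong (λ i → (suc n C suc k) + suc n * i)
        (nCk+nC[k+1]≡[n+1]C[k+1] n k) ⟩
    suc (suc n) * (suc n C suc k) ∎
    where open ≡-Reasoning

  prime∣C : ∀ {n} k → Prime (suc n) → suc k < suc n → suc n ∣ suc n C suc k
  prime∣C {n} k pr k<n with euclidsLemma (suc k) (suc n C suc k) pr (subst (suc n ∣_) (sym (C-absorption n k))
      (m∣m*n (n C k)))
  ... | inj₁ p∣k = ⊥-elim (<⇒≱ k<n (∣⇒≤ p∣k))
  ... | inj₂ p∣C = p∣C

  Σ< : ℕ → (ℕ → ℕ) → ℕ
  Σ< zero    g = 0
  Σ< (suc n) g = g 0 + Σ< n (g ∘ suc)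

  Σ<-cong : ∀ n {g h : ℕ → ℕ} → (∀ i → g i ≡ h i) → Σ< n g ≡ Σ< n h
  Σ<-cong zero    g≗h = refl
  Σ<-cong (suc n) g≗h = cong₂ _+_ (g≗h 0) (Σ<-cong n (g≗h ∘ suc))

  Σ<-+ : ∀ n (g h : ℕ → ℕ) → Σ< n (λ i → g i + h i) ≡ Σ< n g + Σ< n h
  Σ<-+ zero    g h = refl
  Σ<-+ (suc n) g h = trans (cong (g 0 + h 0 +_) (Σ<-+ n (g ∘ suc) (h ∘ suc))) (identity (g 0) (h 0) _ _)
    where
    identity : ∀ a b c d → a + b + (c + d) ≡ a + c + (b + d)
    identity = solve-∀

  Σ<-last : ∀ n (g : ℕ → ℕ) → Σ< (suc n) g ≡ Σ< n g + g n
  Σ<-last zero    g = +-identityʳ (g 0)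
  Σ<-last (suc n) g = trans (cong (g 0 +_) (Σ<-last n (g ∘ suc))) (sym (+-assoc (g 0) _ _))

  ∣Σ< : ∀ {d} n (g : ℕ → ℕ) → (∀ i → i < n → d ∣ g i) → d ∣ Σ< n g
  ∣Σ< {d} zero    g d∣g = d ∣0
  ∣Σ< (suc n) g d∣g = ∣m∣n⇒∣m+n (d∣g 0 (s≤s z≤n)) (∣Σ< n (g ∘ suc) (λ i i<n → d∣g (suc i) (s≤s i<n)))

  -- (1 + E)ʲ f, where E is the shift f ↦ f ∘ suc
  [1+E]^ : ℕ → (ℕ → ℕ) → ℕ → ℕ
  [1+E]^ zero    f a = f a
  [1+E]^ (suc j) f a = [1+E]^ j f a + [1+E]^ j f (suc a)

  [1+E]^-binomial : ∀ j f a → [1+E]^ j f a ≡ Σ< (suc j) (λ i → (j C i) * f (i + a))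
  [1+E]^-binomial zero f a = sym (trans (+-identityʳ _) (*-identityˡ (f a)))
  [1+E]^-binomial (suc j) f a = begin
    [1+E]^ j f a + [1+E]^ j f (suc a)
      ≡⟨ cong₂ _+_ ([1+E]^-binomial j f a) ([1+E]^-binomial j f (suc a)) ⟩
    Σ< (suc j) (λ i → (j C i) * f (i + a)) + Σ< (suc j) (λ i → (j C i) * f (i + suc a))
      ≡⟨ cong₂ _+_ pad (Σ<-cong (suc j) (λ i → cong (λ k → (j C i) * f k) (+-suc i a))) ⟩
    (j C 0) * f a + S₁ + S₀
      ≡⟨ cong (λ i → i * f a + S₁ + S₀) (trans (nC0≡1 j) (sym (nC0≡1 (suc j)))) ⟩
    (suc j C 0) * f a + S₁ + S₀
      ≡⟨ trans (+-assoc ((suc j C 0) * f a) S₁ S₀) (cong ((suc j C 0) * f a +_) (+-comm S₁ S₀)) ⟩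
    (suc j C 0) * f a + (S₀ + S₁)
      ≡⟨ cong ((suc j C 0) * f a +_) (Σ<-+ (suc j) (λ i → (j C i) * f (suc i + a)) (λ i → (j C suc i) * f
          (suc i + a))) ⟨
    (suc j C 0) * f a + Σ< (suc j) (λ i → (j C i) * f (suc i + a) + (j C suc i) * f (suc i + a))
      ≡⟨ cong ((suc j C 0) * f a +_) (Σ<-cong (suc j) (λ i → trans (sym (*-distribʳ-+ (f (suc i + a)) (j C i) _))
          (cong (_* f (suc i + a)) (nCk+nC[k+1]≡[n+1]C[k+1] j i)))) ⟩
    Σ< (suc (suc j)) (λ i → (suc j C i) * f (i + a)) ∎
    where
    open ≡-Reasoning
    S₀ S₁ : ℕ
    S₀ = Σ< (suc j) (λ i → (j C i) * f (suc i + a))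
    S₁ = Σ< (suc j) (λ i → (j C suc i) * f (suc i + a))
    pad : Σ< (suc j) (λ i → (j C i) * f (i + a)) ≡ Σ< (suc (suc j)) (λ i → (j C i) * f (i + a))
    pad = sym (trans (Σ<-last (suc j) (λ i → (j C i) * f (i + a))) (trans (cong (λ c → Σ< (suc j) (λ i → (j C i) * f
        (i + a)) + c * f (suc j + a)) (k>n⇒nCk≡0 {j} {suc j} ≤-refl)) (+-identityʳ _)))

  -- (1 + E)ᵖ ≡ 1 + Eᵖ modulo p, since p divides the inner binomial coefficients. Acting on
  -- arbitrary sequences, it serves both the powers cᵃ in Fermat's theorem and the traces `V`.
  [1+E]^-prime : ∀ {p} → Prime p → ∀ f a → ∃[ e ] [1+E]^ p f a ≡ f a + f (p + a) + p * e
  [1+E]^-prime {zero} pr = ⊥-elim (¬prime[0] pr)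
  [1+E]^-prime {suc n} pr f a with ∣Σ< n (λ i → (suc n C suc i) * f (suc i + a)) (λ i i<n → ∣m⇒∣m*n _ (prime∣C i pr
      (s≤s i<n)))
  ... | divides e eq = e , (begin
    [1+E]^ (suc n) f a ≡⟨ [1+E]^-binomial (suc n) f a ⟩
    (suc n C 0) * f a + Σ< (suc n) (λ i → (suc n C suc i) * f (suc i + a)) ≡⟨ cong₂ _+_ (cong (_* f a)
        (nC0≡1 (suc n))) (Σ<-last n _) ⟩
    1 * f a + (Σ< n _ + (suc n C suc n) * f (suc n + a)) ≡⟨ cong₂ (λ x y → 1 * f a + (x + y * f (suc n + a))) eq
        (nCn≡1 (suc n)) ⟩
    1 * f a + (e * suc n + 1 * f (suc n + a)) ≡⟨ identity (f a) (f (suc n + a)) e (suc n) ⟩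
    f a + f (suc n + a) + suc n * e ∎)
    where
    open ≡-Reasoning
    identity : ∀ x y e p → 1 * x + (e * p + 1 * y) ≡ x + y + p * e
    identity = solve-∀

  fermat : ∀ {p} → Prime p → ∀ c → ∃[ e ] c ^ p ≡ c + p * e
  fermat {zero} pr = ⊥-elim (¬prime[0] pr)
  fermat {suc n} pr zero = 0 , sym (*-zeroʳ (suc n))
  fermat {p@(suc n)} pr (suc c) = e + e′ , (begin
    suc c ^ p ≡⟨ *-identityʳ _ ⟨
    suc c ^ p * c ^ 0 ≡⟨ geometric p 0 ⟨
    [1+E]^ p (c ^_) 0 ≡⟨ proj₂ binomial ⟩
    1 + c ^ (p + 0) + p * e′ ≡⟨ cong (λ k → 1 + c ^ k + p * e′) (+-identityʳ p) ⟩
    1 + c ^ p + p * e′ ≡⟨ cong (λ k → 1 + k + p * e′) (proj₂ (fermat pr c)) ⟩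
    1 + (c + p * e) + p * e′ ≡⟨ identity c p e e′ ⟩
    suc c + p * (e + e′) ∎)
    where
    open ≡-Reasoning
    binomial : ∃[ e ] [1+E]^ p (c ^_) 0 ≡ 1 + c ^ (p + 0) + p * e
    binomial = [1+E]^-prime pr (c ^_) 0
    e e′ : ℕ
    e = proj₁ (fermat pr c)
    e′ = proj₁ binomial
    identity : ∀ c p e e′ → 1 + (c + p * e) + p * e′ ≡ (1 + c) + p * (e + e′)
    identity = solve-∀
    identity₂ : ∀ x y c → x * y + x * (c * y) ≡ (1 + c) * x * y
    identity₂ = solve-∀
    geometric : ∀ j a → [1+E]^ j (c ^_) a ≡ suc c ^ j * c ^ a
    geometric zero    a = sym (+-identityʳ (c ^ a))
    geometric (suc j) a = trans (cong₂ _+_ (geometric j a) (geometric j (suc a))) (identity₂ (suc c ^ j) (c ^ a) c)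

  -- As V₋ₙ = Vₙ, the absolute difference extends `V` to negative indices inside ℕ, and the
  -- recurrence survives the passage through 0.
  V-∣-∣ : ∀ z x p → V z ∣ x - p ∣ + V z ∣ 2 + x - p ∣ ≡ (z + 2) * V z ∣ 1 + x - p ∣
  V-∣-∣ z x zero = trans (cong (λ i → V z i + V z (2 + x)) (∣-∣-identityʳ x)) (trans (+-comm (V z x) _) (V-rec z x))
  V-∣-∣ z zero (suc zero) = identity z
    where
    identity : ∀ z → (2 + (0 + z * 1)) + (2 + (0 + z * 1)) ≡ (z + 2) * 2
    identity = solve-∀
  V-∣-∣ z zero (suc (suc p)) = trans (cong (λ i → V z (2 + p) + V z i) (∣-∣-identityˡ p)) (V-rec z p)
  V-∣-∣ z (suc x) (suc p) = V-∣-∣ z x p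

  -- Take traces in (u + u⁻¹)ᵖ = Σ C(p, i) u^(2i - p): modulo p only i = 0 and i = p remain, so 2 tᵖ
  -- ≡ 2 V_p. Fermat's theorem replaces tᵖ by t = V₁, and the factor 2 cancels because p is odd. `r`
  -- stands for the difference δ_p - δ₁.
  prime∣δ∸δ : ∀ z {p} → Prime p → p ≢ 2 → ∀ r → δ z p ≡ δ z 1 + r → p ∣ r
  prime∣δ∸δ z {p} pr p≢2 r δp≡ = cases (euclidsLemma 2 r pr (∣m+n∣n⇒∣m (subst (p ∣_) key (m∣m*n (2 * e′))) (m∣m*n e)))
    where
    frobenius : ∃[ e ] [1+E]^ p (λ a → V z ∣ a + a - p ∣) 0 ≡ V z ∣ 0 - p ∣ + V z ∣ p + 0 + (p + 0) - p ∣ + p * e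
    frobenius = [1+E]^-prime pr (λ a → V z ∣ a + a - p ∣) 0
    e = proj₁ frobenius
    e′ = proj₁ (fermat pr (z + 2))
    shifts : ∀ j a → [1+E]^ j (λ a → V z ∣ a + a - p ∣) a ≡ (z + 2) ^ j * V z ∣ j + (a + a) - p ∣
    shifts zero    a = sym (+-identityʳ _)
    shifts (suc j) a = begin
      _ ≡⟨ cong₂ _+_ (shifts j a) (shifts j (suc a)) ⟩
      (z + 2) ^ j * V z ∣ j + (a + a) - p ∣ + (z + 2) ^ j * V z ∣ j + (suc a + suc a) - p ∣ ≡⟨ *-distribˡ-+
          ((z + 2) ^ j) _ _ ⟨
      (z + 2) ^ j * (V z ∣ j + (a + a) - p ∣ + V z ∣ j + (suc a + suc a) - p ∣) ≡⟨ cong (λ i → (z + 2) ^ j *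
          (V z ∣ j + (a + a) - p ∣ + V z ∣ i - p ∣)) (index j a) ⟩
      (z + 2) ^ j * (V z ∣ j + (a + a) - p ∣ + V z ∣ 2 + (j + (a + a)) - p ∣) ≡⟨ cong ((z + 2) ^ j *_)
          (V-∣-∣ z (j + (a + a)) p) ⟩
      (z + 2) ^ j * ((z + 2) * V z ∣ 1 + (j + (a + a)) - p ∣) ≡⟨ *-assoc ((z + 2) ^ j) (z + 2) _ ⟨
      (z + 2) ^ j * (z + 2) * V z ∣ 1 + (j + (a + a)) - p ∣ ≡⟨ cong (_* V z ∣ 1 + (j + (a + a)) - p ∣)
          (*-comm ((z + 2) ^ j) (z + 2)) ⟩
      (z + 2) ^ suc j * V z ∣ suc j + (a + a) - p ∣ ∎
      where
      open ≡-Reasoning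
      index : ∀ j a → j + ((1 + a) + (1 + a)) ≡ 2 + (j + (a + a))
      index = solve-∀
    doubled : (z + 2 + p * e′) * 2 ≡ V z p + V z p + p * e
    doubled = begin
      (z + 2 + p * e′) * 2 ≡⟨ cong (_* 2) (proj₂ (fermat pr (z + 2))) ⟨
      (z + 2) ^ p * V z 0 ≡⟨ cong (λ i → (z + 2) ^ p * V z i) (trans (cong (λ i → ∣ i - p ∣) (+-identityʳ p))
          (∣n-n∣≡0 p)) ⟨
      (z + 2) ^ p * V z ∣ p + 0 - p ∣ ≡⟨ shifts p 0 ⟨
      _ ≡⟨ proj₂ frobenius ⟩
      V z ∣ 0 - p ∣ + V z ∣ p + 0 + (p + 0) - p ∣ + p * e ≡⟨ cong₂ (λ i j → V z i + V z j + p * e) (∣-∣-identityˡ p)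
          (trans (cong (λ i → ∣ i + i - p ∣) (+-identityʳ p)) (trans (∣-∣-comm (p + p) p) (∣m-m+n∣≡n p p))) ⟩
      V z p + V z p + p * e ∎
      where open ≡-Reasoning
    key : p * (2 * e′) ≡ 2 * r + p * e
    key = +-cancelˡ-≡ (2 * (z + 2)) _ _ (trans (id₁ z p e′) (trans doubled (trans (cong (λ d → 2 + d + (2 + d) + p *
        e) δp≡) (id₂ z r (p * e)))))
      where
      id₁ : ∀ z p e′ → 2 * (z + 2) + p * (2 * e′) ≡ (z + 2 + p * e′) * 2
      id₁ = solve-∀
      id₂ : ∀ z r x → 2 + (0 + z * 1 + r) + (2 + (0 + z * 1 + r)) + x ≡ 2 * (z + 2) + (2 * r + x)
      id₂ = solve-∀
    cases : p ∣ 2 ⊎ p ∣ r → p ∣ r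
    cases (inj₂ p∣r) = p∣r
    cases (inj₁ p∣2) with prime⇒irreducible prime[2] p∣2
    ... | inj₁ refl = ⊥-elim (¬prime[1] pr)
    ... | inj₂ p≡2 = ⊥-elim (p≢2 p≡2)

  δ-step-≤ : ∀ z n → ∃[ r ] δ z (suc n) ≡ δ z 1 + r
  δ-step-≤ z zero = 0 , sym (+-identityʳ _)
  δ-step-≤ z (suc n) with δ-step-≤ z n
  ... | r , eq = r + z * R z (suc n) , trans (cong (_+ z * R z (suc n)) eq) (+-assoc (δ z 1) r _)

  -- For p = n + 1, the product δ_{p+1} δ_{p-1} is the square of δ_p - δ₁, which p divides.
  rank : ∀ z {n} → Prime (suc n) → suc n ≢ 2 → suc n ∣ δ z n ⊎ suc n ∣ δ z (2 + n)
  rank z {n} pr p≢2 = swap (euclidsLemma (δ z (2 + n)) (δ z n) pr (subst (suc n ∣_) (sym square) (∣m⇒∣m*n r p∣r)))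
    where
    r = proj₁ (δ-step-≤ z n)
    δp≡ = proj₂ (δ-step-≤ z n)
    p∣r : suc n ∣ r
    p∣r = prime∣δ∸δ z pr p≢2 r δp≡
    square : δ z (2 + n) * δ z n ≡ r * r
    square = +-cancelʳ-≡ (2 * (δ z (suc n) * δ z 1)) _ _ (begin
      δ z (2 + n) * δ z n + 2 * (δ z (suc n) * δ z 1) ≡⟨ cong₂ (λ i j → δ z i * δ z n + 2 * (δ z j * δ z 1))
          (trans (cong (_+ 1) (+-comm n 1)) (+-comm (suc n) 1)) (+-comm n 1) ⟨
      δ z (n + 1 + 1) * δ z n + 2 * (δ z (n + 1) * δ z 1) ≡⟨ δ-product z 1 n ⟩
      δ z (n + 1) * δ z (n + 1) + δ z 1 * δ z 1 ≡⟨ cong (λ i → δ z i * δ z i + δ z 1 * δ z 1) (+-comm n 1) ⟩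
      δ z (suc n) * δ z (suc n) + δ z 1 * δ z 1 ≡⟨ cong (λ d → d * d + δ z 1 * δ z 1) δp≡ ⟩
      (δ z 1 + r) * (δ z 1 + r) + δ z 1 * δ z 1 ≡⟨ identity (δ z 1) r ⟩
      r * r + 2 * ((δ z 1 + r) * δ z 1) ≡⟨ cong (λ d → r * r + 2 * (d * δ z 1)) δp≡ ⟨
      r * r + 2 * (δ z (suc n) * δ z 1) ∎)
      where
      open ≡-Reasoning
      identity : ∀ d r → (d + r) * (d + r) + d * d ≡ r * r + 2 * ((d + r) * d)
      identity = solve-∀

-- The quotient G of δₙ by the lcm of the δ_{n/q}

module CyclotomicPart where

  open import Data.List using (List; []; _∷_)
  open import Data.List.Membership.Propositional using (_∈_)
  open import Data.List.Relation.Unary.All using (All; []; _∷_)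
  open import Data.List.Relation.Unary.Any using (here; there)
  open import Data.Nat using (ℕ; zero; suc; _*_; NonZero; ≢-nonZero; ≢-nonZero⁻¹)
  open import Data.Nat.Coprimality using (Coprime; coprime⇒gcd≡1)
  open import Data.Nat.Divisibility
  open import Data.Nat.GCD using (gcd; gcd[m,n]∣m; gcd[m,n]∣n; gcd-greatest; gcd[m,n]≢0; gcd-zeroˡ; c*gcd[m,n]≡gcd[cm,cn])
  open import Data.Nat.LCM using (lcm; m∣lcm[m,n]; n∣lcm[m,n]; lcm-least; gcd*lcm)
  open import Data.Nat.ListAction using (product)
  open import Data.Nat.Properties
  open import Data.Nat.Tactic.RingSolver using (solve-∀)
  open import Data.Sum using (inj₁; inj₂)
  open import Function using (it)
  open import Relation.Binary.PropositionalEquality using (_≡_; _≢_; refl; sym; trans; cong; cong₂; subst; module ≡-Reasoning)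
  open LucasSequence
  open StrongDivisibility

  -- For the nontrivial half, let h be the gcd of gcd(x, d) and gcd(y, d). Then h · e divides both x
  -- · gcd(y, d) and d · gcd(y, d), hence gcd(x, d) · gcd(y, d), which is h times the lcm on the
  -- right; cancel h.
  gcd-distribʳ-lcm : ∀ x y d .{{_ : NonZero d}} → gcd (lcm x y) d ≡ lcm (gcd x d) (gcd y d)
  gcd-distribʳ-lcm x y d = ∣-antisym left right
    where
    e = gcd (lcm x y) d
    e∣d = gcd[m,n]∣n (lcm x y) d
    h = gcd (gcd x d) (gcd y d)
    instance
      h≢0 : NonZero h
      h≢0 = ≢-nonZero (gcd[m,n]≢0 (gcd x d) (gcd y d) (inj₁ (gcd[m,n]≢0 x d (inj₂ (≢-nonZero⁻¹ d)))))
    h∣x : h ∣ x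
    h∣x = ∣-trans (gcd[m,n]∣m _ _) (gcd[m,n]∣m x d)
    h∣y : h ∣ y
    h∣y = ∣-trans (gcd[m,n]∣n (gcd x d) (gcd y d)) (gcd[m,n]∣m y d)
    h∣d : h ∣ d
    h∣d = ∣-trans (gcd[m,n]∣m _ _) (gcd[m,n]∣n x d)
    he∣xy : h * e ∣ x * y
    he∣xy = subst (h * e ∣_) (gcd*lcm x y) (*-pres-∣ (gcd-greatest h∣x h∣y) (gcd[m,n]∣m (lcm x y) d))
    he∣x*gcd : h * e ∣ gcd y d * x
    he∣x*gcd = subst (h * e ∣_) (trans (sym (c*gcd[m,n]≡gcd[cm,cn] x y d)) (*-comm x _))
      (gcd-greatest he∣xy (*-pres-∣ h∣x e∣d))
    he∣d*gcd : h * e ∣ gcd y d * d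
    he∣d*gcd = subst (h * e ∣_) (trans (sym (c*gcd[m,n]≡gcd[cm,cn] d y d)) (*-comm d _))
      (gcd-greatest (subst (_∣ d * y) (*-comm e h) (*-pres-∣ e∣d h∣y)) (*-pres-∣ h∣d e∣d))
    left : e ∣ lcm (gcd x d) (gcd y d)
    left = *-cancelˡ-∣ h (subst (h * e ∣_)
      (trans (sym (c*gcd[m,n]≡gcd[cm,cn] (gcd y d) x d)) (trans (*-comm (gcd y d) (gcd x d)) (sym (gcd*lcm (gcd x d)
          (gcd y d)))))
      (gcd-greatest he∣x*gcd he∣d*gcd))
    right : lcm (gcd x d) (gcd y d) ∣ e
    right = gcd-greatest
      (lcm-least (∣-trans (gcd[m,n]∣m x d) (m∣lcm[m,n] x y)) (∣-trans (gcd[m,n]∣m y d) (n∣lcm[m,n] x y)))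
      (lcm-least (gcd[m,n]∣n x d) (gcd[m,n]∣n y d))

  δ≢0 : ∀ z n .{{_ : NonZero z}} .{{_ : NonZero n}} → NonZero (δ z n)
  δ≢0 (suc z) (suc n) = ≢-nonZero λ eq → R≢0 n (m+n≡0⇒m≡0 (R (suc z) n) (m+n≡0⇒n≡0 (δ (suc z) n) eq))
    where
    R≢0 : ∀ n → R (suc z) n ≢ 0
    R≢0 zero    ()
    R≢0 (suc n) eq = R≢0 n (m+n≡0⇒m≡0 (R (suc z) n) eq)

  -- The least common multiple of the δ z (n / q) for q ∈ L, where n = k * product L.
  A : ℕ → List ℕ → ℕ → ℕ
  A z []      k = 1
  A z (q ∷ L) k = lcm (A z L (k * q)) (δ z (k * product L))

  A∣δ : ∀ z L k → A z L k ∣ δ z (k * product L)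
  A∣δ z []      k = 1∣ _
  A∣δ z (q ∷ L) k = lcm-least
    (subst (λ i → A z L (k * q) ∣ δ z i) (*-assoc k q (product L)) (A∣δ z L (k * q)))
    (δ-mono-∣ z (*-monoʳ-∣ k (n∣m*n q)))

  δ∣A : ∀ z L k {q m} .{{_ : NonZero q}} → q ∈ L → k * product L ≡ q * m → δ z m ∣ A z L k
  δ∣A z (q ∷ L) k {m = m} (here refl) eq = subst (λ i → δ z i ∣ A z (q ∷ L) k)
    (*-cancelˡ-≡ _ _ q (trans (identity q k (product L)) eq)) (n∣lcm[m,n] (A z L (k * q)) _)
    where
    identity : ∀ q k x → q * (k * x) ≡ k * (q * x)
    identity = solve-∀
  δ∣A z (q′ ∷ L) k (there q∈L) eq = ∣-trans (δ∣A z L (k * q′) q∈L (trans (*-assoc k q′ (product L)) eq)) (m∣lcm[m,n]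
      _ _)

  product≢0 : ∀ {L} → All NonZero L → NonZero (product L)
  product≢0 [] = _
  product≢0 (_∷_ {q} {L} q≢0 L≢0) = m*n≢0 q (product L) {{q≢0}} {{product≢0 L≢0}}

  -- The gcd distributes over the lcm and, on values of δ, turns into the gcd of the indices. Since
  -- q is prime to q′, the indices k q ∏L / q′ and k ∏L have the gcd k ∏L / q′.
  gcd-A : ∀ z .{{_ : NonZero z}} L q k .{{_ : NonZero k}} → All NonZero L → All (Coprime q) L →
          gcd (A z L (k * q)) (δ z (k * product L)) ≡ A z L k
  gcd-A z []       q k _ _ = gcd-zeroˡ (δ z (k * 1))
  gcd-A z (q′ ∷ L) q k (q′≢0 ∷ L≢0) (cop ∷ cops) = begin
    gcd (lcm (A z L (k * q * q′)) (δ z (k * q * product L))) (δ z (k * (q′ * product L)))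
      ≡⟨ gcd-distribʳ-lcm (A z L (k * q * q′)) (δ z (k * q * product L)) (δ z (k * (q′ * product L)))
          {{δ≢0 z _ {{it}} {{n≢0}}}} ⟩
    lcm (gcd (A z L (k * q * q′)) (δ z (k * (q′ * product L)))) (gcd (δ z (k * q * product L))
        (δ z (k * (q′ * product L))))
      ≡⟨ cong₂ lcm (trans (cong₂ (λ i j → gcd (A z L i) (δ z j)) (id₁ k q q′) (sym (*-assoc k q′ (product L))))
                          (gcd-A z L q (k * q′) {{m*n≢0 k q′ {{it}} {{q′≢0}}}} L≢0 cops))
                   (trans (gcd-δ z (k * q * product L) (k * (q′ * product L)))
                          (cong (δ z) gcd≡)) ⟩
    lcm (A z L (k * q′)) (δ z (k * product L)) ∎
    where
    open ≡-Reasoning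
    n≢0 : NonZero (k * (q′ * product L))
    n≢0 = m*n≢0 k _ {{it}} {{product≢0 (q′≢0 ∷ L≢0)}}
    id₁ : ∀ k q q′ → k * q * q′ ≡ k * q′ * q
    id₁ = solve-∀
    id₂ : ∀ k q x → k * q * x ≡ k * x * q
    id₂ = solve-∀
    id₃ : ∀ k q x → k * (q * x) ≡ k * x * q
    id₃ = solve-∀
    gcd≡ : gcd (k * q * product L) (k * (q′ * product L)) ≡ k * product L
    gcd≡ = trans (cong₂ gcd (id₂ k q (product L)) (id₃ k q′ (product L)))
      (trans (sym (c*gcd[m,n]≡gcd[cm,cn] (k * product L) q q′)) (trans (cong (k * product L *_) (coprime⇒gcd≡1 cop))
          (*-identityʳ _)))

  -- ∏ δ z (n / d)^μ(d) over d ∣ product L, where n = k * product L.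
  G : ℕ → List ℕ → ℕ → ℕ
  G z L k = quotient (A∣δ z L k)

  G*A : ∀ z L k → δ z (k * product L) ≡ G z L k * A z L k
  G*A z L k = _∣_.equality (A∣δ z L k)

  A≢0 : ∀ z .{{_ : NonZero z}} L k .{{_ : NonZero k}} → All NonZero L → NonZero (A z L k)
  A≢0 z L k L≢0 = m*n≢0⇒n≢0 (G z L k) {{subst NonZero (G*A z L k) (δ≢0 z _ {{it}}
      {{m*n≢0 k _ {{it}} {{product≢0 L≢0}}}})}}

  G≢0 : ∀ z .{{_ : NonZero z}} L k .{{_ : NonZero k}} → All NonZero L → NonZero (G z L k)
  G≢0 z L k L≢0 = m*n≢0⇒m≢0 (G z L k) {{subst NonZero (G*A z L k) (δ≢0 z _ {{it}}
      {{m*n≢0 k _ {{it}} {{product≢0 L≢0}}}})}}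

  G-[] : ∀ z k → G z [] k ≡ δ z k
  G-[] z k = trans (sym (*-identityʳ (G z [] k))) (trans (sym (G*A z [] k)) (cong (δ z) (*-identityʳ k)))

  -- One step of inclusion and exclusion, the counterpart of Φ_{qm}(x) Φ_m(x) = Φ_m(x^q) for a prime
  -- q not dividing m. The two members of the lcm `A z (q ∷ L) k` have the gcd `A z L k` by `gcd-A`,
  -- and gcd times lcm is their product.
  G-∷ : ∀ z .{{_ : NonZero z}} q L k .{{_ : NonZero q}} .{{_ : NonZero k}} → All NonZero L → All (Coprime q) L →
        G z (q ∷ L) k * G z L k ≡ G z L (k * q)
  G-∷ z q L k L≢0 cops = *-cancelʳ-≡ _ _ (a * A z L k) {{m*n≢0 a (A z L k) {{A≢0 z L (k * q) {{m*n≢0 k q}} L≢0}}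
      {{A≢0 z L k L≢0}}}} (begin
    G z (q ∷ L) k * G z L k * (a * A z L k) ≡⟨ id₁ (G z (q ∷ L) k) (G z L k) a (A z L k) ⟩
    G z (q ∷ L) k * (a * (G z L k * A z L k)) ≡⟨ cong (λ x → G z (q ∷ L) k * (a * x)) (G*A z L k) ⟨
    G z (q ∷ L) k * (a * d) ≡⟨ cong (G z (q ∷ L) k *_) (gcd*lcm a d) ⟨
    G z (q ∷ L) k * (gcd a d * lcm a d) ≡⟨ cong (λ x → G z (q ∷ L) k * (x * lcm a d)) (gcd-A z L q k L≢0 cops) ⟩
    G z (q ∷ L) k * (A z L k * lcm a d) ≡⟨ id₂ (G z (q ∷ L) k) (A z L k) (lcm a d) ⟩
    G z (q ∷ L) k * A z (q ∷ L) k * A z L k ≡⟨ cong (_* A z L k) (G*A z (q ∷ L) k) ⟨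
    δ z (k * (q * product L)) * A z L k ≡⟨ cong (λ i → δ z i * A z L k) (*-assoc k q (product L)) ⟨
    δ z (k * q * product L) * A z L k ≡⟨ cong (_* A z L k) (G*A z L (k * q)) ⟩
    G z L (k * q) * a * A z L k ≡⟨ *-assoc (G z L (k * q)) a _ ⟩
    G z L (k * q) * (a * A z L k) ∎)
    where
    open ≡-Reasoning
    a = A z L (k * q)
    d = δ z (k * product L)
    id₁ : ∀ g h a b → g * h * (a * b) ≡ g * (a * (h * b))
    id₁ = solve-∀
    id₂ : ∀ g a l → g * (a * l) ≡ g * l * a
    id₂ = solve-∀

  G∣ : ∀ z .{{_ : NonZero z}} L k {q m Q} .{{_ : NonZero q}} .{{_ : NonZero m}} → q ∈ L → k * product L ≡ q * m →
       δ z (q * m) ≡ δ z m * Q → G z L k ∣ Q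
  G∣ z L k {q} {m} {Q} q∈L eq δ≡ with δ∣A z L k q∈L eq
  ... | divides c A≡ = divides c (*-cancelˡ-≡ _ _ (δ z m) {{δ≢0 z m}} (begin
    δ z m * Q ≡⟨ δ≡ ⟨
    δ z (q * m) ≡⟨ cong (δ z) eq ⟨
    δ z (k * product L) ≡⟨ G*A z L k ⟩
    G z L k * A z L k ≡⟨ cong (G z L k *_) A≡ ⟩
    G z L k * (c * δ z m) ≡⟨ id₁ (G z L k) c (δ z m) ⟩
    δ z m * (c * G z L k) ∎))
    where
    open ≡-Reasoning
    id₁ : ∀ g c d → g * (c * d) ≡ d * (c * g)
    id₁ = solve-∀

-- Comparing G with u^φ(n)

module Growth where

  open import Data.Empty using (⊥-elim)
  open import Data.List using (List; []; _∷_; map)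
  open import Data.List.Relation.Unary.All as All using (All; []; _∷_)
  open import Data.Nat using (ℕ; zero; suc; _+_; _*_; _∸_; _^_; _≤_; z≤n; s≤s; NonZero; pred)
  open import Data.Nat.Coprimality using (Coprime; prime⇒coprime)
  open import Data.Nat.ListAction using (product)
  open import Data.Nat.Primality using (Prime; prime⇒nonZero; ¬prime[1])
  open import Data.Nat.Properties
  open import Data.Nat.Tactic.RingSolver using (solve-∀)
  open import Data.Product using (∃-syntax; _×_; _,_; proj₁; proj₂)
  open import Relation.Binary.PropositionalEquality using (_≡_; refl; sym; trans; cong; subst)
  open LucasSequence
  open StrongDivisibility
  open CyclotomicPart

  m+n≡o⇒m≤o : ∀ m n {o} → m + n ≡ o → m ≤ o
  m+n≡o⇒m≤o m n refl = m≤m+n m n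

  δ-mono-≤ : ∀ z {m n} → m ≤ n → δ z m ≤ δ z n
  δ-mono-≤ z {m} m≤n with m≤n⇒∃[o]m+o≡n m≤n
  ... | o , refl = go o
    where
    go : ∀ o → δ z m ≤ δ z (m + o)
    go zero    = ≤-reflexive (cong (δ z) (sym (+-identityʳ m)))
    go (suc o) = ≤-trans (go o) (subst (λ i → δ z (m + o) ≤ δ z i) (sym (+-suc m o)) (m≤m+n (δ z (m + o)) _))

  V-mono-≤ : ∀ z {m n} → m ≤ n → V z m ≤ V z n
  V-mono-≤ z m≤n = +-monoʳ-≤ 2 (δ-mono-≤ z m≤n)

  δ-monoˡ-≤ : ∀ {z z′} n → z ≤ z′ → δ z n ≤ δ z′ n
  R-monoˡ-≤ : ∀ {z z′} n → z ≤ z′ → R z n ≤ R z′ n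
  δ-monoˡ-≤ zero    z≤z′ = z≤n
  δ-monoˡ-≤ (suc n) z≤z′ = +-mono-≤ (δ-monoˡ-≤ n z≤z′) (*-mono-≤ z≤z′ (R-monoˡ-≤ n z≤z′))
  R-monoˡ-≤ zero    z≤z′ = ≤-refl
  R-monoˡ-≤ (suc n) z≤z′ = +-mono-≤ (R-monoˡ-≤ n z≤z′) (+-monoʳ-≤ 2 (δ-monoˡ-≤ (suc n) z≤z′))

  V-monoˡ-≤ : ∀ {z z′} n → z ≤ z′ → V z n ≤ V z′ n
  V-monoˡ-≤ n z≤z′ = +-monoʳ-≤ 2 (δ-monoˡ-≤ n z≤z′)

  V-doubling : ∀ n → 2 * V 1 (1 + n) ≤ V 1 (2 + n)
  V-doubling n = +-cancelʳ-≤ (V 1 (1 + n)) _ _ (begin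
    2 * V 1 (1 + n) + V 1 (1 + n) ≡⟨ identity (V 1 (1 + n)) ⟩
    3 * V 1 (1 + n) ≡⟨ V-rec 1 n ⟨
    V 1 (2 + n) + V 1 n ≤⟨ +-monoʳ-≤ (V 1 (2 + n)) (V-mono-≤ 1 (n≤1+n n)) ⟩
    V 1 (2 + n) + V 1 (1 + n) ∎)
    where
    open ≤-Reasoning
    identity : ∀ v → 2 * v + v ≡ 3 * v
    identity = solve-∀

  2^suc≤V : ∀ z .{{_ : NonZero z}} k → 3 ≤ k → 2 ^ suc k ≤ V z k
  2^suc≤V (suc z) k 3≤k = ≤-trans (subst (λ i → 2 ^ suc i ≤ V 1 i) (m+[n∸m]≡n 3≤k) (go (k ∸ 3))) (V-monoˡ-≤ k
      (s≤s z≤n))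
    where
    go : ∀ i → 2 ^ (4 + i) ≤ V 1 (3 + i)
    go zero    = m≤m+n 16 2
    go (suc i) = ≤-trans (*-monoʳ-≤ 2 (go i)) (V-doubling (2 + i))

  -- For n = k * product L with L the list of the primes dividing n, `k * deg L` is Euler's φ(n).
  deg : List ℕ → ℕ
  deg L = product (map pred L)

  -- V z (N + e) / V z N tends to uᵉ as N grows, so this says that
  -- a / b ≤ G z L k / uᶠ ≤ b / a for f = k * deg L, without mentioning u.
  record Bound (z : ℕ) (L : List ℕ) (k a b : ℕ) : Set where
    constructor bound
    field
      lower : ∀ N → k * product L ≤ N → a * V z (N + k * deg L) ≤ b * (G z L k * V z N)
      upper : ∀ N → k * product L ≤ N → a * (G z L k * V z N) ≤ b * V z (N + k * deg L)

  weaken-≤ : ∀ {a b a′ b′} .{{_ : NonZero a}} → b * a′ ≤ b′ * a → ∀ x y → a * x ≤ b * y → a′ * x ≤ b′ * y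
  weaken-≤ {a} {b} {a′} {b′} ba′≤b′a x y ax≤by = *-cancelˡ-≤ a (begin
    a * (a′ * x) ≡⟨ id₁ a a′ x ⟩
    a′ * (a * x) ≤⟨ *-monoʳ-≤ a′ ax≤by ⟩
    a′ * (b * y) ≡⟨ id₂ a′ b y ⟩
    b * a′ * y ≤⟨ *-monoˡ-≤ y ba′≤b′a ⟩
    b′ * a * y ≡⟨ id₃ b′ a y ⟩
    a * (b′ * y) ∎)
    where
    open ≤-Reasoning
    id₁ : ∀ a a′ x → a * (a′ * x) ≡ a′ * (a * x)
    id₁ = solve-∀
    id₂ : ∀ a′ b y → a′ * (b * y) ≡ b * a′ * y
    id₂ = solve-∀
    id₃ : ∀ b a y → b * a * y ≡ a * (b * y)
    id₃ = solve-∀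

  weaken : ∀ {z L k a b a′ b′} .{{_ : NonZero a}} → b * a′ ≤ b′ * a → Bound z L k a b → Bound z L k a′ b′
  weaken {z} {L} {k} {a} {b} {a′} {b′} h (bound lower upper) = bound
    (λ N ≤N → weaken-≤ {a} {b} {a′} {b′} h (V z (N + k * deg L)) (G z L k * V z N) (lower N ≤N))
    (λ N ≤N → weaken-≤ {a} {b} {a′} {b′} h (G z L k * V z N) (V z (N + k * deg L)) (upper N ≤N))

  -- By `G-∷` the new G is a quotient, so its lower bound takes the lower bound of the numerator and
  -- the upper bound of the denominator. The latter is applied at `M N` instead of N, because its
  -- exponent k D then ends at N + k q D, just where that of the numerator ends.
  bound-∷ : ∀ z .{{_ : NonZero z}} q′ L k {a b a′ b′} .{{_ : NonZero k}} → All NonZero L → All (Coprime (suc q′)) L →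
            Bound z L k a b → Bound z L (k * suc q′) a′ b′ → Bound z (suc q′ ∷ L) k (a * a′) (b * b′)
  bound-∷ z q′ L k {a} {b} {a′} {b′} L≢0 cops (bound low up) (bound low′ up′) = bound lower upper
    where
    open ≤-Reasoning
    q = suc q′
    D = deg L
    g = G z L k
    g′ = G z (q ∷ L) k
    h = G z L (k * q)
    g′g≡h : g′ * g ≡ h
    g′g≡h = G-∷ z q L k L≢0 cops
    M : ℕ → ℕ
    M N = N + k * (q′ * D)
    M+ : ∀ N → M N + k * D ≡ N + k * q * D
    M+ N = identity N k q′ D
      where
      identity : ∀ N k q′ D → N + k * (q′ * D) + k * D ≡ N + k * (1 + q′) * D
      identity = solve-∀
    ≤N₁ : ∀ {N} → k * (q * product L) ≤ N → k * q * product L ≤ N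
    ≤N₁ = ≤-trans (≤-reflexive (*-assoc k q (product L)))
    ≤N₂ : ∀ {N} → k * (q * product L) ≤ N → k * product L ≤ M N
    ≤N₂ {N} h = ≤-trans (*-monoʳ-≤ k (m≤n*m (product L) q)) (≤-trans h (m≤m+n N _))
    lower : ∀ N → k * (q * product L) ≤ N → a * a′ * V z (M N) ≤ b * b′ * (g′ * V z N)
    lower N ≤N = *-cancelˡ-≤ g {{G≢0 z L k L≢0}} (begin
      g * (a * a′ * V z (M N)) ≡⟨ id₁ g a a′ (V z (M N)) ⟩
      a′ * (a * (g * V z (M N))) ≤⟨ *-monoʳ-≤ a′ (up (M N) (≤N₂ ≤N)) ⟩
      a′ * (b * V z (M N + k * D)) ≡⟨ cong (λ i → a′ * (b * V z i)) (M+ N) ⟩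
      a′ * (b * V z (N + k * q * D)) ≡⟨ id₂ a′ b (V z (N + k * q * D)) ⟩
      b * (a′ * V z (N + k * q * D)) ≤⟨ *-monoʳ-≤ b (low′ N (≤N₁ ≤N)) ⟩
      b * (b′ * (h * V z N)) ≡⟨ cong (λ x → b * (b′ * (x * V z N))) g′g≡h ⟨
      b * (b′ * (g′ * g * V z N)) ≡⟨ id₃ b b′ g′ g (V z N) ⟩
      g * (b * b′ * (g′ * V z N)) ∎)
      where
      id₁ : ∀ g a a′ v → g * (a * a′ * v) ≡ a′ * (a * (g * v))
      id₁ = solve-∀
      id₂ : ∀ a b v → a * (b * v) ≡ b * (a * v)
      id₂ = solve-∀
      id₃ : ∀ b b′ g′ g v → b * (b′ * (g′ * g * v)) ≡ g * (b * b′ * (g′ * v))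
      id₃ = solve-∀
    upper : ∀ N → k * (q * product L) ≤ N → a * a′ * (g′ * V z N) ≤ b * b′ * V z (M N)
    upper N ≤N = *-cancelˡ-≤ g {{G≢0 z L k L≢0}} (begin
      g * (a * a′ * (g′ * V z N)) ≡⟨ id₁ g a a′ g′ (V z N) ⟩
      a * (a′ * (g′ * g * V z N)) ≡⟨ cong (λ x → a * (a′ * (x * V z N))) g′g≡h ⟩
      a * (a′ * (h * V z N)) ≤⟨ *-monoʳ-≤ a (up′ N (≤N₁ ≤N)) ⟩
      a * (b′ * V z (N + k * q * D)) ≡⟨ id₂ a b′ (V z (N + k * q * D)) ⟩
      b′ * (a * V z (N + k * q * D)) ≡⟨ cong (λ i → b′ * (a * V z i)) (M+ N) ⟨
      b′ * (a * V z (M N + k * D)) ≤⟨ *-monoʳ-≤ b′ (low (M N) (≤N₂ ≤N)) ⟩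
      b′ * (b * (g * V z (M N))) ≡⟨ id₃ b′ b g (V z (M N)) ⟩
      g * (b * b′ * V z (M N)) ∎)
      where
      id₁ : ∀ g a a′ g′ v → g * (a * a′ * (g′ * v)) ≡ a * (a′ * (g′ * g * v))
      id₁ = solve-∀
      id₂ : ∀ a b v → a * (b * v) ≡ b * (a * v)
      id₂ = solve-∀
      id₃ : ∀ b′ b g v → b′ * (b * (g * v)) ≡ g * (b * b′ * v)
      id₃ = solve-∀

  V-product-≤ : ∀ z {k N} → k ≤ N → V z (N + k) ≤ V z N * V z k × V z N * V z k ≤ V z (N + k) + V z N
  V-product-≤ z {k} {N} k≤N = subst (λ i → V z (i + k) ≤ V z i * V z k) N≡ (m+n≡o⇒m≤o (V z (N ∸ k + k + k))
      (V z (N ∸ k)) (V-product z k (N ∸ k))) ,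
    subst (λ i → V z i * V z k ≤ V z (i + k) + V z i) N≡
      (≤-trans (≤-reflexive (sym (V-product z k (N ∸ k)))) (+-monoʳ-≤ (V z (N ∸ k + k + k)) (V-mono-≤ z
          (m≤m+n (N ∸ k) k))))
    where
    N≡ = m∸n+n≡m k≤N

  bound-[]-upper : ∀ z k N → k * 1 ≤ N → G z [] k * V z N ≤ V z (N + k * 1)
  bound-[]-upper z k N k≤N rewrite G-[] z k | *-identityʳ k = +-cancelʳ-≤ (V z N) _ _ (begin
    δ z k * V z N + V z N ≤⟨ m≤m+n _ (V z N) ⟩
    δ z k * V z N + V z N + V z N ≡⟨ identity (δ z k) (V z N) ⟩
    V z N * V z k ≤⟨ proj₂ (V-product-≤ z k≤N) ⟩
    V z (N + k) + V z N ∎)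
    where
    open ≤-Reasoning
    identity : ∀ d v → d * v + v + v ≡ v * (2 + d)
    identity = solve-∀

  -- δ_k / uᵏ = (1 - u⁻ᵏ)² lies between 1 - 2 / V_k and 1.
  bound-[] : ∀ z k e → 2 + e ≤ V z k → Bound z [] k e (2 + e)
  bound-[] z k e 2+e≤V = bound lower
    (λ N k≤N → *-mono-≤ (m≤n+m e 2) (bound-[]-upper z k N k≤N))
    where
    open ≤-Reasoning
    lower : ∀ N → k * 1 ≤ N → e * V z (N + k * 1) ≤ (2 + e) * (G z [] k * V z N)
    lower N k≤N rewrite G-[] z k | *-identityʳ k = begin
      e * V z (N + k) ≤⟨ *-monoʳ-≤ e (proj₁ (V-product-≤ z k≤N)) ⟩
      e * (V z N * V z k) ≡⟨ id₁ e (V z N) (δ z k) ⟩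
      (2 * e + e * δ z k) * V z N ≤⟨ *-monoˡ-≤ (V z N) (+-monoˡ-≤ (e * δ z k) (*-monoʳ-≤ 2 (+-cancelˡ-≤ 2 e (δ z k)
          2+e≤V))) ⟩
      (2 * δ z k + e * δ z k) * V z N ≡⟨ id₂ e (δ z k) (V z N) ⟩
      (2 + e) * (δ z k * V z N) ∎
      where
      id₁ : ∀ e v d → e * (v * (2 + d)) ≡ (2 * e + e * d) * v
      id₁ = solve-∀
      id₂ : ∀ e d v → (2 * d + e * d) * v ≡ (2 + e) * (d * v)
      id₂ = solve-∀

  V-suc-≤ : ∀ z M → V z (1 + M) ≤ (z + 2) * V z M
  V-suc-≤ z zero    = m+n≡o⇒m≤o (V z 1) (z + 2) (identity z)
    where
    identity : ∀ z → 2 + (0 + z * 1) + (z + 2) ≡ (z + 2) * 2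
    identity = solve-∀
  V-suc-≤ z (suc M) = ≤-trans (m≤m+n (V z (2 + M)) (V z M)) (≤-reflexive (V-rec z M))

  -- This is z / u ≥ 3/8. For z = 1 the true value is (3 - √5) / 2 = 0.381..., while `bound-[]`
  -- would give only 1/3; using the recurrence twice, once as V_{n+1} ≤ 3 V_n, recovers most of the
  -- loss.
  3*V-suc-≤ : ∀ z .{{_ : NonZero z}} N → 1 ≤ N → 3 * V z (N + 1) ≤ 8 * (z * V z N)
  3*V-suc-≤ (suc zero) (suc M) _ = subst (λ i → 3 * V 1 i ≤ 8 * (1 * V 1 (1 + M))) (+-comm 1 (suc M))
    (ratio (V 1 M) (V 1 (1 + M)) (V 1 (2 + M)) (V-rec 1 M) (V-suc-≤ 1 M))
    where
    open ≤-Reasoning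
    identity : ∀ w → 3 * (3 * w) ≡ 8 * (1 * w) + w
    identity = solve-∀
    ratio : ∀ v₀ v₁ v₂ → v₂ + v₀ ≡ 3 * v₁ → v₁ ≤ 3 * v₀ → 3 * v₂ ≤ 8 * (1 * v₁)
    ratio v₀ v₁ v₂ rec v₁≤ = +-cancelʳ-≤ (3 * v₀) _ _ (begin
      3 * v₂ + 3 * v₀ ≡⟨ *-distribˡ-+ 3 v₂ v₀ ⟨
      3 * (v₂ + v₀) ≡⟨ cong (3 *_) rec ⟩
      3 * (3 * v₁) ≡⟨ identity v₁ ⟩
      8 * (1 * v₁) + v₁ ≤⟨ +-monoʳ-≤ (8 * (1 * v₁)) v₁≤ ⟩
      8 * (1 * v₁) + 3 * v₀ ∎)
  3*V-suc-≤ (suc (suc w)) N 1≤N = begin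
    3 * V (2 + w) (N + 1) ≤⟨ *-monoʳ-≤ 3 (proj₁ (V-product-≤ (2 + w) 1≤N)) ⟩
    3 * (V (2 + w) N * V (2 + w) 1) ≤⟨ m+n≡o⇒m≤o _ ((4 + 5 * w) * V (2 + w) N) (identity w (V (2 + w) N)) ⟩
    8 * ((2 + w) * V (2 + w) N) ∎
    where
    open ≤-Reasoning
    identity : ∀ w v → 3 * (v * (2 + (2 + w) * 1)) + (4 + 5 * w) * v ≡ 8 * ((2 + w) * v)
    identity = solve-∀

  bound-[]-1 : ∀ z .{{_ : NonZero z}} → Bound z [] 1 3 8
  bound-[]-1 z = bound
    (λ N 1≤N → subst (λ g → 3 * V z (N + 1) ≤ 8 * (g * V z N)) (sym (trans (G-[] z 1) (*-identityʳ z))) (3*V-suc-≤ z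
        N 1≤N))
    (λ N 1≤N → *-mono-≤ (m≤m+n 3 5) (bound-[]-upper z 1 N 1≤N))

  -- Any selection of primes up to m, in decreasing order. The index m is kept because the bounds of
  -- the estimates are functions of 2ᵐ and have to be weakened also when a number is skipped.
  data Primes≤ : ℕ → List ℕ → Set where
    []   : Primes≤ 0 []
    skip : ∀ {m L} → Primes≤ m L → Primes≤ (suc m) L
    take : ∀ {m L} → Prime (suc m) → Primes≤ m L → Primes≤ (suc m) (suc m ∷ L)

  primes≤⇒≤ : ∀ {m L} → Primes≤ m L → All (_≤ m) L
  primes≤⇒≤ [] = []
  primes≤⇒≤ (skip ps) = All.map m≤n⇒m≤1+n (primes≤⇒≤ ps)
  primes≤⇒≤ (take pr ps) = ≤-refl ∷ All.map m≤n⇒m≤1+n (primes≤⇒≤ ps)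

  primes≤⇒prime : ∀ {m L} → Primes≤ m L → All Prime L
  primes≤⇒prime [] = []
  primes≤⇒prime (skip ps) = primes≤⇒prime ps
  primes≤⇒prime (take pr ps) = pr ∷ primes≤⇒prime ps

  primes≤⇒≢0 : ∀ {m L} → Primes≤ m L → All NonZero L
  primes≤⇒≢0 ps = All.map (λ pr → prime⇒nonZero pr) (primes≤⇒prime ps)

  primes≤⇒coprime : ∀ {m L} → Prime (suc m) → Primes≤ m L → All (Coprime (suc m)) L
  primes≤⇒coprime {m} pr ps = go (primes≤⇒≢0 ps) (primes≤⇒≤ ps)
    where
    go : ∀ {L} → All NonZero L → All (_≤ m) L → All (Coprime (suc m)) L
    go []           []           = []
    go (q≢0 ∷ L≢0) (q≤m ∷ L≤m) = prime⇒coprime pr {{q≢0}} (s≤s q≤m) ∷ go L≢0 L≤m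

  bound-take : ∀ z .{{_ : NonZero z}} {m L} k {a b a′ b′} .{{_ : NonZero k}} → Prime (suc m) → Primes≤ m L →
               Bound z L k a b → Bound z L (k * suc m) a′ b′ → Bound z (suc m ∷ L) k (a * a′) (b * b′)
  bound-take z {m} {L} k pr ps = bound-∷ z m L k (primes≤⇒≢0 ps) (primes≤⇒coprime pr ps)

  prime⇒2+ : ∀ {m} → Prime (suc m) → ∃[ m′ ] m ≡ suc m′
  prime⇒2+ {zero}  pr = ⊥-elim (¬prime[1] pr)
  prime⇒2+ {suc m} pr = m , refl

-- The constant 5 in the lower bound for G

module GrowthConstants where

  open import Data.Empty using (⊥-elim)
  open import Data.List using ([]; _∷_)
  open import Data.List.Relation.Unary.All using ([]; _∷_)
  open import Data.Nat using (zero; suc; _+_; _*_; _∸_; _^_; _≤_; _≤?_; z≤n; s≤s; NonZero; >-nonZero)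
  open import Data.Nat.ListAction using (product)
  open import Data.Nat.Primality using (prime?; ¬prime[1])
  open import Data.Nat.Properties
  open import Data.Nat.Tactic.RingSolver using (solve-∀)
  open import Data.Product using (∃-syntax; _,_; proj₂)
  open import Relation.Binary.PropositionalEquality using (_≡_; refl; sym; trans; cong)
  open import Relation.Nullary.Decidable using (from-no; from-yes)
  open LucasSequence
  open StrongDivisibility
  open CyclotomicPart
  open Growth


  -- 1 / (1 − s) with s = (2 − 2⁻ᵐ) / 2ᵏ; both sides are multiplied by 2ᵐ⁺ᵏ, and 2ᵏ = 2 + y.
  bound-tail : ∀ z .{{_ : NonZero z}} {m L} → Primes≤ m L → ∀ k y → 3 ≤ k → 2 ^ k ≡ 2 + y →
               Bound z L k (1 + 2 ^ m * y) (2 ^ m * (2 + y))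
  bound-tail z [] k y 3≤k 2^k≡ = weaken (≤-reflexive (identity y)) (bound-[] z k (2 + 2 * y) (begin
    2 + (2 + 2 * y) ≡⟨ double y ⟩
    2 * (2 + y) ≡⟨ cong (2 *_) 2^k≡ ⟨
    2 ^ suc k ≤⟨ 2^suc≤V z k 3≤k ⟩
    V z k ∎))
    where
    open ≤-Reasoning
    identity : ∀ y → (2 + (2 + 2 * y)) * (1 + 1 * y) ≡ 1 * (2 + y) * (2 + 2 * y)
    identity = solve-∀
    double : ∀ y → 2 + (2 + 2 * y) ≡ 2 * (2 + y)
    double = solve-∀
  bound-tail z {suc m} (skip ps) k y 3≤k 2^k≡ = weaken (≤-trans (m≤m+n _ _) (≤-reflexive (identity (2 ^ m) y)))
      (bound-tail z ps k y 3≤k 2^k≡)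
    where
    identity : ∀ X y → X * (2 + y) * (1 + 2 * X * y) + X * (2 + y) ≡ 2 * X * (2 + y) * (1 + X * y)
    identity = solve-∀
  bound-tail z {suc m} {suc m ∷ L} (take pr ps) k y 3≤k 2^k≡ =
    weaken inequality (bound-take z k {{k≢0}} pr ps (bound-tail z ps k y 3≤k 2^k≡) (bound-tail z ps (k * suc m) w
        3≤kq 2^kq≡))
    where
    instance
      k≢0 : NonZero k
      k≢0 = >-nonZero (≤-trans (s≤s z≤n) 3≤k)
    X = 2 ^ m
    m≥1 : 1 ≤ m
    m≥1 with prime⇒2+ pr
    ... | _ , refl = s≤s z≤n
    3≤kq : 3 ≤ k * suc m
    3≤kq = ≤-trans 3≤k (m≤m*n k (suc m))
    w = 2 ^ (k * suc m) ∸ 2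
    2+m+k≤kq : 2 + m + k ≤ k * suc m
    2+m+k≤kq = begin
      2 + m + k ≤⟨ +-monoˡ-≤ k (+-monoˡ-≤ m (+-mono-≤ m≥1 m≥1)) ⟩
      m + m + m + k ≡⟨ id₁ m k ⟩
      3 * m + k ≤⟨ +-monoˡ-≤ k (*-monoˡ-≤ m 3≤k) ⟩
      k * m + k ≡⟨ id₂ k m ⟩
      k * suc m ∎
      where
      open ≤-Reasoning
      id₁ : ∀ m k → m + m + m + k ≡ 3 * m + k
      id₁ = solve-∀
      id₂ : ∀ k m → k * m + k ≡ k * (1 + m)
      id₂ = solve-∀
    -- With W = 2^(kq) this gives 2 / W ≤ 1 / (2 X 2ᵏ), and the right side is what s gains when m
    -- grows to m + 1. The loss from the new factor is below 2 / W and so fits into that gain.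
    4XY≤W : 2 ^ (2 + m) * 2 ^ k ≤ 2 ^ (k * suc m)
    4XY≤W = ≤-trans (≤-reflexive (sym (^-distribˡ-+-* 2 (2 + m) k))) (^-monoʳ-≤ 2 2+m+k≤kq)
    2^kq≡ : 2 ^ (k * suc m) ≡ 2 + w
    2^kq≡ = sym (m+[n∸m]≡n (≤-trans (m≤m+n 2 6) (^-monoʳ-≤ 2 3≤kq)))
    w≥ : 4 * X * y + 2 ≤ w
    w≥ = +-cancelˡ-≤ 2 _ _ (begin
      2 + (4 * X * y + 2) ≤⟨ m≤m+n _ 4 ⟩
      2 + (4 * X * y + 2) + 4 * 1 ≤⟨ +-monoʳ-≤ (2 + (4 * X * y + 2)) (*-monoʳ-≤ 4 (m^n>0 2 m)) ⟩
      2 + (4 * X * y + 2) + 4 * X ≤⟨ +-monoʳ-≤ (2 + (4 * X * y + 2)) (m≤m+n (4 * X) 0) ⟩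
      2 + (4 * X * y + 2) + (4 * X + 0) ≡⟨ id₁ X y ⟩
      4 + (4 * X * y + 4 * X) ≤⟨ +-monoˡ-≤ (4 * X * y + 4 * X) (*-monoʳ-≤ 4 (m^n>0 2 m)) ⟩
      4 * X + (4 * X * y + 4 * X) ≡⟨ id₂ X y ⟩
      2 * (2 * X) * (2 + y) ≡⟨ cong (2 ^ (2 + m) *_) 2^k≡ ⟨
      2 ^ (2 + m) * 2 ^ k ≤⟨ 4XY≤W ⟩
      2 ^ (k * suc m) ≡⟨ 2^kq≡ ⟩
      2 + w ∎)
      where
      open ≤-Reasoning
      id₁ : ∀ X y → 2 + (4 * X * y + 2) + (4 * X + 0) ≡ 4 + (4 * X * y + 4 * X)
      id₁ = solve-∀
      id₂ : ∀ X y → 4 * X + (4 * X * y + 4 * X) ≡ 2 * (2 * X) * (2 + y)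
      id₂ = solve-∀
    polynomial : ∀ X y w → 4 * X * y + 2 ≤ w →
      X * (2 + y) * (X * (2 + w)) * (1 + 2 * X * y) ≤ 2 * X * (2 + y) * ((1 + X * y) * (1 + X * w))
    polynomial X y w w≥ with m≤n⇒∃[o]m+o≡n w≥
    ... | v , refl = ≤-trans (m≤m+n _ ((2 + 2 * X * y + X * v) * (X * (2 + y)))) (≤-reflexive (identity X y v))
      where
      identity : ∀ X y v → X * (2 + y) * (X * (2 + (4 * X * y + 2 + v))) * (1 + 2 * X * y) + (2 + 2 * X * y + X * v)
          * (X * (2 + y))
               ≡ 2 * X * (2 + y) * ((1 + X * y) * (1 + X * (4 * X * y + 2 + v)))
      identity = solve-∀
    inequality : X * (2 + y) * (X * (2 + w)) * (1 + 2 ^ suc m * y) ≤ 2 ^ suc m * (2 + y) * ((1 + X * y) * (1 + X * w))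
    inequality = polynomial X y w w≥

  -- As m grows, 10 X / (2 X + 5) with X = 2ᵐ increases to 5, by more at each step
  -- than the factor that bound-tail gives for the new prime; likewise 4 X / (X + 2)
  -- in bound-2.
  bound-1 : ∀ z .{{_ : NonZero z}} {m L} → Primes≤ (4 + m) L → Bound z L 1 (2 * 2 ^ (4 + m) + 5) (10 * 2 ^ (4 + m))
  bound-1 z {zero} ps = weaken {a = 15 * 5120} {b = 56 * 5796} (from-yes (56 * 5796 * 37 ≤? 160 * (15 * 5120)))
      (four ps)
    where
    -- The constants come from z = 1: 3/8 for δ₁, and 5/7, 16/18 and 320/322 from V₂ = 7, V₃ = 18
    -- and V₆ = 322. The primes 2 and 3 get these exact values since `bound-tail` at k = 3 yields
    -- 25/32 in place of 5120/5796, and 15 · 25 / (56 · 32) falls below the required 37/160.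
    one : ∀ {L} → Primes≤ 1 L → Bound z L 1 3 8
    one (skip [])    = bound-[]-1 z
    one (take pr []) = ⊥-elim (¬prime[1] pr)
    V≥ : ∀ k c → c ≤ V 1 k → c ≤ V z k
    V≥ k c c≤ = ≤-trans c≤ (V-monoˡ-≤ k (>-nonZero⁻¹ z))
      where open import Data.Nat using (>-nonZero⁻¹)
    two : ∀ {L} → Primes≤ 2 L → Bound z L 1 15 56
    two (skip ps)             = weaken {a = 3} {b = 8} (from-yes (8 * 15 ≤? 56 * 3)) (one ps)
    two (take pr (skip []))   = bound-take z 1 pr (skip []) (bound-[]-1 z) (bound-[] z 2 5 (V≥ 2 7 ≤-refl))
    two (take _ (take pr [])) = ⊥-elim (¬prime[1] pr)
    at3 : ∀ {L} → Primes≤ 2 L → Bound z L 3 5120 5796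
    at3 (skip (skip []))       = weaken {a = 16} {b = 18} (from-yes (18 * 5120 ≤? 5796 * 16)) (bound-[] z 3 16
        (V≥ 3 18 ≤-refl))
    at3 (skip (take pr []))    = ⊥-elim (¬prime[1] pr)
    at3 (take pr (skip []))    = bound-take z 3 pr (skip []) (bound-[] z 3 16 (V≥ 3 18 ≤-refl)) (bound-[] z 6 320
        (V≥ 6 322 ≤-refl))
    at3 (take _ (take pr []))  = ⊥-elim (¬prime[1] pr)
    three : ∀ {L} → Primes≤ 3 L → Bound z L 1 (15 * 5120) (56 * 5796)
    three (skip ps)    = weaken {a = 15} {b = 56} (from-yes (56 * (15 * 5120) ≤? 56 * 5796 * 15)) (two ps)
    three (take pr ps) = bound-take z 1 pr ps (two ps) (at3 ps)
    four : ∀ {L} → Primes≤ 4 L → Bound z L 1 (15 * 5120) (56 * 5796)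
    four (skip ps)    = three ps
    four (take pr ps) = ⊥-elim (from-no (prime? 4) pr)
  bound-1 z {suc m} (skip ps) = weaken {{2X+5≢0}} (≤-trans (m≤m+n _ _) (≤-reflexive (identity (2 ^ (4 + m)))))
      (bound-1 z ps)
    where
    2X+5≢0 : NonZero (2 * 2 ^ (4 + m) + 5)
    2X+5≢0 = >-nonZero (≤-trans (s≤s z≤n) (m≤n+m 5 (2 * 2 ^ (4 + m))))
    identity : ∀ X → 10 * X * (2 * (2 * X) + 5) + 50 * X ≡ 10 * (2 * X) * (2 * X + 5)
    identity = solve-∀
  bound-1 z {suc m} (take pr ps) = weaken {{ab≢0}} inequality (bound-take z 1 pr ps (bound-1 z ps) (bound-tail z ps
      (1 * (5 + m)) y 3≤q 2^q≡))
    where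
    X = 2 ^ (4 + m)
    -- In terms of x the difference of the two sides has nonnegative coefficients; 8 is the first
    -- power of 2 at which that difference is not negative.
    x = X ∸ 8
    y = 14 + 2 * x
    8+x≡X : 8 + x ≡ X
    8+x≡X = m+[n∸m]≡n (^-monoʳ-≤ 2 (m≤m+n 3 (1 + m)))
    3≤q : 3 ≤ 1 * (5 + m)
    3≤q = s≤s (s≤s (s≤s z≤n))
    double : ∀ x → 2 * (8 + x) ≡ 2 + (14 + 2 * x)
    double = solve-∀
    2^q≡ : 2 ^ (1 * (5 + m)) ≡ 2 + y
    2^q≡ = trans (cong (2 ^_) (*-identityˡ (5 + m))) (trans (cong (2 *_) (sym 8+x≡X)) (double x))
    ab≢0 : NonZero ((2 * X + 5) * (1 + X * y))
    ab≢0 = m*n≢0 (2 * X + 5) (1 + X * y) {{>-nonZero (≤-trans (s≤s z≤n) (m≤n+m 5 (2 * X)))}}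
    polynomial : ∀ X x → 8 + x ≡ X → 10 * X * (X * (2 + (14 + 2 * x))) * (2 * (2 * X) + 5) ≤ 10 * (2 * X) *
        ((2 * X + 5) * (1 + X * (14 + 2 * x)))
    polynomial X x refl = ≤-trans (m≤m+n _ (10 * (8 + x) * (2 * x * x + 16 * x + 10))) (≤-reflexive (identity x))
      where
      identity : ∀ x → 10 * (8 + x) * ((8 + x) * (2 + (14 + 2 * x))) * (2 * (2 * (8 + x)) + 5) + 10 * (8 + x) *
          (2 * x * x + 16 * x + 10)
               ≡ 10 * (2 * (8 + x)) * ((2 * (8 + x) + 5) * (1 + (8 + x) * (14 + 2 * x)))
      identity = solve-∀
    inequality : 10 * X * (X * (2 + y)) * (2 * (2 * X) + 5) ≤ 10 * (2 * X) * ((2 * X + 5) * (1 + X * y))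
    inequality = polynomial X x 8+x≡X

  bound-2 : ∀ z .{{_ : NonZero z}} {m L} → Primes≤ (1 + m) L → Bound z L 2 (2 ^ (1 + m) + 2) (4 * 2 ^ (1 + m))
  bound-2 z {zero} (skip [])    = weaken {a = 5} {b = 7} (from-yes (28 ≤? 40)) (bound-[] z 2 5 (V-monoˡ-≤ 2
      (>-nonZero⁻¹ z)))
    where open import Data.Nat using (>-nonZero⁻¹)
  bound-2 z {zero} (take pr []) = ⊥-elim (¬prime[1] pr)
  bound-2 z {suc m} (skip ps) = weaken {{X+2≢0}} (≤-trans (m≤m+n _ _) (≤-reflexive (identity (2 ^ (1 + m)))))
      (bound-2 z ps)
    where
    X+2≢0 : NonZero (2 ^ (1 + m) + 2)
    X+2≢0 = >-nonZero (≤-trans (s≤s z≤n) (m≤n+m 2 (2 ^ (1 + m))))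
    identity : ∀ X → 4 * X * (2 * X + 2) + 8 * X ≡ 4 * (2 * X) * (X + 2)
    identity = solve-∀
  bound-2 z {suc m} (take pr ps) = weaken {{ab≢0}} inequality (bound-take z 2 pr ps (bound-2 z ps) (bound-tail z ps
      (2 * (2 + m)) y 3≤q 2^q≡))
    where
    X = 2 ^ (1 + m)
    x = X ∸ 1
    y = 2 + 8 * x + 4 * x * x
    1+x≡X : 1 + x ≡ X
    1+x≡X = m+[n∸m]≡n (m^n>0 2 (1 + m))
    3≤q : 3 ≤ 2 * (2 + m)
    3≤q = ≤-trans (m≤m+n 3 1) (*-monoʳ-≤ 2 (m≤m+n 2 m))
    square : ∀ x → 2 * (1 + x) * (2 * (1 + x)) ≡ 2 + (2 + 8 * x + 4 * x * x)
    square = solve-∀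
    2*≡+ : ∀ m → 2 * m ≡ m + m
    2*≡+ = solve-∀
    2^q≡ : 2 ^ (2 * (2 + m)) ≡ 2 + y
    2^q≡ = trans (cong (2 ^_) (2*≡+ (2 + m))) (trans (^-distribˡ-+-* 2 (2 + m) (2 + m))
        (trans (cong (λ X → 2 * X * (2 * X)) (sym 1+x≡X)) (square x)))
    ab≢0 : NonZero ((X + 2) * (1 + X * y))
    ab≢0 = m*n≢0 (X + 2) (1 + X * y) {{>-nonZero (≤-trans (s≤s z≤n) (m≤n+m 2 X))}}
    polynomial : ∀ X x → 1 + x ≡ X → let y = 2 + 8 * x + 4 * x * x in
      4 * X * (X * (2 + y)) * (2 * X + 2) ≤ 4 * (2 * X) * ((X + 2) * (1 + X * y))
    polynomial X x refl = ≤-trans (m≤m+n _ (8 * (1 + x) * (4 * x * x * x + 10 * x * x + 5 * x + 1))) (≤-reflexive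
        (identity x))
      where
      identity : ∀ x → 4 * (1 + x) * ((1 + x) * (2 + (2 + 8 * x + 4 * x * x))) * (2 * (1 + x) + 2) + 8 * (1 + x) *
          (4 * x * x * x + 10 * x * x + 5 * x + 1)
               ≡ 4 * (2 * (1 + x)) * ((1 + x + 2) * (1 + (1 + x) * (2 + 8 * x + 4 * x * x)))
      identity = solve-∀
    inequality : 4 * X * (X * (2 + y)) * (2 * X + 2) ≤ 4 * (2 * X) * ((X + 2) * (1 + X * y))
    inequality = polynomial X x 1+x≡X

  primes≤-+ : ∀ {m L} i → Primes≤ m L → Primes≤ (i + m) L
  primes≤-+ zero    ps = ps
  primes≤-+ (suc i) ps = skip (primes≤-+ i ps)

  bound-5 : ∀ z .{{_ : NonZero z}} {m L} → Primes≤ m L → ∀ k .{{_ : NonZero k}} → Bound z L k 1 5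
  bound-5 z {m} ps 1 = weaken {{2X+5≢0}} (≤-trans (m≤m+n _ 25) (≤-reflexive (identity (2 ^ (4 + m)))))
      (bound-1 z (primes≤-+ 4 ps))
    where
    2X+5≢0 : NonZero (2 * 2 ^ (4 + m) + 5)
    2X+5≢0 = >-nonZero (≤-trans (s≤s z≤n) (m≤n+m 5 (2 * 2 ^ (4 + m))))
    identity : ∀ X → 10 * X * 1 + 25 ≡ 5 * (2 * X + 5)
    identity = solve-∀
  bound-5 z {m} ps 2 = weaken {{X+2≢0}} (≤-trans (m≤m+n _ (2 ^ (1 + m) + 10)) (≤-reflexive (identity (2 ^ (1 + m)))))
      (bound-2 z (primes≤-+ 1 ps))
    where
    X+2≢0 : NonZero (2 ^ (1 + m) + 2)
    X+2≢0 = >-nonZero (≤-trans (s≤s z≤n) (m≤n+m 2 (2 ^ (1 + m))))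
    identity : ∀ X → 4 * X * 1 + (X + 10) ≡ 5 * (X + 2)
    identity = solve-∀
  bound-5 z {m} ps k@(suc (suc (suc k′))) = weaken (polynomial (2 ^ m) y 1≤y) (bound-tail z ps k y
      (s≤s (s≤s (s≤s z≤n))) (sym (m+[n∸m]≡n (≤-trans (m≤m+n 2 6) 8≤2^k))))
    where
    y = 2 ^ k ∸ 2
    8≤2^k : 8 ≤ 2 ^ k
    8≤2^k = ^-monoʳ-≤ 2 (m≤m+n 3 k′)
    1≤y : 1 ≤ y
    1≤y = ∸-monoˡ-≤ 2 (≤-trans (m≤m+n 3 5) 8≤2^k)
    polynomial : ∀ X y → 1 ≤ y → X * (2 + y) * 1 ≤ 5 * (1 + X * y)
    polynomial X (suc v) _ = ≤-trans (m≤m+n _ (5 + 2 * X + 4 * X * v)) (≤-reflexive (identity X v))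
      where
      identity : ∀ X v → X * (2 + (1 + v)) * 1 + (5 + 2 * X + 4 * X * v) ≡ 5 * (1 + X * (1 + v))
      identity = solve-∀

  -- V_N V_f ≤ V_{N+f} + V_N ≤ (5 G + 1) V_N, and V_N cancels. N is large enough both for the
  -- product formula, f ≤ N, and for the bound on G.
  V≤1+5*G : ∀ z .{{_ : NonZero z}} {m L} → Primes≤ m L → ∀ k .{{_ : NonZero k}} → V z (k * deg L) ≤ 1 + 5 * G z L k
  V≤1+5*G z {m} {L} ps k = *-cancelˡ-≤ (V z N) (begin
    V z N * V z f ≤⟨ proj₂ (V-product-≤ z f≤N) ⟩
    V z (N + f) + V z N ≡⟨ cong (_+ V z N) (+-identityʳ (V z (N + f))) ⟨
    1 * V z (N + f) + V z N ≤⟨ +-monoˡ-≤ (V z N) (Bound.lower (bound-5 z ps k) N (m≤m+n (k * product L) f)) ⟩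
    5 * (G z L k * V z N) + V z N ≡⟨ identity (G z L k) (V z N) ⟩
    V z N * (1 + 5 * G z L k) ∎)
    where
    open ≤-Reasoning
    f = k * deg L
    N = k * product L + f
    f≤N : f ≤ N
    f≤N = m≤n+m f (k * product L)
    identity : ∀ g v → 5 * (g * v) + v ≡ v * (1 + 5 * g)
    identity = solve-∀

-- Prime factors of n and small values of φ(n)

module PrimeFactors where

  open import Data.Empty using (⊥; ⊥-elim)
  open import Data.List using ([]; _∷_)
  open import Data.List.Membership.Propositional using (_∈_)
  open import Data.List.Relation.Unary.All as All using (All; []; _∷_)
  open import Data.List.Relation.Unary.Any using (here; there)
  open import Data.Nat using (zero; suc; _+_; _*_; _≤_; _<_; _≤?_; z≤n; s≤s; NonZero; ≢-nonZero; ≢-nonZero⁻¹; pred; >-nonZero)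
  open import Data.Nat.Coprimality using (Coprime)
  open import Data.Nat.Divisibility
  open import Data.Nat.ListAction using (product)
  open import Data.Nat.Primality using (Prime; prime?; ¬prime[1]; ¬prime[0]; euclidsLemma; prime⇒irreducible)
  open import Data.Nat.Primality.Factorisation using (factorise; factorisationHasAllPrimeFactors)
  open import Data.Nat.Properties hiding (_≤?_; _≟_)
  open import Data.Product using (∃-syntax; _×_; _,_)
  open import Data.Sum using (_⊎_; inj₁; inj₂)
  open import Function using (it)
  open import Relation.Binary.PropositionalEquality using (_≡_; _≢_; refl; sym; trans; cong; subst)
  open import Relation.Nullary using (¬_; yes; no)
  open import Relation.Nullary.Decidable using (from-no; from-yes)
  open RankOfApparition
  open Growth
  open GrowthConstants

  prime∣prime⇒≡ : ∀ {p q} → Prime p → Prime q → p ∣ q → p ≡ q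
  prime∣prime⇒≡ pr-p pr-q p∣q with prime⇒irreducible pr-q p∣q
  ... | inj₁ refl = ⊥-elim (¬prime[1] pr-p)
  ... | inj₂ p≡q  = p≡q

  prime∤1 : ∀ {p} → Prime p → ¬ p ∣ 1
  prime∤1 pr p∣1 = ¬prime[1] (subst Prime (∣1⇒≡1 p∣1) pr)

  prime∤⇒coprime : ∀ {p m} → Prime p → ¬ p ∣ m → Coprime m p
  prime∤⇒coprime pr p∤m (d∣m , d∣p) with prime⇒irreducible pr d∣p
  ... | inj₁ d≡1  = d≡1
  ... | inj₂ refl = ⊥-elim (p∤m d∣m)

  primeDivisor : ∀ n .{{_ : NonZero n}} → n ≡ 1 ⊎ (∃[ p ] Prime p × p ∣ n)
  primeDivisor n with factorise n
  ... | record { factors = [] ; isFactorisation = eq } = inj₁ eq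
  ... | record { factors = p ∷ ps ; isFactorisation = eq ; factorsPrime = pr ∷ _ } = inj₂ (p , pr , subst (p ∣_)
      (sym eq) (m∣m*n (product ps)))

  coprimeByPrimes : ∀ m n .{{_ : NonZero m}} → (∀ {p} → Prime p → p ∣ m → ¬ p ∣ n) → Coprime m n
  coprimeByPrimes m n none {d} (d∣m , d∣n) with primeDivisor d {{≢-nonZero λ { refl → ≢-nonZero⁻¹ m (0∣⇒≡0 d∣m) }}}
  ... | inj₁ d≡1 = d≡1
  ... | inj₂ (p , pr , p∣d) = ⊥-elim (none pr (∣-trans p∣d d∣m) (∣-trans p∣d d∣n))

  primesDividing : ∀ n m → ∃[ L ] Primes≤ m L × All (_∣ n) L × (∀ {p} → Prime p → p ≤ m → p ∣ n → p ∈ L)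
  primesDividing n zero = [] , [] , [] , λ { pr z≤n → ⊥-elim (¬prime[0] pr) }
  primesDividing n (suc m) with primesDividing n m | prime? (suc m) | suc m ∣? n
  ... | L , ps , L∣n , complete | yes pr | yes q∣n = suc m ∷ L , take pr ps , q∣n ∷ L∣n , complete′
    where
    complete′ : ∀ {p} → Prime p → p ≤ suc m → p ∣ n → p ∈ suc m ∷ L
    complete′ pr p≤ p∣n with m≤n⇒m<n∨m≡n p≤
    ... | inj₁ (s≤s p≤m) = there (complete pr p≤m p∣n)
    ... | inj₂ refl = here refl
  ... | L , ps , L∣n , complete | no ¬pr | _ = L , skip ps , L∣n , complete′
    where
    complete′ : ∀ {p} → Prime p → p ≤ suc m → p ∣ n → p ∈ L
    complete′ pr p≤ p∣n with m≤n⇒m<n∨m≡n p≤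
    ... | inj₁ (s≤s p≤m) = complete pr p≤m p∣n
    ... | inj₂ refl = ⊥-elim (¬pr pr)
  ... | L , ps , L∣n , complete | yes _ | no q∤n = L , skip ps , L∣n , complete′
    where
    complete′ : ∀ {p} → Prime p → p ≤ suc m → p ∣ n → p ∈ L
    complete′ pr p≤ p∣n with m≤n⇒m<n∨m≡n p≤
    ... | inj₁ (s≤s p≤m) = complete pr p≤m p∣n
    ... | inj₂ refl = ⊥-elim (q∤n p∣n)

  product∣ : ∀ {n m L} → Primes≤ m L → All (_∣ n) L → product L ∣ n
  product∣ [] [] = 1∣ _
  product∣ (skip ps) L∣n = product∣ ps L∣n
  product∣ {n} {suc m} {_ ∷ L} (take pr ps) (q∣n ∷ L∣n) with product∣ ps L∣n
  ... | divides c n≡ with euclidsLemma c (product L) pr (subst (suc m ∣_) n≡ q∣n)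
  ... | inj₁ (divides c′ c≡) = divides c′ (trans n≡ (trans (cong (_* product L) c≡) (*-assoc c′ (suc m) (product L))))
  ... | inj₂ q∣Π = ⊥-elim (<-irrefl refl (All.lookup (primes≤⇒≤ ps) (factorisationHasAllPrimeFactors pr q∣Π
      (primes≤⇒prime ps))))

  shrink : ∀ c i {L} → Primes≤ (i + c) L → All (_≤ c) L → Primes≤ c L
  shrink c zero    ps L≤c = ps
  shrink c (suc i) (skip ps) L≤c = shrink c i ps L≤c
  shrink c (suc i) (take _ _) (i+c<c ∷ _) = ⊥-elim (m+n≮n i c i+c<c)

  pred∣deg : ∀ {q L} → q ∈ L → pred q ∣ deg L
  pred∣deg {L = _ ∷ L} (here refl) = m∣m*n (deg L)
  pred∣deg {L = q′ ∷ _} (there q∈L) = ∣n⇒∣m*n (pred q′) (pred∣deg q∈L)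

  deg≢0 : ∀ {m L} → Primes≤ m L → NonZero (deg L)
  deg≢0 [] = _
  deg≢0 (skip ps) = deg≢0 ps
  deg≢0 (take {m} {L} pr ps) with prime⇒2+ pr
  ... | m′ , refl = m*n≢0 (suc m′) (deg L) {{it}} {{deg≢0 ps}}

  pred≤k*deg : ∀ {m L q} → Primes≤ m L → ∀ k .{{_ : NonZero k}} → q ∈ L → pred q ≤ k * deg L
  pred≤k*deg {L = L} ps k q∈L = ≤-trans (∣⇒≤ {{deg≢0 ps}} (pred∣deg q∈L)) (m≤n*m (deg L) k)

  -- Each q in the list has q - 1 dividing `deg L`, so q ≤ φ(n) + 1. A bound on φ(n) thus leaves
  -- finitely many lists to inspect.
  k*deg<⇒primes≤ : ∀ {m L} c → Primes≤ m L → ∀ k .{{_ : NonZero k}} → k * deg L < c → Primes≤ c L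
  k*deg<⇒primes≤ {m} {L} c ps k f<c = shrink c m (subst (λ i → Primes≤ i L) (+-comm c m) (primes≤-+ c ps))
    (All.tabulate λ {q} q∈L → ≤-trans (m≤1+pred q) (≤-trans (s≤s (pred≤k*deg ps k q∈L)) f<c))
    where
    m≤1+pred : ∀ q → q ≤ suc (pred q)
    m≤1+pred zero    = z≤n
    m≤1+pred (suc q) = ≤-refl

  -- φ(n) ≤ 3 holds only for n = 1, 2, 3, 4 and 6.
  4≤φ : ∀ {m L} → Primes≤ m L → ∀ k .{{_ : NonZero k}} → 7 ≤ k * product L → (∀ {p} → Prime p → p ∣ k * product L → p
      ∈ L) → 4 ≤ k * deg L
  4≤φ {m} {L} ps k 7≤n complete = ≮⇒≥ λ f<4 → cases (k*deg<⇒primes≤ 4 ps k f<4) f<4 7≤n complete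
    where
    too-small : ∀ {a b} → a ≤ b → b ≤ 6 → 7 ≤ a → ⊥
    too-small a≤b b≤6 7≤a = from-no (7 ≤? 6) (≤-trans 7≤a (≤-trans a≤b b≤6))
    k*2<4⇒k≤1 : k * 2 < 4 → k ≤ 1
    k*2<4⇒k≤1 h = ≤-pred (*-cancelʳ-< 2 k 2 h)
    cases : ∀ {L} → Primes≤ 4 L → k * deg L < 4 → 7 ≤ k * product L → (∀ {p} → Prime p → p ∣ k * product L → p ∈ L) →
        ⊥
    cases (take pr _) _ _ _ = from-no (prime? 4) pr
    cases (skip (skip (skip (skip [])))) f<4 7≤n complete with primeDivisor (k * 1)
        {{>-nonZero (≤-trans (s≤s z≤n) 7≤n)}}
    ... | inj₁ n≡1 = too-small ≤-refl (≤-trans (≤-reflexive n≡1) (s≤s z≤n)) 7≤n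
    ... | inj₂ (p , pr , p∣n) with () ← complete pr p∣n
    cases (skip (skip (skip (take pr [])))) = ⊥-elim (¬prime[1] pr)
    cases (skip (skip (take pr (take pr′ [])))) = ⊥-elim (¬prime[1] pr′)
    cases (skip (take pr (skip (take pr′ [])))) = ⊥-elim (¬prime[1] pr′)
    cases (skip (take pr (take pr″ (take pr′ [])))) = ⊥-elim (¬prime[1] pr′)
    cases (skip (skip (take pr (skip [])))) f<4 7≤n _ = too-small (*-monoˡ-≤ 2 (≤-pred (subst (_< 4) (*-identityʳ k)
        f<4))) ≤-refl 7≤n
    cases (skip (take pr (skip (skip [])))) f<4 7≤n _ = too-small (*-monoˡ-≤ 3 (k*2<4⇒k≤1 f<4)) (from-yes (3 ≤? 6))
        7≤n
    cases (skip (take pr (take pr′ (skip [])))) f<4 7≤n _ = too-small (*-monoˡ-≤ 6 (k*2<4⇒k≤1 f<4)) ≤-refl 7≤n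

  -- Among the multiples of 5, only 5 and 10 have φ(n) < 6.
  6≤φ : ∀ {m L} → Primes≤ m L → ∀ k .{{_ : NonZero k}} → 7 ≤ k * product L → k * product L ≢ 10 → 5 ∈ L → 6 ≤ k * deg
      L
  6≤φ {m} {L} ps k@(suc k-1) 7≤n n≢10 5∈L = ≮⇒≥ λ f<6 → cases (k*deg<⇒primes≤ 6 ps k f<6) f<6 7≤n n≢10 5∈L
    where
    k*4<6⇒k≡1 : k * 4 < 6 → k ≡ 1
    k*4<6⇒k≡1 h = ≤-antisym (≤-pred (*-cancelʳ-< 4 k 2 (≤-trans h (m≤m+n 6 2)))) (s≤s z≤n)
    8≰ : ∀ {x} → x ≡ 8 → k * x < 6 → ⊥
    8≰ refl h = from-no (8 ≤? 6) (≤-trans (m≤n*m 8 k) (<⇒≤ h))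
    none : ∀ {L} → Primes≤ 4 L → 5 ∈ L → ⊥
    none ps′ 5∈L = from-no (5 ≤? 4) (All.lookup (primes≤⇒≤ ps′) 5∈L)
    cases : ∀ {L} → Primes≤ 6 L → k * deg L < 6 → 7 ≤ k * product L → k * product L ≢ 10 → 5 ∈ L → ⊥
    cases (take pr _) = ⊥-elim (from-no (prime? 6) pr)
    cases (skip (skip ps′)) _ _ _ 5∈L = none ps′ 5∈L
    cases (skip (take _ (take pr _))) = ⊥-elim (from-no (prime? 4) pr)
    cases (skip (take _ (skip (take _ (skip (take pr [])))))) = ⊥-elim (¬prime[1] pr)
    cases (skip (take _ (skip (take _ (take _ (take pr [])))))) = ⊥-elim (¬prime[1] pr)
    cases (skip (take _ (skip (skip (skip (take pr [])))))) = ⊥-elim (¬prime[1] pr)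
    cases (skip (take _ (skip (skip (take _ (take pr [])))))) = ⊥-elim (¬prime[1] pr)
    cases (skip (take _ (skip (take _ (skip (skip [])))))) f<6 = ⊥-elim (8≰ refl f<6)
    cases (skip (take _ (skip (take _ (take _ (skip [])))))) f<6 = ⊥-elim (8≰ refl f<6)
    cases (skip (take _ (skip (skip (skip (skip [])))))) f<6 7≤n _ _ =
      from-no (7 ≤? 5) (≤-trans 7≤n (≤-reflexive (cong (_* 5) (k*4<6⇒k≡1 f<6))))
    cases (skip (take _ (skip (skip (take _ (skip [])))))) f<6 _ n≢10 _ = n≢10 (cong (_* 10) (k*4<6⇒k≡1 f<6))

-- The contradiction for n > 6 without primitive prime divisor

module Zsigmondy where

  open import Data.Empty using (⊥; ⊥-elim)
  open import Data.List using (List)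
  open import Data.List.Membership.Propositional using (_∈_)
  open import Data.Nat using (ℕ; zero; suc; _+_; _*_; _≤_; _<_; _≤?_; _<?_; _≟_; z≤n; s≤s; NonZero; ≢-nonZero; pred; >-nonZero; >-nonZero⁻¹)
  open import Data.Nat.Coprimality as Coprime using (Coprime; coprime-divisor)
  open import Data.Nat.Divisibility
  open import Data.Nat.GCD using (gcd; gcd[m,n]∣m; gcd[m,n]∣n)
  open import Data.Nat.ListAction using (product)
  open import Data.Nat.Primality using (Prime; prime?; prime[2]; prime⇒nonZero; ¬prime[1]; ¬prime[0]; euclidsLemma)
  open import Data.Nat.Properties hiding (_≤?_; _<?_; _≟_)
  open import Data.Nat.Tactic.RingSolver using (solve-∀)
  open import Data.Product using (∃-syntax; _×_; _,_; proj₁; proj₂)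
  open import Data.Sum using (_⊎_; inj₁; inj₂; [_,_]′)
  open import Function using (it; _∘_)
  open import Relation.Binary.Definitions using (tri<; tri≈; tri>)
  open import Relation.Binary.PropositionalEquality using (_≡_; _≢_; refl; sym; trans; cong; subst)
  open import Relation.Nullary using (¬_; yes; no; contradiction)
  open import Relation.Nullary.Decidable using (from-no; from-yes; decidable-stable)
  open LucasSequence
  open StrongDivisibility
  open RankOfApparition
  open CyclotomicPart
  open Growth
  open GrowthConstants
  open PrimeFactors

  prime[3] : Prime 3
  prime[3] = from-yes (prime? 3)

  2∣p⊎2∣1+p : ∀ p → 2 ∣ p ⊎ 2 ∣ suc p
  2∣p⊎2∣1+p zero = inj₁ (2 ∣0)
  2∣p⊎2∣1+p (suc p) with 2∣p⊎2∣1+p p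
  ... | inj₁ 2∣p = inj₂ (∣m∣n⇒∣m+n ∣-refl 2∣p)
  ... | inj₂ 2∣1+p = inj₁ 2∣1+p

  odd : ∀ {p} → Prime p → p ≢ 2 → ∃[ b ] p ≡ 1 + b + b
  odd {zero} pr _ = ⊥-elim (¬prime[0] pr)
  odd {suc p} pr p≢2 with 2∣p⊎2∣1+p p
  ... | inj₂ 2∣1+p = ⊥-elim (p≢2 (sym (prime∣prime⇒≡ prime[2] pr 2∣1+p)))
  ... | inj₁ (divides b p≡) = b , cong suc (trans p≡ (trans (*-comm b 2) (cong (b +_) (+-identityʳ b))))

  odd+1-composite : ∀ {p} → Prime p → p ≢ 2 → ¬ Prime (suc p)
  odd+1-composite {p} pr p≢2 pr′ with odd pr p≢2 | odd pr′ (λ { refl → ¬prime[1] pr })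
  ... | b , p≡ | b′ , 1+p≡ = even≢odd b′ b (trans (cong (b′ +_) (+-identityʳ b′))
    (trans (sym (suc-injective 1+p≡)) (trans p≡ (sym (cong (λ i → suc (b + i)) (+-identityʳ b))))))

  1+p∤ : ∀ {p} h → Prime p → ¬ p ∣ 1 + p * h
  1+p∤ {p} h pr p∣ = prime∤1 pr (∣m+n∣n⇒∣m p∣ (m∣m*n h))

  V≥47 : ∀ z .{{_ : NonZero z}} {f} → 4 ≤ f → 47 ≤ V z f
  V≥47 z {f} 4≤f = ≤-trans (V-monoˡ-≤ 4 (>-nonZero⁻¹ z)) (V-mono-≤ z 4≤f)

  -- With p = 7 + i this reads 5 p² + 2 ≤ V_{p-1}. It fails at p = 5, where V₄ = 47, which is why
  -- the primes below 7 are treated singly.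
  V-large : ∀ i → 5 * ((7 + i) * (7 + i)) + 2 ≤ V 1 (6 + i)
  V-large zero    = from-yes (247 ≤? 322)
  V-large (suc i) = begin
    5 * ((8 + i) * (8 + i)) + 2 ≤⟨ m≤m+n _ (5 * i * i + 60 * i + 172) ⟩
    5 * ((8 + i) * (8 + i)) + 2 + (5 * i * i + 60 * i + 172) ≡⟨ identity i ⟩
    2 * (5 * ((7 + i) * (7 + i)) + 2) ≤⟨ *-monoʳ-≤ 2 (V-large i) ⟩
    2 * V 1 (6 + i) ≤⟨ V-doubling (5 + i) ⟩
    V 1 (7 + i) ∎
    where
    open ≤-Reasoning
    identity : ∀ i → 5 * ((8 + i) * (8 + i)) + 2 + (5 * i * i + 60 * i + 172) ≡ 2 * (5 * ((7 + i) * (7 + i)) + 2)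
    identity = solve-∀

  -- The linear coefficient of `R` is b (b + 1) p / 6 with p = 2b + 1. For p ≥ 5 it is a multiple of
  -- p, so p ∣ x already gives `R` ≡ p modulo p². For p = 3 the 6 cancels this factor and `R` is 3 +
  -- x, hence the demand 9 ∣ x.
  R-prime : ∀ x b → Prime (1 + b + b) → 1 + b + b ∣ x → (b ≡ 1 → 9 ∣ x) → ∃[ h ] R x b ≡ (1 + b + b) *
      (1 + (1 + b + b) * h)
  R-prime x zero pr = ⊥-elim (¬prime[1] pr)
  R-prime x (suc zero) pr _ 9∣x with 9∣x refl
  ... | divides c refl = c , identity c
    where
    identity : ∀ c → 1 + (2 + (0 + (c * 9) * 1)) ≡ 3 * (1 + 3 * c)
    identity = solve-∀
  R-prime x b@(suc (suc b′)) pr (divides c refl) _ = expand (R-expansion x b) (p∣s (euclidsLemma 6 (sumSquares b) pr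
      (subst (p ∣_) (sym (6*sumSquares b)) (n∣m*n (b * (1 + b))))))
    where
    p = 1 + b + b
    p∣s : p ∣ 6 ⊎ p ∣ sumSquares b → p ∣ sumSquares b
    p∣s (inj₂ p∣) = p∣
    p∣s (inj₁ p∣6) with euclidsLemma 2 3 pr p∣6
    ... | inj₁ p∣2 = contradiction (prime∣prime⇒≡ pr prime[2] p∣2) λ ()
    ... | inj₂ p∣3 = contradiction (trans (sym (index b′)) (prime∣prime⇒≡ pr prime[3] p∣3)) λ ()
      where
      index : ∀ b′ → 1 + (2 + b′) + (2 + b′) ≡ 5 + b′ + b′
      index = solve-∀
    identity : ∀ p c s e → p + c * p * (s * p) + c * p * (c * p) * e ≡ p * (1 + p * (c * s + c * c * e))
    identity = solve-∀
    expand : (∃[ e ] R x b ≡ p + x * sumSquares b + x * x * e) → p ∣ sumSquares b → ∃[ h ] R x b ≡ p * (1 + p * h)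
    expand (e , R≡) (divides s s≡) = c * s + c * c * e , trans R≡ (trans (cong (λ s → p + x * s + x * x * e) s≡)
        (identity p c s e))

  module _ (z n : ℕ) .{{_ : NonZero z}} (7≤n : 7 ≤ n) (n≢12 : n ≢ 12) (¬z≡1×n≡10 : z ≡ 1 → n ≢ 10)
    (noPrimitive : ∀ {p} → Prime p → p ∣ δ z n → ∃[ q ] ∃[ m ] Prime q × n ≡ q * m × p ∣ δ z m) where

    private
      instance
        n≢0 : NonZero n
        n≢0 = >-nonZero (≤-trans (s≤s z≤n) 7≤n)

      L : List ℕ
      L = proj₁ (primesDividing n n)
      ps : Primes≤ n L
      ps = proj₁ (proj₂ (primesDividing n n))
      Π∣n : product L ∣ n
      Π∣n = product∣ ps (proj₁ (proj₂ (proj₂ (primesDividing n n))))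
      ∈L : ∀ {p} → Prime p → p ∣ n → p ∈ L
      ∈L pr p∣n = proj₂ (proj₂ (proj₂ (primesDividing n n))) pr (∣⇒≤ p∣n) p∣n
      k : ℕ
      k = quotient Π∣n
      n≡ : n ≡ k * product L
      n≡ = _∣_.equality Π∣n
      instance
        k≢0 : NonZero k
        k≢0 = m*n≢0⇒m≢0 k {{subst NonZero n≡ n≢0}}

      g f : ℕ
      g = G z L k
      f = k * deg L

      instance
        g≢0 : NonZero g
        g≢0 = G≢0 z L k (primes≤⇒≢0 ps)

      V≤ : V z f ≤ 1 + 5 * g
      V≤ = V≤1+5*G z ps k

      4≤f : 4 ≤ f
      4≤f = 4≤φ ps k (subst (7 ≤_) n≡ 7≤n) (λ pr p∣ → ∈L pr (subst (_ ∣_) (sym n≡) p∣))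

      cofactor≢0 : ∀ {q m} → n ≡ q * m → NonZero m
      cofactor≢0 {q} n≡qm = m*n≢0⇒n≢0 q {{subst NonZero n≡qm n≢0}}

      g∣ : ∀ {q m Q} → Prime q → n ≡ q * m → δ (δ z m) q ≡ δ z m * Q → g ∣ Q
      g∣ {q} {m} pr n≡qm δ≡ = G∣ z L k {{prime⇒nonZero pr}} {{cofactor≢0 {q} {m} n≡qm}}
        (∈L pr (subst (q ∣_) (sym n≡qm) (m∣m*n m))) (trans (sym n≡) n≡qm) (trans (δ-compose z m q) δ≡)

      unique : ∀ {p q m} → Prime p → p ∣ g → Prime q → n ≡ q * m → p ∣ δ z m → p ≡ q
      unique {p} {q} {m} pr p∣g pr-q n≡qm p∣δ = prime∣prime⇒≡ pr pr-q (p∣q (euclidsLemma q q pr p∣qq))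
        where
        x = δ z m
        e = proj₁ (δ-expansion x q)
        identity : ∀ q x e → q * q * x + x * x * e ≡ x * (q * q + x * e)
        identity = solve-∀
        p∣Q : p ∣ q * q + x * e
        p∣Q = ∣-trans p∣g (g∣ pr-q n≡qm (trans (proj₂ (δ-expansion x q)) (identity q x e)))
        p∣qq : p ∣ q * q
        p∣qq = ∣m+n∣n⇒∣m p∣Q (∣m⇒∣m*n e p∣δ)
        p∣q : p ∣ q ⊎ p ∣ q → p ∣ q
        p∣q (inj₁ h) = h
        p∣q (inj₂ h) = h

      -- Every prime p ∣ g divides n, and it is the only prime q ∣ n with p ∣ δ z (n / q).
      module Bad {p} (pr : Prime p) (p∣g : p ∣ g) where
        p∣δn : p ∣ δ z n
        p∣δn = ∣-trans p∣g (divides (A z L k) (trans (trans (cong (δ z) n≡) (G*A z L k)) (*-comm g (A z L k))))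

        descend : ∃[ m ] n ≡ p * m × p ∣ δ z m
        descend = from (noPrimitive pr p∣δn)
          where
          from : (∃[ q ] ∃[ m ] Prime q × n ≡ q * m × p ∣ δ z m) → ∃[ m ] n ≡ p * m × p ∣ δ z m
          from (q , m , pr-q , n≡qm , p∣δ) = m , subst (λ q → n ≡ q * m) (sym (unique pr p∣g pr-q n≡qm p∣δ)) n≡qm ,
              p∣δ

        m = proj₁ descend
        n≡pm = proj₁ (proj₂ descend)
        p∣δm = proj₂ (proj₂ descend)

        instance
          p≢0 : NonZero p
          p≢0 = prime⇒nonZero pr

        p∣n : p ∣ n
        p∣n = subst (p ∣_) (sym n≡pm) (m∣m*n m)

        excluded : ∀ {q m′ r} → Prime q → p ≢ q → n ≡ q * m′ → p ∣ δ z r → r ∣ m′ → ⊥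
        excluded pr-q p≢q n≡qm′ p∣δr r∣m′ = p≢q (unique pr p∣g pr-q n≡qm′ (∣-trans p∣δr (δ-mono-∣ z r∣m′)))

        -- If q did not divide r, then gcd(n, r) would divide n / q, so p ∣ δ_{n/q} and p = q by
        -- `unique`. It confines the prime factors of n to those of any small r with p ∣ δ_r.
        otherPrime∣ : ∀ {q r} → Prime q → p ≢ q → q ∣ n → p ∣ δ z r → q ∣ r
        otherPrime∣ {q} {r} pr-q p≢q q∣n@(divides m′ n≡m′q) p∣δr with q ∣? r
        ... | yes q∣r = q∣r
        ... | no q∤r = ⊥-elim (excluded pr-q p≢q n≡qm′ (δ-∣-gcd z n r p∣δn p∣δr)
                (coprime-divisor (prime∤⇒coprime pr-q (λ q∣gcd → q∤r (∣-trans q∣gcd (gcd[m,n]∣n n r))))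
                                 (subst (gcd n r ∣_) n≡qm′ (gcd[m,n]∣m n r))))
          where
          n≡qm′ = trans n≡m′q (*-comm m′ q)

        p≤pred : pred p ≤ f
        p≤pred = pred≤k*deg ps k (∈L pr p∣n)

      -- By the rank of apparition q divides p - 1 or p + 1. The value q = p + 1 is excluded because
      -- p + 1 is even and larger than 2.
      odd-bad-max : ∀ {p q} → Prime p → p ∣ g → p ≢ 2 → Prime q → q ∣ n → p ≢ q → q < p
      odd-bad-max {zero} pr _ _ _ _ _ = ⊥-elim (¬prime[0] pr)
      odd-bad-max {suc p} {q} pr p∣g p≢2 pr-q q∣n p≢q = [ below , above ]′ (rank z pr p≢2)
        where
        p≢0 : NonZero p
        p≢0 = ≢-nonZero λ { refl → ¬prime[1] pr }
        below : suc p ∣ δ z p → q < suc p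
        below p∣δ = s≤s (∣⇒≤ {{p≢0}} (Bad.otherPrime∣ pr p∣g pr-q p≢q q∣n p∣δ))
        above : suc p ∣ δ z (2 + p) → q < suc p
        above p∣δ = ≤∧≢⇒< (≤-pred (≤∧≢⇒< (∣⇒≤ (Bad.otherPrime∣ pr p∣g pr-q p≢q q∣n p∣δ)) (λ q≡ → odd+1-composite pr
            p≢2 (subst Prime q≡ pr-q)))) (p≢q ∘ sym)

      onlyPrime : ∀ p m .{{_ : NonZero m}} → (∀ {q} → Prime q → q ∣ m → q ≡ p) → m ≡ 1 ⊎ ∃[ m′ ] m ≡ p * m′
      onlyPrime p m only with primeDivisor m
      ... | inj₁ m≡1 = inj₁ m≡1
      ... | inj₂ (q , pr , q∣m) with only pr q∣m
      ... | refl with q∣m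
      ... | divides m′ m≡ = inj₂ (m′ , trans m≡ (*-comm m′ p))

      powerOf2 : ∀ m .{{_ : NonZero m}} → (∀ {q} → Prime q → q ∣ m → q ≡ 2) → m ≡ 1 ⊎ m ≡ 2 ⊎ m ≡ 4 ⊎ 8 ∣ m
      powerOf2 m only with onlyPrime 2 m only
      ... | inj₁ m≡1 = inj₁ m≡1
      ... | inj₂ (m₁ , refl) with onlyPrime 2 m₁ {{m*n≢0⇒n≢0 2}} (λ pr q∣ → only pr (∣n⇒∣m*n 2 q∣))
      ... | inj₁ refl = inj₂ (inj₁ refl)
      ... | inj₂ (m₂ , refl) with onlyPrime 2 m₂ {{m*n≢0⇒n≢0 4 {{subst NonZero (sym (*-assoc 2 2 m₂)) it}}}}
          (λ pr q∣ → only pr (∣n⇒∣m*n 2 (∣n⇒∣m*n 2 q∣)))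
      ... | inj₁ refl = inj₂ (inj₂ (inj₁ refl))
      ... | inj₂ (m₃ , refl) = inj₂ (inj₂ (inj₂ (divides m₃ (identity m₃))))
        where
        identity : ∀ m → 2 * (2 * (2 * m)) ≡ m * 8
        identity = solve-∀

      n≤6⇒⊥ : n ≤ 6 → ⊥
      n≤6⇒⊥ n≤6 = from-no (7 ≤? 6) (≤-trans 7≤n n≤6)

      -- δ₃ = z (z + 3)², and one of z and z + 3 is even.
      2∣δ3 : 2 ∣ δ z 3
      2∣δ3 = subst (2 ∣_) (sym (identity z)) (2∣z*[1+z]² (2∣p⊎2∣1+p z))
        where
        identity : ∀ z → 0 + z * 1 + z * (1 + (2 + (0 + z * 1))) + z * (1 + (2 + (0 + z * 1)) +
            (2 + (0 + z * 1 + z * (1 + (2 + (0 + z * 1)))))) ≡ z * ((3 + z) * (3 + z))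
        identity = solve-∀
        2∣z*[1+z]² : 2 ∣ z ⊎ 2 ∣ suc z → 2 ∣ z * ((3 + z) * (3 + z))
        2∣z*[1+z]² (inj₁ h) = ∣m⇒∣m*n _ h
        2∣z*[1+z]² (inj₂ h) = ∣n⇒∣m*n z (∣m⇒∣m*n (3 + z) (∣m∣n⇒∣m+n (∣-refl {2}) h))

      -- As 2 ∣ δ₃, every odd prime factor of n divides 3, and 9 ∤ n because otherwise 2 ∣ δ_{n/3}.
      -- So n is 2ᵃ or 3 · 2ᵃ, and n ≥ 7 with n ≠ 12 leaves a ≥ 3.
      2-bad⇒8∣n : 2 ∣ g → 8 ∣ n
      2-bad⇒8∣n 2∣g with 3 ∣? n
      ... | no 3∤n = finish (powerOf2 n only)
        where
        open Bad prime[2] 2∣g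
        only : ∀ {q} → Prime q → q ∣ n → q ≡ 2
        only {q} pr q∣n with 2 ≟ q
        ... | yes 2≡q = sym 2≡q
        ... | no 2≢q with prime∣prime⇒≡ pr prime[3] (otherPrime∣ {r = 3} pr 2≢q q∣n 2∣δ3)
        ... | refl = ⊥-elim (3∤n q∣n)
        finish : n ≡ 1 ⊎ n ≡ 2 ⊎ n ≡ 4 ⊎ 8 ∣ n → 8 ∣ n
        finish (inj₁ n≡1) = ⊥-elim (n≤6⇒⊥ (≤-trans (≤-reflexive n≡1) (from-yes (1 ≤? 6))))
        finish (inj₂ (inj₁ n≡2)) = ⊥-elim (n≤6⇒⊥ (≤-trans (≤-reflexive n≡2) (from-yes (2 ≤? 6))))
        finish (inj₂ (inj₂ (inj₁ n≡4))) = ⊥-elim (n≤6⇒⊥ (≤-trans (≤-reflexive n≡4) (from-yes (4 ≤? 6))))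
        finish (inj₂ (inj₂ (inj₂ 8∣n))) = 8∣n
      ... | yes (divides n′ n≡n′3) = finish (powerOf2 n′ {{cofactor≢0 {3} {n′} n≡3n′}} only)
        where
        open Bad prime[2] 2∣g
        n≡3n′ = trans n≡n′3 (*-comm n′ 3)
        only : ∀ {q} → Prime q → q ∣ n′ → q ≡ 2
        only {q} pr q∣n′ with 2 ≟ q
        ... | yes 2≡q = sym 2≡q
        ... | no 2≢q with prime∣prime⇒≡ pr prime[3] (otherPrime∣ {r = 3} pr 2≢q (∣-trans q∣n′ (divides 3 n≡3n′)) 2∣δ3)
        ... | refl = ⊥-elim (excluded {r = 3} prime[3] (λ ()) n≡3n′ 2∣δ3 q∣n′)
        finish : n′ ≡ 1 ⊎ n′ ≡ 2 ⊎ n′ ≡ 4 ⊎ 8 ∣ n′ → 8 ∣ n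
        finish (inj₁ n′≡) = ⊥-elim (n≤6⇒⊥ (≤-trans (≤-reflexive (trans n≡n′3 (cong (_* 3) n′≡))) (from-yes (3 ≤? 6))))
        finish (inj₂ (inj₁ n′≡)) = ⊥-elim (n≤6⇒⊥ (≤-reflexive (trans n≡n′3 (cong (_* 3) n′≡))))
        finish (inj₂ (inj₂ (inj₁ n′≡))) = ⊥-elim (n≢12 (trans n≡n′3 (cong (_* 3) n′≡)))
        finish (inj₂ (inj₂ (inj₂ 8∣n′))) = ∣-trans 8∣n′ (divides 3 n≡3n′)

      module Bad3 (pr : Prime 3) (3∣g : 3 ∣ g) where
        open Bad pr 3∣g

        3∣δ4 : 3 ∣ δ z 4
        3∣δ4 = [ (λ 3∣δ2 → ∣-trans 3∣δ2 (δ-mono-∣ z {2} {4} (divides 2 refl))) , (λ h → h) ]′ (rank z pr (λ ()))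

        8∤n : ¬ 8 ∣ n
        8∤n (divides c n≡c8) = excluded {m′ = 4 * c} {r = 4} prime[2] (λ ()) (trans n≡c8 (identity c)) 3∣δ4 (m∣m*n c)
          where
          identity : ∀ c → c * 8 ≡ 2 * (4 * c)
          identity = solve-∀

        -- Since 3 ∣ δ₄, the only other possible prime factor of n is 2. If 3 ∤ m, then n = 3 · 2ᵃ,
        -- where a ≤ 2 contradicts n ≥ 7 or n ≠ 12 and a ≥ 3 contradicts 8 ∤ n.
        3∣cofactor : ∀ m → n ≡ 3 * m → 3 ∣ m
        3∣cofactor m n≡3m = decidable-stable (3 ∣? m) λ 3∤m → finish (powerOf2 m {{cofactor≢0 {3} {m} n≡3m}}
            (only 3∤m))
          where
          only : ¬ 3 ∣ m → ∀ {q} → Prime q → q ∣ m → q ≡ 2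
          only 3∤m {q} pr-q q∣m = prime∣prime⇒≡ pr-q prime[2] ([ (λ h → h) , (λ h → h) ]′ (euclidsLemma 2 2 pr-q q∣4))
            where
            q∣4 : q ∣ 4
            q∣4 = otherPrime∣ {r = 4} pr-q (λ 3≡q → 3∤m (subst (_∣ m) (sym 3≡q) q∣m)) (∣-trans q∣m (divides 3 n≡3m))
                3∣δ4
          finish : m ≡ 1 ⊎ m ≡ 2 ⊎ m ≡ 4 ⊎ 8 ∣ m → ⊥
          finish (inj₁ m≡) = n≤6⇒⊥ (≤-trans (≤-reflexive (trans n≡3m (cong (3 *_) m≡))) (from-yes (3 ≤? 6)))
          finish (inj₂ (inj₁ m≡)) = n≤6⇒⊥ (≤-reflexive (trans n≡3m (cong (3 *_) m≡)))
          finish (inj₂ (inj₂ (inj₁ m≡))) = n≢12 (trans n≡3m (cong (3 *_) m≡))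
          finish (inj₂ (inj₂ (inj₂ 8∣m))) = 8∤n (∣-trans 8∣m (divides 3 n≡3m))

        3∣m : 3 ∣ m
        3∣m = 3∣cofactor m n≡pm

        -- With y = δ_{m/3} one has δ_m = y (3 + y)². That 3 ∣ y holds because 3 divides δ at gcd(m,
        -- 4), an index that still divides m / 3. `R-prime` asks for this when p = 3.
        9∣δm : 9 ∣ δ z m
        9∣δm = divides (c * 3 * ((1 + c) * (1 + c))) (trans (cong (δ z) m≡) (trans (δ-compose z m₃ 3)
            (trans (cong (λ y → δ y 3) (_∣_.equality 3∣δm₃)) (identity c))))
          where
          m₃ = quotient 3∣m
          m≡ : m ≡ 3 * m₃
          m≡ = trans (_∣_.equality 3∣m) (*-comm m₃ 3)
          3∤gcd : ¬ 3 ∣ gcd m 4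
          3∤gcd 3∣gcd = from-no (3 ∣? 4) (∣-trans 3∣gcd (gcd[m,n]∣n m 4))
          3∣δm₃ : 3 ∣ δ z m₃
          3∣δm₃ = ∣-trans (δ-∣-gcd z m 4 p∣δm 3∣δ4)
            (δ-mono-∣ z {gcd m 4} {m₃} (coprime-divisor (prime∤⇒coprime pr 3∤gcd) (subst (gcd m 4 ∣_) m≡ (gcd[m,n]∣m
                m 4))))
          c = quotient 3∣δm₃
          identity : ∀ c → 0 + c * 3 * 1 + c * 3 * (1 + (2 + (0 + c * 3 * 1))) + c * 3 * (1 + (2 + (0 + c * 3 * 1)) +
              (2 + (0 + c * 3 * 1 + c * 3 * (1 + (2 + (0 + c * 3 * 1))))))
                   ≡ c * 3 * ((1 + c) * (1 + c)) * 9
          identity = solve-∀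

      -- An odd p would be the largest prime factor of n. If p = 2, then q ∣ 3 because 2 ∣ δ₃, and
      -- the primes 2 and 3 impose 8 ∣ n and 8 ∤ n.
      ¬bad<bad : ∀ {p q} → Prime p → p ∣ g → Prime q → q ∣ g → p < q → ⊥
      ¬bad<bad {p} {q} pr-p p∣g pr-q q∣g p<q with p ≟ 2
      ... | no p≢2 = <-asym p<q (odd-bad-max pr-p p∣g p≢2 pr-q (Bad.p∣n pr-q q∣g) (<⇒≢ p<q))
      ... | yes refl = Bad3.8∤n prime[3] (subst (_∣ g) q≡3 q∣g) (2-bad⇒8∣n p∣g)
        where
        q≡3 : q ≡ 3
        q≡3 = prime∣prime⇒≡ pr-q prime[3] (Bad.otherPrime∣ pr-p p∣g {r = 3} pr-q (<⇒≢ p<q) (Bad.p∣n pr-q q∣g) 2∣δ3)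

      bad-unique : ∀ {p q} → Prime p → p ∣ g → Prime q → q ∣ g → p ≡ q
      bad-unique {p} {q} pr-p p∣g pr-q q∣g with <-cmp p q
      ... | tri≈ _ p≡q _ = p≡q
      ... | tri< p<q _ _ = ⊥-elim (¬bad<bad pr-p p∣g pr-q q∣g p<q)
      ... | tri> _ _ q<p = ⊥-elim (¬bad<bad pr-q q∣g pr-p p∣g q<p)

      -- The multiple is δₙ / δ_{n/p}, shown to be p² times a number prime to p. As p is the only
      -- prime factor of g, the second factor is prime to g, which leaves g ∣ p².
      g∣p²w : ∀ {p} → Prime p → p ∣ g → ∃[ h ] g ∣ (1 + p * h) * (p * p)
      g∣p²w {p} pr p∣g with p ≟ 2
      ... | yes refl = even (2-bad⇒8∣n p∣g)
        where
        even : 8 ∣ n → ∃[ h ] g ∣ (1 + 2 * h) * 4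
        even (divides c n≡c8) = finish 2∣δc
          where
          open Bad pr p∣g
          id₁ : ∀ c → c * 8 ≡ 2 * (2 * (2 * c))
          id₁ = solve-∀
          id₂ : ∀ c → c * 8 ≡ 8 * c
          id₂ = solve-∀
          gcd∣c : gcd n 3 ∣ c
          gcd∣c = coprime-divisor {n = 8} (λ (d∣gcd , d∣8) → from-yes (Coprime.coprime? 3 8) (∣-trans d∣gcd
              (gcd[m,n]∣n n 3) , d∣8))
            (subst (gcd n 3 ∣_) (trans n≡c8 (id₂ c)) (gcd[m,n]∣m n 3))
          2∣δc : 2 ∣ δ z c
          2∣δc = ∣-trans (δ-∣-gcd z n 3 p∣δn 2∣δ3) (δ-mono-∣ z {gcd n 3} {c} gcd∣c)
          finish : 2 ∣ δ z c → ∃[ h ] g ∣ (1 + 2 * h) * 4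
          -- Two doublings starting from 2 ∣ δ_c make x = δ_{4c} a multiple of 16, so the quotient
          -- δ_{8c} / δ_{4c} = 4 + x is 4 times an odd number. This is the use of 8 ∣ n.
          finish (divides d δc≡) = 2 * e , g∣ {2} {2 * (2 * c)} {(1 + 2 * (2 * e)) * 4} prime[2] (trans n≡c8 (id₁ c))
              (trans (δ-two x) (cong (x *_) (trans (cong (4 +_) x≡) (id₅ e))))
            where
            y₂ = δ z (2 * c)
            x = δ z (2 * (2 * c))
            e = d * (2 + d) * (1 + d * (2 + d))
            y₂≡ : y₂ ≡ 4 * (d * (2 + d))
            y₂≡ = trans (δ-compose z c 2) (trans (cong (λ y → δ y 2) δc≡) (trans (δ-two (d * 2)) (id₃ d)))
              where
              id₃ : ∀ d → d * 2 * (4 + d * 2) ≡ 4 * (d * (2 + d))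
              id₃ = solve-∀
            x≡ : x ≡ 16 * e
            x≡ = trans (δ-compose z (2 * c) 2) (trans (cong (λ y → δ y 2) y₂≡) (trans (δ-two (4 * (d * (2 + d))))
                (id₄ (d * (2 + d)))))
              where
              id₄ : ∀ w → 4 * w * (4 + 4 * w) ≡ 16 * (w * (1 + w))
              id₄ = solve-∀
            id₅ : ∀ e → 4 + 16 * e ≡ (1 + 2 * (2 * e)) * 4
            id₅ = solve-∀
      ... | no p≢2 with odd pr p≢2
      ... | b , refl = 2 * h + p * h * h , subst (g ∣_) square (g∣ {p} {m} pr n≡pm (δ-odd (δ z m) b
          {{δ≢0 z m {{it}} {{cofactor≢0 {p} {m} n≡pm}}}}))
        where
        open Bad pr p∣g
        expansion : ∃[ h ] R (δ z m) b ≡ p * (1 + p * h)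
        expansion = R-prime (δ z m) b pr p∣δm (λ { refl → Bad3.9∣δm pr p∣g })
        h = proj₁ expansion
        identity : ∀ p h → p * (1 + p * h) * (p * (1 + p * h)) ≡ (1 + p * (2 * h + p * h * h)) * (p * p)
        identity = solve-∀
        square : R (δ z m) b * R (δ z m) b ≡ (1 + p * (2 * h + p * h * h)) * (p * p)
        square = trans (cong (λ r → r * r) (proj₂ expansion)) (identity p h)

      g≤p² : ∀ {p} → Prime p → p ∣ g → g ≤ p * p
      g≤p² {p} pr p∣g with g∣p²w pr p∣g
      ... | h , g∣ = ∣⇒≤ {{m*n≢0 p p {{prime⇒nonZero pr}} {{prime⇒nonZero pr}}}}
        (coprime-divisor (coprimeByPrimes g (1 + p * h) λ pr-q q∣g q∣w →
          1+p∤ h pr (subst (_∣ 1 + p * h) (bad-unique pr-q q∣g pr p∣g) q∣w)) g∣)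

      small-V : ∀ {c} → V z f ≤ c → c < 47 → ⊥
      small-V V≤c c<47 = <-irrefl refl (≤-trans c<47 (≤-trans (V≥47 z 4≤f) V≤c))

      n-not-10 : 1 < z → ∀ {c} → V z f ≤ c → c < 194 → ⊥
      n-not-10 1<z V≤c c<194 = <-irrefl refl (≤-trans c<194 (≤-trans (V-monoˡ-≤ 4 1<z) (≤-trans (V-mono-≤ z 4≤f)
          V≤c)))

    someTermHasPrimitive : ⊥
    someTermHasPrimitive with primeDivisor g
    ... | inj₁ g≡1 = small-V (subst (λ g → V z f ≤ 1 + 5 * g) g≡1 V≤) (from-yes (6 <? 47))
    ... | inj₂ (p , pr , p∣g) = bySize p pr p∣g (≤-trans V≤ (+-monoʳ-≤ 1 (*-monoʳ-≤ 5 (g≤p² pr p∣g))))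
      where
      bySize : ∀ p → Prime p → p ∣ g → V z f ≤ 1 + 5 * (p * p) → ⊥
      bySize 0 pr = ⊥-elim (¬prime[0] pr)
      bySize 1 pr = ⊥-elim (¬prime[1] pr)
      bySize 2 pr p∣g h = small-V h (from-yes (21 <? 47))
      bySize 3 pr p∣g h = small-V h (from-yes (46 <? 47))
      bySize 4 pr = ⊥-elim (from-no (prime? 4) pr)
      -- The bound is 1 + 5 · 25 = 126. At n = 10 one has φ(n) = 4, and V₄ is 194 for z = 2 but only
      -- 47 for z = 1, hence the excluded pair; for every other n, φ(n) ≥ 6 and V₆ ≥ 322.
      bySize 5 pr p∣g h with n ≟ 10
      ... | yes n≡10 = n-not-10 (≤∧≢⇒< (>-nonZero⁻¹ z) (λ 1≡z → ¬z≡1×n≡10 (sym 1≡z) n≡10)) h (from-yes (126 <? 194))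
      ... | no n≢10 = from-no (322 ≤? 126) (≤-trans (V-monoˡ-≤ 6 (>-nonZero⁻¹ z))
        (≤-trans (V-mono-≤ z (6≤φ ps k (subst (7 ≤_) n≡ 7≤n) (n≢10 ∘ trans n≡) (∈L pr (Bad.p∣n pr p∣g)))) h))
      bySize 6 pr = ⊥-elim (from-no (prime? 6) pr)
      bySize p@(suc (suc (suc (suc (suc (suc (suc i))))))) pr p∣g h = <-irrefl refl (begin-strict
        1 + 5 * (p * p) <⟨ ≤-reflexive (+-comm 2 (5 * (p * p))) ⟩
        5 * (p * p) + 2 ≤⟨ V-large i ⟩
        V 1 (6 + i) ≤⟨ V-monoˡ-≤ (6 + i) (>-nonZero⁻¹ z) ⟩
        V z (6 + i) ≤⟨ V-mono-≤ z (Bad.p≤pred pr p∣g) ⟩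
        V z f ≤⟨ h ⟩
        1 + 5 * (p * p) ∎)
        where open ≤-Reasoning

-- Primitive prime divisors, the index 12 and the bound Z ≤ 6

module PrimitiveDivisors where

  open import Data.Empty using (⊥; ⊥-elim)
  open import Data.Integer as ℤ using (ℤ; +_)
  import Data.Integer.Properties as ℤ
  open import Data.Nat using (ℕ; zero; suc; _+_; _*_; _^_; _≤_; _<_; _≤?_; _≟_; z≤n; s≤s; NonZero; ≢-nonZero; ≢-nonZero⁻¹; >-nonZero)
  open import Data.Nat.DivMod using (_%_; _/_; m≡m%n+[m/n]*n; m%n<n)
  open import Data.Nat.DivMod using (_%_; _/_; m≡m%n+[m/n]*n; m%n<n)
  open import Data.Nat.Divisibility
  open import Data.Nat.GCD using (gcd; gcd[m,n]∣m; gcd[m,n]≤n)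
  open import Data.Nat.Primality using (Prime; prime?; prime[2]; euclidsLemma)
  open import Data.Nat.Properties hiding (_≤?_; _<?_; _≟_)
  open import Data.Nat.Tactic.RingSolver using (solve-∀)
  open import Data.Product using (∃; ∃-syntax; _×_; _,_; proj₁; proj₂)
  open import Data.Sum using (_⊎_; inj₁; inj₂; [_,_]′)
  open import Defs using (PrimitivePrimeDivisor; NoPrimitive; Z[_]≤_)
  open import Function using (it; _∘_)
  open import Relation.Binary.PropositionalEquality using (_≡_; _≢_; refl; sym; trans; cong; subst)
  open import Relation.Nullary using (¬_; yes; no; Dec)
  open import Relation.Nullary.Decidable using (from-no; from-yes; _×-dec_; _→-dec_; ¬?; map′)
  open LucasSequence
  open StrongDivisibility
  open CyclotomicPart
  open PrimeFactors
  open Zsigmondy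

  Δ : ℕ → ℕ → ℤ
  Δ z n = ℤ.- (+ δ z n)

  ∣Δ∣ : ∀ z n → ℤ.∣ Δ z n ∣ ≡ δ z n
  ∣Δ∣ z n = ℤ.∣-i∣≡∣i∣ (+ δ z n)

  Primitive : ℕ → ℕ → ℕ → Set
  Primitive z n p = Prime p × p ∣ δ z n × (∀ {m} → m < n → 1 ≤ m → ¬ p ∣ δ z m)

  primitive? : ∀ z n p → Dec (Primitive z n p)
  primitive? z n p = prime? p ×-dec (p ∣? δ z n) ×-dec allUpTo? (λ m → (1 ≤? m) →-dec ¬? (p ∣? δ z m)) n

  primitive⇒ : ∀ {z n p} → Primitive z n p → PrimitivePrimeDivisor (Δ z) n p
  primitive⇒ {z} {n} {p} (pr , p∣δ , new) = pr , subst (p ∣_) (sym (∣Δ∣ z n)) p∣δ ,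
    λ m 1≤m m<n _ p∣Δ → new m<n 1≤m (subst (p ∣_) (∣Δ∣ z m) p∣Δ)

  primitive⇐ : ∀ {z n p} .{{_ : NonZero z}} → PrimitivePrimeDivisor (Δ z) n p → Primitive z n p
  primitive⇐ {z} {n} {p} (pr , p∣Δ , new) = pr , subst (p ∣_) (∣Δ∣ z n) p∣Δ ,
    λ {m} m<n 1≤m p∣δ → new m 1≤m m<n (λ Δ≡0 → ≢-nonZero⁻¹ (δ z m) {{δ≢0 z m {{it}} {{>-nonZero 1≤m}}}}
        (trans (sym (∣Δ∣ z m)) (cong ℤ.∣_∣ Δ≡0)))
      (subst (p ∣_) (sym (∣Δ∣ z m)) p∣δ)

  noPrimitive? : ∀ z .{{_ : NonZero z}} n → Dec (NoPrimitive (Δ z) n)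
  noPrimitive? z zero    = no λ ()
  noPrimitive? z n@(suc _) = map′ to from (¬? (anyUpTo? (primitive? z n) (suc (δ z n))))
    where
    to : ¬ (∃[ p ] p < suc (δ z n) × Primitive z n p) → NoPrimitive (Δ z) n
    to none = s≤s z≤n , λ (p , prim) → none (p , s≤s (∣⇒≤ {{δ≢0 z n}} (proj₁ (proj₂ (primitive⇐ prim)))) , primitive⇐
        prim)
    from : NoPrimitive (Δ z) n → ¬ (∃[ p ] p < suc (δ z n) × Primitive z n p)
    from (_ , none) (p , _ , prim) = none (p , primitive⇒ prim)

  properPrimeCofactor : ∀ {g n} → 1 ≤ n → g ∣ n → g < n → ∃[ q ] ∃[ m ] Prime q × n ≡ q * m × g ∣ m
  properPrimeCofactor {g} {n} 1≤n (divides c n≡) g<n = fromPrime (primeDivisor c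
      {{m*n≢0⇒m≢0 c {{subst NonZero n≡ (>-nonZero 1≤n)}}}})
    where
    fromPrime : c ≡ 1 ⊎ (∃[ q ] Prime q × q ∣ c) → ∃[ q ] ∃[ m ] Prime q × n ≡ q * m × g ∣ m
    fromPrime (inj₁ c≡1) = ⊥-elim (<-irrefl (sym (trans n≡ (trans (cong (_* g) c≡1) (*-identityˡ g)))) g<n)
    fromPrime (inj₂ (q , pr , divides c′ c≡)) = q , c′ * g , pr , trans n≡ (trans (cong (_* g) c≡) (identity c′ q g))
        , n∣m*n c′
      where
      identity : ∀ c q g → c * q * g ≡ q * (c * g)
      identity = solve-∀

  descends : ∀ z {n p} → 1 ≤ n → p ∣ δ z n → (∃[ m ] m < n × 1 ≤ m × p ∣ δ z m) → ∃[ q ] ∃[ m ] Prime q × n ≡ q * m ×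
      p ∣ δ z m
  descends z {n} {p} 1≤n p∣δn (m , m<n , 1≤m , p∣δm) = conclude (properPrimeCofactor 1≤n (gcd[m,n]∣m n m)
      (≤-<-trans (gcd[m,n]≤n n m {{>-nonZero 1≤m}}) m<n))
    where
    conclude : (∃[ q ] ∃[ m′ ] Prime q × n ≡ q * m′ × gcd n m ∣ m′) → ∃[ q ] ∃[ m′ ] Prime q × n ≡ q * m′ × p ∣ δ z m′
    conclude (q , m′ , pr , n≡ , g∣m′) = q , m′ , pr , n≡ , ∣-trans (δ-∣-gcd z n m p∣δn p∣δm) (δ-mono-∣ z g∣m′)

  primitive⊎descends : ∀ z {n p} → 1 ≤ n → Prime p → p ∣ δ z n →
                       Primitive z n p ⊎ (∃[ q ] ∃[ m ] Prime q × n ≡ q * m × p ∣ δ z m)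
  primitive⊎descends z {n} {p} 1≤n pr p∣δn = decide (anyUpTo? (λ m → (1 ≤? m) ×-dec (p ∣? δ z m)) n)
    where
    decide : Dec (∃[ m ] m < n × 1 ≤ m × p ∣ δ z m) → Primitive z n p ⊎ (∃[ q ] ∃[ m ] Prime q × n ≡ q * m × p ∣ δ z
        m)
    decide (yes earlier) = inj₂ (descends z 1≤n p∣δn earlier)
    decide (no new) = inj₁ (pr , p∣δn , λ {m} m<n 1≤m p∣δm → new (m , m<n , 1≤m , p∣δm))

  -- t² − 3 with t = z + 2, the minimal polynomial of 2 cos(2π/12) at t.
  ψ₁₂ : ℕ → ℕ
  ψ₁₂ z = 1 + z * (4 + z)

  ∣ψ₁₂⇒∣ψ₁₂[%] : ∀ a .{{_ : NonZero a}} z → a ∣ ψ₁₂ z → a ∣ ψ₁₂ (z % a)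
  ∣ψ₁₂⇒∣ψ₁₂[%] a z a∣ = ∣m+n∣n⇒∣m (subst (a ∣_) (trans (cong ψ₁₂ (m≡m%n+[m/n]*n z a)) (identity (z % a) (z / a) a))
      a∣) (n∣m*n (z / a * (4 + z % a + z % a + z / a * a)))
    where
    identity : ∀ r c a → 1 + (r + c * a) * (4 + (r + c * a)) ≡ 1 + r * (4 + r) + c * (4 + r + r + c * a) * a
    identity = solve-∀

  4∤ψ₁₂ : ∀ z → ¬ 4 ∣ ψ₁₂ z
  4∤ψ₁₂ z 4∣ = from-yes (allUpTo? (λ r → ¬? (4 ∣? ψ₁₂ r)) 4) (m%n<n z 4) (∣ψ₁₂⇒∣ψ₁₂[%] 4 z 4∣)

  9∤ψ₁₂ : ∀ z → ¬ 9 ∣ ψ₁₂ z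
  9∤ψ₁₂ z 9∣ = from-yes (allUpTo? (λ r → ¬? (9 ∣? ψ₁₂ r)) 9) (m%n<n z 9) (∣ψ₁₂⇒∣ψ₁₂[%] 9 z 9∣)

  removeFactor : ∀ p m .{{_ : NonZero m}} → ¬ p * p ∣ m → ∃[ m′ ] (m ≡ m′ ⊎ m ≡ p * m′) × ¬ p ∣ m′
  removeFactor p m p²∤m with p ∣? m
  ... | no p∤m = m , inj₁ refl , p∤m
  ... | yes (divides m′ m≡) = m′ , inj₂ (trans m≡ (*-comm m′ p)) ,
    λ { (divides c m′≡) → p²∤m (divides c (trans m≡ (trans (cong (_* p) m′≡) (*-assoc c p p)))) }

  -- t² - 3 is divisible neither by 4 nor by 9, so its part made of 2 and 3 is at most 6, while z ≥
  -- 2 makes it at least 13. For z = 1 it is exactly 6, and Δ₁₂ has no primitive prime divisor.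
  bigPrime∣ψ₁₂ : ∀ z → 2 ≤ z → ∃[ p ] Prime p × p ∣ ψ₁₂ z × p ≢ 2 × p ≢ 3
  bigPrime∣ψ₁₂ z 2≤z = conclude (removeFactor 2 w (4∤ψ₁₂ z))
    where
    w = ψ₁₂ z
    13≤w : 13 ≤ w
    13≤w = +-monoʳ-≤ 1 (*-mono-≤ 2≤z (+-monoʳ-≤ 4 2≤z))
    ∣of≡ : ∀ p {a b} → a ≡ b ⊎ a ≡ p * b → b ∣ a
    ∣of≡ p (inj₁ refl) = ∣-refl
    ∣of≡ p (inj₂ refl) = n∣m*n p
    ≤of≡ : ∀ p {a b} .{{_ : NonZero p}} → a ≡ b ⊎ a ≡ p * b → a ≤ p * b
    ≤of≡ p {b = b} (inj₁ refl) = m≤n*m b p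
    ≤of≡ p (inj₂ refl) = ≤-refl
    conclude : (∃[ w₁ ] (w ≡ w₁ ⊎ w ≡ 2 * w₁) × ¬ 2 ∣ w₁) → ∃[ p ] Prime p × p ∣ w × p ≢ 2 × p ≢ 3
    conclude (w₁ , w≡ , 2∤w₁) = conclude′ (removeFactor 3 w₁ {{w₁≢0}} (λ 9∣ → 9∤ψ₁₂ z (∣-trans 9∣ (∣of≡ 2 w≡))))
      where
      w₁≢0 : NonZero w₁
      w₁≢0 = ≢-nonZero λ w₁≡0 → 2∤w₁ (subst (2 ∣_) (sym w₁≡0) (2 ∣0))
      conclude′ : (∃[ w₂ ] (w₁ ≡ w₂ ⊎ w₁ ≡ 3 * w₂) × ¬ 3 ∣ w₂) → ∃[ p ] Prime p × p ∣ w × p ≢ 2 × p ≢ 3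
      conclude′ (w₂ , w₁≡ , 3∤w₂) = conclude″ (primeDivisor w₂ {{≢-nonZero λ w₂≡0 → 3∤w₂ (subst (3 ∣_) (sym w₂≡0)
          (3 ∣0))}})
        where
        conclude″ : w₂ ≡ 1 ⊎ (∃[ p ] Prime p × p ∣ w₂) → ∃[ p ] Prime p × p ∣ w × p ≢ 2 × p ≢ 3
        conclude″ (inj₁ w₂≡1) = ⊥-elim (from-no (13 ≤? 6) (≤-trans 13≤w (≤-trans (≤of≡ 2 w≡)
          (*-monoʳ-≤ 2 (≤-trans (≤of≡ 3 w₁≡) (≤-reflexive (cong (3 *_) w₂≡1)))))))
        conclude″ (inj₂ (p , pr , p∣w₂)) = p , pr , ∣-trans p∣w₁ (∣of≡ 2 w≡) ,
          (λ { refl → 2∤w₁ p∣w₁ }) , (λ { refl → 3∤w₂ p∣w₂ })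
          where
          p∣w₁ = ∣-trans p∣w₂ (∣of≡ 3 w₁≡)

  V-three : ∀ z → V z 3 ≡ (z + 2) * ψ₁₂ z
  V-three z = identity z
    where
    identity : ∀ z → 2 + (0 + z * 1 + z * (1 + (2 + (0 + z * 1))) + z * (1 + (2 + (0 + z * 1)) +
        (2 + (0 + z * 1 + z * (1 + (2 + (0 + z * 1))))))) ≡ (z + 2) * (1 + z * (4 + z))
    identity = solve-∀

  -- With w = t² - 3, both δ₆ + 4 = V₃² and δ₄ + 3 = w (w + 2) are multiples of w. A prime p > 3
  -- dividing w therefore divides δ₁₂ = δ₆ (δ₆ + 4) but neither δ₆ nor δ₄, whose indices are the
  -- maximal proper divisors of 12.
  primitive₁₂ : ∀ z → 2 ≤ z → ∃ (Primitive z 12)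
  primitive₁₂ z 2≤z = from (bigPrime∣ψ₁₂ z 2≤z)
    where
    w = ψ₁₂ z
    δ₆ : δ z 6 + 4 ≡ (z + 2) * w * ((z + 2) * w)
    δ₆ = trans (shift (δ z 6)) (trans (V-product z 3 0) (cong (λ v → v * v) (V-three z)))
      where
      shift : ∀ d → d + 4 ≡ 2 + d + 2
      shift = solve-∀
    δ₄ : δ z 4 + 3 ≡ w * (2 + w)
    δ₄ = trans (cong (_+ 3) (trans (δ-compose z 2 2) (trans (cong (λ d → δ d 2) (δ-two z)) (δ-two (z * (4 + z))))))
        (identity (z * (4 + z)))
      where
      identity : ∀ d → d * (4 + d) + 3 ≡ (1 + d) * (3 + d)
      identity = solve-∀
    δ₁₂ : δ z 12 ≡ δ z 6 * (δ z 6 + 4)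
    δ₁₂ = trans (δ-compose z 6 2) (trans (δ-two (δ z 6)) (cong (δ z 6 *_) (+-comm 4 (δ z 6))))
    from : (∃[ p ] Prime p × p ∣ w × p ≢ 2 × p ≢ 3) → ∃ (Primitive z 12)
    from (p , pr , p∣w , p≢2 , p≢3) = p , [ (λ prim → prim) , (λ d → ⊥-elim (impossible d)) ]′ (primitive⊎descends z
        {12} {p} (s≤s z≤n) pr p∣δ₁₂)
      where
      p∣δ₆+4 : p ∣ δ z 6 + 4
      p∣δ₆+4 = subst (p ∣_) (sym δ₆) (∣n⇒∣m*n ((z + 2) * w) (∣n⇒∣m*n (z + 2) p∣w))
      p∣δ₁₂ : p ∣ δ z 12
      p∣δ₁₂ = subst (p ∣_) (sym δ₁₂) (∣n⇒∣m*n (δ z 6) p∣δ₆+4)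
      p∤2 : ¬ p ∣ 2
      p∤2 = p≢2 ∘ prime∣prime⇒≡ pr prime[2]
      p∤3 : ¬ p ∣ 3
      p∤3 = p≢3 ∘ prime∣prime⇒≡ pr prime[3]
      p∤δ₆ : ¬ p ∣ δ z 6
      p∤δ₆ p∣δ₆ = [ p∤2 , p∤2 ]′ (euclidsLemma 2 2 pr (∣m+n∣m⇒∣n p∣δ₆+4 p∣δ₆))
      p∤δ₄ : ¬ p ∣ δ z 4
      p∤δ₄ p∣δ₄ = p∤3 (∣m+n∣m⇒∣n (subst (p ∣_) (sym δ₄) (∣m⇒∣m*n (2 + w) p∣w)) p∣δ₄)
      impossible : ¬ (∃[ q ] ∃[ m ] Prime q × 12 ≡ q * m × p ∣ δ z m)
      impossible (q , m , pr-q , 12≡ , p∣δm) = [ q∣4⇒⊥ , q∣3⇒⊥ ]′ (euclidsLemma 4 3 pr-q (subst (q ∣_) (sym 12≡)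
          (m∣m*n m)))
        where
        at : ∀ c i → q ≡ c → .{{_ : NonZero c}} → 12 ≡ c * i → p ∣ δ z i
        at c i refl 12≡ci = subst (λ i → p ∣ δ z i) (*-cancelˡ-≡ m i c (trans (sym 12≡) 12≡ci)) p∣δm
        q∣2⇒⊥ : q ∣ 2 → ⊥
        q∣2⇒⊥ q∣2 = p∤δ₆ (at 2 6 (prime∣prime⇒≡ pr-q prime[2] q∣2) refl)
        q∣4⇒⊥ : q ∣ 4 → ⊥
        q∣4⇒⊥ q∣4 = [ q∣2⇒⊥ , q∣2⇒⊥ ]′ (euclidsLemma 2 2 pr-q q∣4)
        q∣3⇒⊥ : q ∣ 3 → ⊥
        q∣3⇒⊥ q∣3 = p∤δ₄ (at 3 4 (prime∣prime⇒≡ pr-q prime[3] q∣3) refl)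

  noPrimitive⇒≤6 : ∀ z .{{_ : NonZero z}} n → n ≢ 12 → (z ≡ 1 → n ≢ 10) → NoPrimitive (Δ z) n → n ≤ 6
  noPrimitive⇒≤6 z n n≢12 ¬z≡1×n≡10 (1≤n , none) = ≮⇒≥ λ 7≤n → someTermHasPrimitive z n 7≤n n≢12 ¬z≡1×n≡10
    λ pr p∣δ → [ (λ prim → ⊥-elim (none (_ , primitive⇒ prim))) , (λ d → d) ]′ (primitive⊎descends z 1≤n pr p∣δ)

  noPrimitive⇒≤6′ : ∀ z → 2 ≤ z → ∀ n → NoPrimitive (Δ z) n → n ≤ 6
  noPrimitive⇒≤6′ (suc z) 2≤z n np with n ≟ 12
  ... | yes refl = ⊥-elim (proj₂ np (_ , primitive⇒ (proj₂ (primitive₁₂ (suc z) 2≤z))))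
  ... | no n≢12  = noPrimitive⇒≤6 (suc z) n n≢12 (λ { refl → ⊥-elim (from-no (2 ≤? 1) 2≤z) }) np

  -- A downward search from the bound finds the maximum, since having no primitive prime divisor is
  -- decidable.
  Z-exists : ∀ z .{{_ : NonZero z}} b → (∀ n → NoPrimitive (Δ z) n → n ≤ b) → Z[ Δ z ]≤ b
  Z-exists z zero    ≤b = 0 , (≤b , inj₁ refl) , z≤n
  Z-exists z (suc b) ≤b = decide (noPrimitive? z (suc b))
    where
    decide : Dec (NoPrimitive (Δ z) (suc b)) → Z[ Δ z ]≤ (suc b)
    decide (yes np) = suc b , (≤b , inj₂ np) , ≤-refl
    decide (no ¬np) = weaken (Z-exists z b λ n np → ≤-pred (≤∧≢⇒< (≤b n np) λ { refl → ¬np np }))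
      where
      weaken : Z[ Δ z ]≤ b → Z[ Δ z ]≤ (suc b)
      weaken (y , Z≡ , y≤b) = y , Z≡ , m≤n⇒m≤1+n y≤b

  Z≤6 : ∀ z → 2 ≤ z → Z[ Δ z ]≤ 6
  Z≤6 z@(suc _) 2≤z = Z-exists z 6 (noPrimitive⇒≤6′ z 2≤z)

  prime∣^ : ∀ {p} → Prime p → ∀ x k → p ∣ x ^ k → p ∣ x
  prime∣^ pr x zero    p∣1 = ⊥-elim (prime∤1 pr p∣1)
  prime∣^ pr x (suc k) p∣ = [ (λ h → h) , prime∣^ pr x k ]′ (euclidsLemma x (x ^ k) pr p∣)

  -- Every prime divisor of δₙ divides δ_a or δ_b. One divisibility between explicit numbers thus
  -- certifies an exceptional index; in the applications a and b run through n / q for the primes q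
  -- ∣ n.
  ¬primitive : ∀ z {n} a b k → 1 ≤ a → 1 ≤ b → a < n → b < n → δ z n ∣ (δ z a * δ z b) ^ k → ¬ ∃ (Primitive z n)
  ¬primitive z a b k 1≤a 1≤b a<n b<n δ∣ (p , pr , p∣δ , new) =
    [ new a<n 1≤a , new b<n 1≤b ]′ (euclidsLemma (δ z a) (δ z b) pr (prime∣^ pr _ k (∣-trans p∣δ δ∣)))

-- The traces 3, 4, 5 and 6 by evaluation

module ExceptionalTraces where

  open import Data.Empty using (⊥-elim)
  open import Data.List using ([]; _∷_)
  open import Data.List.Membership.Propositional using (_∈_)
  open import Data.List.Relation.Unary.Any using (here; there)
  open import Data.Nat using (suc; _*_; _^_; _≤_; _≤?_; _<?_; _≟_; z≤n; s≤s; NonZero)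
  open import Data.Nat.Divisibility
  open import Data.Nat.Properties hiding (_≤?_; _<?_; _≟_)
  open import Data.Product using (_,_; proj₁; proj₂)
  open import Data.Sum using (inj₂)
  open import Defs using (NoPrimitive; Z[_]≡_; NoPrimitiveExactlyAt)
  open import Function using (mk⇔)
  open import Relation.Binary.PropositionalEquality using (_≡_; refl)
  open import Relation.Nullary using (yes; no; Dec)
  open import Relation.Nullary.Decidable using (from-yes; True; toWitness)
  open LucasSequence
  open PrimeFactors
  open PrimitiveDivisors

  noPrimitive : ∀ z .{{_ : NonZero z}} n a b k {_ : True (1 ≤? n)} {_ : True (1 ≤? a)} {_ : True (1 ≤? b)}
      {_ : True (a <? n)} {_ : True (b <? n)} →
                True (δ z n ∣? (δ z a * δ z b) ^ k) → NoPrimitive (Δ z) n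
  noPrimitive z n a b k {1≤n} {1≤a} {1≤b} {a<n} {b<n} δ∣ = toWitness 1≤n , λ (p , prim) →
    ¬primitive z a b k (toWitness 1≤a) (toWitness 1≤b) (toWitness a<n) (toWitness b<n) (toWitness δ∣) (p , primitive⇐
        prim)

  excluded : ∀ {A : Set} z n p {_ : True (primitive? z n p)} → NoPrimitive (Δ z) n → A
  excluded z n p {prim} (_ , none) = ⊥-elim (none (p , primitive⇒ (toWitness prim)))

  noPrimitive₁ : NoPrimitiveExactlyAt (Δ 1) (1 ∷ 6 ∷ 10 ∷ 12 ∷ [])
  noPrimitive₁ n = mk⇔ (λ np → exceptions np (n ≟ 10) (n ≟ 12)) λ
    { (here refl) → s≤s z≤n , λ (p , prim) → prime∤1 (proj₁ prim) (proj₁ (proj₂ (primitive⇐ prim)))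
    ; (there (here refl)) → noPrimitive 1 6 2 3 2 _
    ; (there (there (here refl))) → noPrimitive 1 10 2 5 3 _
    ; (there (there (there (here refl)))) → noPrimitive 1 12 4 6 2 _ }
    where
    small : ∀ n → n ≤ 6 → NoPrimitive (Δ 1) n → n ∈ 1 ∷ 6 ∷ 10 ∷ 12 ∷ []
    small 0 _ (() , _)
    small 1 _ np = here refl
    small 2 _ np = excluded 1 2 5 np
    small 3 _ np = excluded 1 3 2 np
    small 4 _ np = excluded 1 4 3 np
    small 5 _ np = excluded 1 5 11 np
    small 6 _ np = there (here refl)
    small (suc (suc (suc (suc (suc (suc (suc n))))))) (s≤s (s≤s (s≤s (s≤s (s≤s (s≤s ())))))) np
    exceptions : NoPrimitive (Δ 1) n → Dec (n ≡ 10) → Dec (n ≡ 12) → n ∈ 1 ∷ 6 ∷ 10 ∷ 12 ∷ []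
    exceptions np (yes n≡10) _ = there (there (here n≡10))
    exceptions np (no _) (yes n≡12) = there (there (there (here n≡12)))
    exceptions np (no n≢10) (no n≢12) = small n (noPrimitive⇒≤6 1 n n≢12 (λ _ → n≢10) np) np

  noPrimitive₂ : NoPrimitiveExactlyAt (Δ 2) (4 ∷ 6 ∷ [])
  noPrimitive₂ n = mk⇔ (λ np → small n (noPrimitive⇒≤6′ 2 ≤-refl n np) np) λ
    { (here refl) → noPrimitive 2 4 2 2 2 _
    ; (there (here refl)) → noPrimitive 2 6 2 3 3 _ }
    where
    small : ∀ n → n ≤ 6 → NoPrimitive (Δ 2) n → n ∈ 4 ∷ 6 ∷ []
    small 0 _ (() , _)
    small 1 _ np = excluded 2 1 2 np
    small 2 _ np = excluded 2 2 3 np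
    small 3 _ np = excluded 2 3 5 np
    small 4 _ np = here refl
    small 5 _ np = excluded 2 5 19 np
    small 6 _ np = there (here refl)
    small (suc (suc (suc (suc (suc (suc (suc n))))))) (s≤s (s≤s (s≤s (s≤s (s≤s (s≤s ())))))) np

  noPrimitive₃ : NoPrimitiveExactlyAt (Δ 3) (6 ∷ [])
  noPrimitive₃ n = mk⇔ (λ np → small n (noPrimitive⇒≤6′ 3 (s≤s (s≤s z≤n)) n np) np) λ
    { (here refl) → noPrimitive 3 6 2 3 3 _ }
    where
    small : ∀ n → n ≤ 6 → NoPrimitive (Δ 3) n → n ∈ 6 ∷ []
    small 0 _ (() , _)
    small 1 _ np = excluded 3 1 3 np
    small 2 _ np = excluded 3 2 7 np
    small 3 _ np = excluded 3 3 2 np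
    small 4 _ np = excluded 3 4 5 np
    small 5 _ np = excluded 3 5 29 np
    small 6 _ np = here refl
    small (suc (suc (suc (suc (suc (suc (suc n))))))) (s≤s (s≤s (s≤s (s≤s (s≤s (s≤s ())))))) np

  noPrimitive₄⇒≤2 : ∀ n → NoPrimitive (Δ 4) n → n ≤ 2
  noPrimitive₄⇒≤2 n np = small n (noPrimitive⇒≤6′ 4 (s≤s (s≤s z≤n)) n np) np
    where
    small : ∀ n → n ≤ 6 → NoPrimitive (Δ 4) n → n ≤ 2
    small 0 _ _ = z≤n
    small 1 _ _ = s≤s z≤n
    small 2 _ _ = ≤-refl
    small 3 _ np = excluded 4 3 7 np
    small 4 _ np = excluded 4 4 3 np
    small 5 _ np = excluded 4 5 41 np
    small 6 _ np = excluded 4 6 5 np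
    small (suc (suc (suc (suc (suc (suc (suc n))))))) (s≤s (s≤s (s≤s (s≤s (s≤s (s≤s ())))))) np

  exactly⇒Z : ∀ {a z ns} → NoPrimitiveExactlyAt a ns → z ∈ ns → (∀ {n} → n ∈ ns → n ≤ z) → Z[ a ]≡ z
  exactly⇒Z exact z∈ns ns≤z = (λ n np → ns≤z (Function.Equivalence.to (exact n) np)) , inj₂
      (Function.Equivalence.from (exact _) z∈ns)

  Z₁ : Z[ Δ 1 ]≡ 12
  Z₁ = exactly⇒Z noPrimitive₁ (there (there (there (here refl)))) λ
    { (here refl) → from-yes (1 ≤? 12) ; (there (here refl)) → from-yes (6 ≤? 12)
    ; (there (there (here refl))) → from-yes (10 ≤? 12) ; (there (there (there (here refl)))) → ≤-refl }

  Z₂ : Z[ Δ 2 ]≡ 6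
  Z₂ = exactly⇒Z noPrimitive₂ (there (here refl)) λ { (here refl) → from-yes (4 ≤? 6) ; (there (here refl)) → ≤-refl }

  Z₃ : Z[ Δ 3 ]≡ 6
  Z₃ = exactly⇒Z noPrimitive₃ (here refl) λ { (here refl) → ≤-refl }

  Z₄ : Z[ Δ 4 ]≡ 2
  Z₄ = noPrimitive₄⇒≤2 , inj₂ (noPrimitive 4 2 1 1 3 _)

-- Ring identities over ℚ

module RationalSolver where

  open import Data.Rational using (0ℚ)
  open import Data.Rational.Properties using (+-*-commutativeRing; _≟_)
  open import Level using (0ℓ)
  open import Relation.Nullary.Decidable using (dec⇒maybe)
  open import Tactic.RingSolver.Core.AlmostCommutativeRing using (AlmostCommutativeRing; fromCommutativeRing)

  ℚ-ring : AlmostCommutativeRing 0ℓ 0ℓ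
  ℚ-ring = fromCommutativeRing +-*-commutativeRing λ x → dec⇒maybe (0ℚ ≟ x)

-- Integers inside ℚ and bounded denominators

module IntegralTraces where

  open import Data.Empty using (⊥-elim)
  open import Data.Integer as ℤ using (ℤ; +_; 0ℤ)
  import Data.Integer.Properties as ℤ
  open import Data.List using (List; []; _∷_; length)
  open import Data.Nat as ℕ using (ℕ; zero; suc; z≤n; s≤s; NonZero)
  open import Data.Nat.Coprimality as Coprime using (Coprime; 1-coprimeTo)
  open import Data.Nat.Divisibility as ℕ using (divides)
  import Data.Nat.Properties as ℕ
  open import Data.Product using (∃-syntax; _×_; _,_; proj₁; proj₂)
  open import Data.Rational as ℚ using (ℚ; mkℚ; 0ℚ; _/_; ↥_; ↧_; ↧ₙ_)
  import Data.Rational.Properties as ℚ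
  import Data.Rational.Unnormalised as ℚᵘ
  import Data.Rational.Unnormalised.Properties as ℚᵘ
  open import Data.Sum using ([_,_]′)
  open import Defs as K using (ℚ[√_]; _⊕_√d)
  open import Relation.Binary.PropositionalEquality using (_≡_; _≢_; refl; sym; trans; cong; cong₂; subst; module ≡-Reasoning)
  open import Tactic.RingSolver using (solve-∀)
  open RationalSolver

  ι : ℤ → ℚ
  ι i = i / 1

  -- The reduced form of i / 1. Operations of ℚ compute on it, whereas `/` is blocked by a gcd when
  -- i is a variable.
  mkι : ℤ → ℚ
  mkι i = mkℚ i 0 (Coprime.sym (1-coprimeTo ℤ.∣ i ∣))

  ι≡mkι : ∀ i → ι i ≡ mkι i
  ι≡mkι i = ℚ.↥p/↧p≡p (mkι i)

  ι-+ : ∀ i j → ι (i ℤ.+ j) ≡ ι i ℚ.+ ι j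
  ι-+ i j = trans (cong ι (sym (cong₂ ℤ._+_ (ℤ.*-identityʳ i) (ℤ.*-identityʳ j)))) (sym (cong₂ ℚ._+_ (ι≡mkι i)
      (ι≡mkι j)))

  ι-* : ∀ i j → ι (i ℤ.* j) ≡ ι i ℚ.* ι j
  ι-* i j = sym (cong₂ ℚ._*_ (ι≡mkι i) (ι≡mkι j))

  ι-neg : ∀ i → ι (ℤ.- i) ≡ ℚ.- ι i
  ι-neg i = begin
    ι (ℤ.- i) ≡⟨ shift (ι (ℤ.- i)) (ι i) ⟩
    (ι (ℤ.- i) ℚ.+ ι i) ℚ.+ (ℚ.- ι i) ≡⟨ cong (ℚ._+ (ℚ.- ι i)) (ι-+ (ℤ.- i) i) ⟨
    ι (ℤ.- i ℤ.+ i) ℚ.+ (ℚ.- ι i) ≡⟨ cong (λ k → ι k ℚ.+ (ℚ.- ι i)) (ℤ.+-inverseˡ i) ⟩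
    0ℚ ℚ.+ (ℚ.- ι i) ≡⟨ ℚ.+-identityˡ _ ⟩
    ℚ.- ι i ∎
    where
    open ≡-Reasoning
    shift : ∀ x y → x ≡ (x ℚ.+ y) ℚ.+ (ℚ.- y)
    shift = solve-∀ ℚ-ring

  mkι-injective : ∀ {i j} → mkι i ≡ mkι j → i ≡ j
  mkι-injective refl = refl

  ι-injective : ∀ {i j} → ι i ≡ ι j → i ≡ j
  ι-injective {i} {j} eq = mkι-injective (trans (sym (ι≡mkι i)) (trans eq (ι≡mkι j)))

  x*↧x : ∀ x → x ℚ.* ι (↧ x) ≡ ι (↥ x)
  x*↧x x@(mkℚ n d-1 _) = trans (cong (x ℚ.*_) (ι≡mkι (↧ x))) (trans (ℚ.toℚᵘ-injective (ℚᵘ.≃-trans (ℚ.toℚᵘ-homo-* x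
      (mkι (↧ x))) equal)) (sym (ι≡mkι (↥ x))))
    where
    equal : ℚ.toℚᵘ x ℚᵘ.* ℚ.toℚᵘ (mkι (↧ x)) ℚᵘ.≃ ℚ.toℚᵘ (mkι (↥ x))
    equal = ℚᵘ.*≡* (trans (ℤ.*-identityʳ _) (cong (λ d → n ℤ.* + d) (sym (ℕ.*-identityʳ (suc d-1)))))

  ↥-↧-coprime : ∀ x → Coprime ℤ.∣ ↥ x ∣ (↧ₙ x)
  ↥-↧-coprime (mkℚ n d-1 coprime) = Coprime.recompute coprime

  IsInt : ℚ → Set
  IsInt x = ∃[ i ] x ≡ ι i

  int-+ : ∀ {x y} → IsInt x → IsInt y → IsInt (x ℚ.+ y)
  int-+ (i , refl) (j , refl) = i ℤ.+ j , sym (ι-+ i j)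

  int-neg : ∀ {x} → IsInt x → IsInt (ℚ.- x)
  int-neg (i , refl) = ℤ.- i , sym (ι-neg i)

  int-* : ∀ {x} i → IsInt x → IsInt (ι i ℚ.* x)
  int-* i (j , refl) = i ℤ.* j , sym (ι-* i j)

  int-cancel : ∀ {x y} → IsInt (x ℚ.+ y) → IsInt y → IsInt x
  int-cancel {x} {y} sum int-y = subst IsInt (identity x y) (int-+ sum (int-neg int-y))
    where
    identity : ∀ x y → (x ℚ.+ y) ℚ.+ (ℚ.- y) ≡ x
    identity = solve-∀ ℚ-ring

  trace : ∀ {d} → ℚ[√ d ] → ℚ
  trace (a ⊕ _ √d) = a ℚ.+ a

  module _ (W : ℕ → ℚ) where

    -- The trace of uʲ f(u), for f = evalMonic cs and W n the trace of uⁿ.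
    relation : List ℤ → ℕ → ℚ
    relation []       j = W j
    relation (c ∷ cs) j = ι c ℚ.* W j ℚ.+ relation cs (suc j)

    -- The polynomial is monic, so the relation expresses its last trace through the earlier ones
    -- with integer coefficients.
    lastInt : ∀ N cs j → (∀ i → i ℕ.< length cs → IsInt (N ℚ.* W (i ℕ.+ j))) → IsInt (N ℚ.* relation cs j) → IsInt
        (N ℚ.* W (length cs ℕ.+ j))
    lastInt N []       j _    int = int
    lastInt N (c ∷ cs) j init int = subst (λ i → IsInt (N ℚ.* W i)) (ℕ.+-suc (length cs) j)
      (lastInt N cs (suc j) (λ i i<m → subst (λ k → IsInt (N ℚ.* W k)) (sym (ℕ.+-suc i j)) (init (suc i) (s≤s i<m)))
        (int-cancel {y = ι c ℚ.* (N ℚ.* W j)} (subst IsInt (identity N (ι c) (W j) (relation cs (suc j))) int)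
            (int-* c (init 0 (s≤s z≤n)))))
      where
      identity : ∀ N c w r → N ℚ.* (c ℚ.* w ℚ.+ r) ≡ N ℚ.* r ℚ.+ c ℚ.* (N ℚ.* w)
      identity = solve-∀ ℚ-ring

    allInt : ∀ N cs → (∀ j → relation cs j ≡ 0ℚ) → (∀ i → i ℕ.< length cs → IsInt (N ℚ.* W i)) → ∀ j → IsInt
        (N ℚ.* W j)
    allInt N cs zeros init j = [ init j , (λ m≤j → subst (λ k → IsInt (N ℚ.* W k)) (ℕ.m+[n∸m]≡n m≤j)
        (last (j ℕ.∸ length cs) (windows (j ℕ.∸ length cs)))) ]′ (ℕ.<-≤-connex j (length cs))
      where
      Window : ℕ → Set
      Window j = ∀ i → i ℕ.< length cs → IsInt (N ℚ.* W (i ℕ.+ j))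
      last : ∀ j → Window j → IsInt (N ℚ.* W (length cs ℕ.+ j))
      last j win = lastInt N cs j win (0ℤ , trans (cong (N ℚ.*_) (zeros j)) (ℚ.*-zeroʳ N))
      windows : ∀ j → Window j
      windows zero i i<m = subst (λ k → IsInt (N ℚ.* W k)) (sym (ℕ.+-identityʳ i)) (init i i<m)
      windows (suc j) i i<m = subst (λ k → IsInt (N ℚ.* W k)) (sym (ℕ.+-suc i j))
        ([ windows j (suc i) , (λ 1+i≡m → subst (λ m → IsInt (N ℚ.* W (m ℕ.+ j))) (sym 1+i≡m) (last j (windows j)))
            ]′ (ℕ.m≤n⇒m<n∨m≡n i<m))

    commonDenominator : ∀ m → ∃[ N ] (N ≢ 0) × (∀ i → i ℕ.< m → IsInt (ι (+ N) ℚ.* W i))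
    commonDenominator zero = 1 , (λ ()) , λ _ ()
    commonDenominator (suc m) with commonDenominator m
    ... | N , N≢0 , ints = N ℕ.* ↧ₙ (W m) , nonzero , ints′
      where
      q = ↧ₙ (W m)
      nonzero : N ℕ.* q ≢ 0
      nonzero eq = [ N≢0 , (λ ()) ]′ (ℕ.m*n≡0⇒m≡0∨n≡0 N eq)
      split : ∀ x → ι (+ (N ℕ.* q)) ℚ.* x ≡ ι (+ q) ℚ.* (ι (+ N) ℚ.* x)
      split x = trans (cong (λ k → ι k ℚ.* x) (ℤ.pos-* N q)) (trans (cong (ℚ._* x) (ι-* (+ N) (+ q)))
          (identity (ι (+ N)) (ι (+ q)) x))
        where
        identity : ∀ n q x → n ℚ.* q ℚ.* x ≡ q ℚ.* (n ℚ.* x)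
        identity = solve-∀ ℚ-ring
      ints′ : ∀ i → i ℕ.< suc m → IsInt (ι (+ (N ℕ.* q)) ℚ.* W i)
      ints′ i (s≤s i≤m) = [ (λ i<m → subst IsInt (sym (split (W i))) (int-* (+ q) (ints i i<m)))
                          , (λ { refl → subst IsInt (identity (W m)) (int-* (+ N) (↥ (W m) , x*↧x (W m))) }) ]′
                              (ℕ.m≤n⇒m<n∨m≡n i≤m)
        where
        identity : ∀ x → ι (+ N) ℚ.* (x ℚ.* ι (+ q)) ≡ ι (+ (N ℕ.* q)) ℚ.* x
        identity x = trans (shuffle (ι (+ N)) x (ι (+ q))) (sym (split x))
          where
          shuffle : ∀ n x q → n ℚ.* (x ℚ.* q) ≡ q ℚ.* (n ℚ.* x)
          shuffle = solve-∀ ℚ-ring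

  -- q divides `k j` · p and is prime to p, so it divides every `k j`; the quotients satisfy the
  -- same recurrence, and the argument repeats.
  ^∣geometric : ∀ {p q} .{{_ : NonZero q}} → Coprime q p → ∀ i (k : ℕ → ℕ) → (∀ j → k (suc j) ℕ.* q ≡ k j ℕ.* p) → q
      ℕ.^ i ℕ.∣ k 0
  ^∣geometric _ zero k _ = ℕ.1∣ k 0
  ^∣geometric {p} {q} cop (suc i) k rec = subst (q ℕ.^ suc i ℕ.∣_) (trans (ℕ.*-comm q (k′ 0)) (sym (k≡ 0)))
    (ℕ.*-monoʳ-∣ q (^∣geometric cop i k′ λ j → ℕ.*-cancelʳ-≡ _ _ q (begin
      k′ (suc j) ℕ.* q ℕ.* q ≡⟨ cong (ℕ._* q) (k≡ (suc j)) ⟨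
      k (suc j) ℕ.* q ≡⟨ rec j ⟩
      k j ℕ.* p ≡⟨ cong (ℕ._* p) (k≡ j) ⟩
      k′ j ℕ.* q ℕ.* p ≡⟨ ℕ.*-assoc (k′ j) q p ⟩
      k′ j ℕ.* (q ℕ.* p) ≡⟨ cong (k′ j ℕ.*_) (ℕ.*-comm q p) ⟩
      k′ j ℕ.* (p ℕ.* q) ≡⟨ ℕ.*-assoc (k′ j) p q ⟨
      k′ j ℕ.* p ℕ.* q ∎)))
    where
    open ≡-Reasoning
    q∣k : ∀ j → q ℕ.∣ k j
    q∣k j = Coprime.coprime-divisor cop (divides (k (suc j)) (trans (ℕ.*-comm p (k j)) (sym (rec j))))
    k′ : ℕ → ℕ
    k′ j = ℕ.quotient (q∣k j)
    k≡ : ∀ j → k j ≡ k′ j ℕ.* q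
    k≡ j = ℕ._∣_.equality (q∣k j)

  n<2^n : ∀ n → n ℕ.< 2 ℕ.^ n
  n<2^n zero    = s≤s z≤n
  n<2^n (suc n) = ℕ.≤-trans (ℕ.+-mono-≤ (ℕ.m^n>0 2 n) (n<2^n n)) (ℕ.≤-reflexive (cong (2 ℕ.^ n ℕ.+_)
      (sym (ℕ.+-identityʳ _))))

  -- The denominator q of T has qⁱ ∣ x 0 for every i.
  powersInt⇒int : ∀ T N → N ≢ 0ℚ → (x : ℕ → ℚ) → x 0 ≡ N → (∀ i → x (suc i) ≡ x i ℚ.* T) → (∀ i → IsInt (x i)) →
      IsInt T
  powersInt⇒int T N N≢0 x x₀ rec ints = byDenominator (↧ₙ T) refl
    where
    k : ℕ → ℕ
    k i = ℤ.∣ proj₁ (ints i) ∣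
    recℤ : ∀ j → proj₁ (ints (suc j)) ℤ.* ↧ T ≡ proj₁ (ints j) ℤ.* ↥ T
    recℤ j = ι-injective (begin
      ι (k′ (suc j) ℤ.* ↧ T) ≡⟨ ι-* (k′ (suc j)) (↧ T) ⟩
      ι (k′ (suc j)) ℚ.* ι (↧ T) ≡⟨ cong (ℚ._* ι (↧ T)) (proj₂ (ints (suc j))) ⟨
      x (suc j) ℚ.* ι (↧ T) ≡⟨ cong (ℚ._* ι (↧ T)) (rec j) ⟩
      x j ℚ.* T ℚ.* ι (↧ T) ≡⟨ ℚ.*-assoc (x j) T (ι (↧ T)) ⟩
      x j ℚ.* (T ℚ.* ι (↧ T)) ≡⟨ cong₂ ℚ._*_ (proj₂ (ints j)) (x*↧x T) ⟩
      ι (k′ j) ℚ.* ι (↥ T) ≡⟨ ι-* (k′ j) (↥ T) ⟨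
      ι (k′ j ℤ.* ↥ T) ∎)
      where
      open ≡-Reasoning
      k′ : ℕ → ℤ
      k′ j = proj₁ (ints j)
    k₀≢0 : k 0 ≢ 0
    k₀≢0 eq = N≢0 (trans (sym x₀) (trans (proj₂ (ints 0)) (cong ι (ℤ.∣i∣≡0⇒i≡0 {proj₁ (ints 0)} eq))))
    q^i∣k₀ : ∀ i → ↧ₙ T ℕ.^ i ℕ.∣ k 0
    q^i∣k₀ i = ^∣geometric {ℤ.∣ ↥ T ∣} {↧ₙ T} (Coprime.sym (↥-↧-coprime T)) i k
      (λ j → trans (sym (ℤ.abs-* (proj₁ (ints (suc j))) (↧ T))) (trans (cong ℤ.∣_∣ (recℤ j))
          (ℤ.abs-* (proj₁ (ints j)) (↥ T))))
    byDenominator : ∀ q → ↧ₙ T ≡ q → IsInt T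
    byDenominator zero ()
    byDenominator 1 eq = ↥ T , trans (sym (ℚ.*-identityʳ T)) (trans (cong (λ q → T ℚ.* ι (+ q)) (sym eq)) (x*↧x T))
    -- The exponent `k 0` suffices: a base of at least 2 gives a power that exceeds `k 0`, which it
    -- should divide.
    byDenominator (suc (suc q)) eq = ⊥-elim (ℕ.<⇒≱ (n<2^n (k 0)) (ℕ.≤-trans (ℕ.^-monoˡ-≤ (k 0) (s≤s (s≤s z≤n)))
      (ℕ.∣⇒≤ {{ℕ.≢-nonZero k₀≢0}} (subst (λ q → q ℕ.^ k 0 ℕ.∣ k 0) eq (q^i∣k₀ (k 0))))))

-- The traces of uⁿ and their relation to δ

module TraceSequence where

  open import Data.Integer as ℤ using (ℤ; +_; 0ℤ)
  import Data.Integer.Properties as ℤ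
  open import Data.List using ([]; _∷_; length)
  open import Data.Nat as ℕ using (ℕ; zero; suc)
  import Data.Nat.Properties as ℕ
  open import Data.Product using (∃-syntax; _×_; _,_; proj₁; proj₂)
  open import Data.Rational as ℚ using (ℚ; 0ℚ; 1ℚ; _/_; _+_; _*_; -_; _-_)
  import Data.Rational.Properties as ℚ
  open import Data.Sum using ([_,_]′)
  open import Defs as K using (ℚ[√_]; _⊕_√d; evalMonic; Integral; norm; 0#; 1#; _^_)
  open import Relation.Binary.PropositionalEquality using (_≡_; _≢_; refl; sym; trans; cong; cong₂; subst; module ≡-Reasoning)
  open import Tactic.RingSolver using (solve-∀)
  open LucasSequence using (δ; V; V-rec)
  open PrimitiveDivisors using (Δ)
  open IntegralTraces
  open RationalSolver

  module _ {d : ℕ} (a b : ℚ) (norm≡1 : norm {d} (a ⊕ b √d) ≡ 1ℚ) where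

    private
      D : ℚ
      D = + d / 1
      u : ℚ[√ d ]
      u = a ⊕ b √d
      P Q W : ℕ → ℚ
      P j = ℚ[√_].rat (u ^ j)
      Q j = ℚ[√_].irr (u ^ j)
      W j = trace (u ^ j)

    trace-rec : ∀ j → W (2 ℕ.+ j) + W j ≡ (a + a) * W (1 ℕ.+ j)
    trace-rec j = begin
      W (2 ℕ.+ j) + (P j + P j) ≡⟨ cong (λ x → W (2 ℕ.+ j) + (x + x)) (trans (cong (_* P j) norm≡1) (ℚ.*-identityˡ
          (P j))) ⟨
      W (2 ℕ.+ j) + ((a * a - D * (b * b)) * P j + (a * a - D * (b * b)) * P j) ≡⟨ identity D a b (P j) (Q j) ⟩
      (a + a) * W (1 ℕ.+ j) ∎
      where
      open ≡-Reasoning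
      identity : ∀ D a b p q → let p′ = a * p + D * (b * q) ; q′ = a * q + b * p ; p″ = a * p′ + D * (b * q′) ; n = a * a - D * (b * b) in
        (p″ + p″) + (n * p + n * p) ≡ (a + a) * (p′ + p′)
      identity = solve-∀ ℚ-ring

    relation-trace : ∀ cs j → relation W cs j ≡ trace (evalMonic cs u K.* u ^ j)
    relation-trace [] j = identity D (P j) (Q j)
      where
      identity : ∀ D p q → p + p ≡ (1ℚ * p + D * (0ℚ * q)) + (1ℚ * p + D * (0ℚ * q))
      identity = solve-∀ ℚ-ring
    relation-trace (c ∷ cs) j = trans (cong (λ r → ι c * W j + r) (relation-trace cs (suc j)))
      (identity D a b (ℚ[√_].rat (evalMonic cs u)) (ℚ[√_].irr (evalMonic cs u)) (P j) (Q j) (ι c))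
      where
      identity : ∀ D a b p q P Q c →
        let l = p * (a * P + D * (b * Q)) + D * (q * (a * Q + b * P)) ; r = (c + (a * p + D * (b * q))) * P + D * ((0ℚ + (a * q + b * p)) * Q) in
        c * (P + P) + (l + l) ≡ r + r
      identity = solve-∀ ℚ-ring

    relation-zero : ∀ cs → evalMonic cs u ≡ 0# → ∀ j → relation W cs j ≡ 0ℚ
    relation-zero cs root j = trans (relation-trace cs j) (trans (cong (λ e → trace (e K.* u ^ j)) root) (identity D
        (P j) (Q j)))
      where
      identity : ∀ D p q → (0ℚ * p + D * (0ℚ * q)) + (0ℚ * p + D * (0ℚ * q)) ≡ 0ℚ
      identity = solve-∀ ℚ-ring

    -- The monic equation gives all traces W j a common denominator N. By T · W_{j+1} = W_{j+2} +
    -- W_j with T = 2a, the same N clears all Tⁱ W j. So the powers of T have bounded denominators,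
    -- which makes T an integer.
    integral⇒traceInt : Integral u → IsInt (a + a)
    integral⇒traceInt (cs , root) = powersInt⇒int (a + a) (x 0 * W 0) nonzero (λ i → x i * W 0) refl (λ i → move
        (x i) (a + a) (W 0)) (λ i → good i 0)
      where
      common : ∃[ N ] (N ≢ 0) × (∀ i → i ℕ.< length cs → IsInt (ι (+ N) * W i))
      common = commonDenominator W (length cs)
      N : ℕ
      N = proj₁ common
      x : ℕ → ℚ
      x zero    = ι (+ N)
      x (suc i) = x i * (a + a)
      move : ∀ x t w → x * t * w ≡ x * w * t
      move = solve-∀ ℚ-ring
      nonzero : ι (+ N) * W 0 ≢ 0ℚ
      nonzero eq = [ proj₁ (proj₂ common) , (λ ()) ]′ (ℕ.m*n≡0⇒m≡0∨n≡0 N (ℤ.+-injective (trans (ℤ.pos-* N 2)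
          (ι-injective {+ N ℤ.* + 2} {0ℤ} (trans (ι-* (+ N) (+ 2)) eq)))))
      id₀ : ∀ D x a b → let w = a * 1ℚ + D * (b * 0ℚ) in x * (w + w) + x * (w + w) ≡ x * (a + a) * (1ℚ + 1ℚ)
      id₀ = solve-∀ ℚ-ring
      id₁ : ∀ x w w″ t w′ → w″ + w ≡ t * w′ → x * w″ + x * w ≡ x * t * w′
      id₁ x w w″ t w′ eq = trans (sym (ℚ.*-distribˡ-+ x w″ w)) (trans (cong (x *_) eq) (sym (ℚ.*-assoc x t w′)))
      good : ∀ i j → IsInt (x i * W j)
      good zero    j       = allInt W (ι (+ N)) cs (relation-zero cs root) (proj₂ (proj₂ common)) j
      -- The case j = -1 of the recurrence: W₋₁ = W₁, so T · W₀ = 2 W₁.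
      good (suc i) zero    = subst IsInt (id₀ D (x i) a b) (int-+ (good i 1) (good i 1))
      good (suc i) (suc j) = subst IsInt (id₁ (x i) (W j) (W (2 ℕ.+ j)) (a + a) (W (1 ℕ.+ j)) (trace-rec j))
          (int-+ (good i (2 ℕ.+ j)) (good i j))

    module _ (z : ℕ) (trace≡ : a + a ≡ ι (+ (z ℕ.+ 2))) where

      trace≡V : ∀ n → W n ≡ ι (+ V z n)
      trace≡V zero = refl
      trace≡V (suc zero) = trans (identity D a b) (trans trace≡ (cong (λ k → ι (+ k)) (trans (ℕ.+-comm z 2)
          (cong (2 ℕ.+_) (sym (ℕ.*-identityʳ z))))))
        where
        identity : ∀ D a b → (a * 1ℚ + D * (b * 0ℚ)) + (a * 1ℚ + D * (b * 0ℚ)) ≡ a + a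
        identity = solve-∀ ℚ-ring
      trace≡V (suc (suc n)) = cancel (W (2 ℕ.+ n)) (ι (+ V z (2 ℕ.+ n))) (W n) (begin
        W (2 ℕ.+ n) + W n ≡⟨ trace-rec n ⟩
        (a + a) * W (1 ℕ.+ n) ≡⟨ cong₂ _*_ trace≡ (trace≡V (suc n)) ⟩
        ι (+ (z ℕ.+ 2)) * ι (+ V z (1 ℕ.+ n)) ≡⟨ ι-* (+ (z ℕ.+ 2)) (+ V z (1 ℕ.+ n)) ⟨
        ι (+ (z ℕ.+ 2) ℤ.* + V z (1 ℕ.+ n)) ≡⟨ cong ι (ℤ.pos-* (z ℕ.+ 2) (V z (1 ℕ.+ n))) ⟨
        ι (+ ((z ℕ.+ 2) ℕ.* V z (1 ℕ.+ n))) ≡⟨ cong (λ k → ι (+ k)) (V-rec z n) ⟨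
        ι (+ (V z (2 ℕ.+ n) ℕ.+ V z n)) ≡⟨ ι-+ (+ V z (2 ℕ.+ n)) (+ V z n) ⟩
        ι (+ V z (2 ℕ.+ n)) + ι (+ V z n) ≡⟨ cong (λ w → ι (+ V z (2 ℕ.+ n)) + w) (trace≡V n) ⟨
        ι (+ V z (2 ℕ.+ n)) + W n ∎)
        where
        open ≡-Reasoning
        cancel : ∀ x y w → x + w ≡ y + w → x ≡ y
        cancel x y w eq = trans (identity x w) (trans (cong (_+ (- w)) eq) (sym (identity y w)))
          where
          identity : ∀ x w → x ≡ (x + w) + (- w)
          identity = solve-∀ ℚ-ring

      norm-^ : ∀ n → norm (u ^ n) ≡ 1ℚ
      norm-^ zero = identity D
        where
        identity : ∀ D → 1ℚ * 1ℚ - D * (0ℚ * 0ℚ) ≡ 1ℚ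
        identity = solve-∀ ℚ-ring
      norm-^ (suc n) = trans (identity D a b (P n) (Q n)) (cong₂ _*_ norm≡1 (norm-^ n))
        where
        identity : ∀ D a b p q → (a * p + D * (b * q)) * (a * p + D * (b * q)) - D * ((a * q + b * p) * (a * q + b *
            p)) ≡ (a * a - D * (b * b)) * (p * p - D * (q * q))
        identity = solve-∀ ℚ-ring

      Δ≡norm : ∀ n → Δ z n / 1 ≡ norm (u ^ n K.- 1#)
      Δ≡norm n = begin
        ι (ℤ.- (+ δ z n)) ≡⟨ ι-neg (+ δ z n) ⟩
        - ι (+ δ z n) ≡⟨ id₁ (ι (+ δ z n)) ⟩
        1ℚ + 1ℚ - (1ℚ + 1ℚ + ι (+ δ z n)) ≡⟨ cong (λ w → 1ℚ + 1ℚ - w) (ι-+ (+ 2) (+ δ z n)) ⟨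
        1ℚ + 1ℚ - ι (+ V z n) ≡⟨ cong (λ w → 1ℚ + 1ℚ - w) (trace≡V n) ⟨
        1ℚ + 1ℚ - W n ≡⟨ cong (λ x → x + 1ℚ - W n) (norm-^ n) ⟨
        norm (u ^ n) + 1ℚ - W n ≡⟨ id₂ D (P n) (Q n) ⟩
        norm (u ^ n K.- 1#) ∎
        where
        open ≡-Reasoning
        id₁ : ∀ x → - x ≡ 1ℚ + 1ℚ - (1ℚ + 1ℚ + x)
        id₁ = solve-∀ ℚ-ring
        id₂ : ∀ D p q → (p * p - D * (q * q)) + 1ℚ - (p + p) ≡ (p + (- 1ℚ)) * (p + (- 1ℚ)) - D * ((q + (- 0ℚ)) *
            (q + (- 0ℚ)))
        id₂ = solve-∀ ℚ-ring

-- Locating u in ℝ through its trace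

module RealEmbedding where

  open import Data.Empty using (⊥; ⊥-elim)
  open import Data.Integer as ℤ using (ℤ; +_)
  import Data.Integer.Properties as ℤ
  open import Data.Nat as ℕ using (ℕ; suc; s≤s)
  import Data.Nat.Properties as ℕ
  open import Data.Product using (∃-syntax; _,_)
  open import Data.Rational as ℚ using (ℚ; 0ℚ; 1ℚ; _/_; _+_; _*_; -_; _-_; _<_; _≤_)
  import Data.Rational.Properties as ℚ
  open import Data.Sum using (_⊎_; inj₁; inj₂; [_,_]′)
  open import Defs as K using (_⊕_√d; fromℚ; fromℤ; norm; 0#; 1#)
  open import Relation.Binary.Definitions using (Tri; tri<; tri≈; tri>)
  open import Relation.Binary.PropositionalEquality using (_≡_; _≢_; refl; sym; trans; cong; cong₂; subst; subst₂; module ≡-Reasoning)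
  open import Relation.Nullary using (¬_)
  open import Relation.Nullary.Decidable using (from-yes)
  open import Tactic.RingSolver using (solve-∀)
  open IntegralTraces
  open RationalSolver

  0<+0< : ∀ {x y} → 0ℚ < x → 0ℚ < y → 0ℚ < x + y
  0<+0< 0<x 0<y = ℚ.+-mono-< 0<x 0<y

  0≤+0< : ∀ {x y} → 0ℚ ≤ x → 0ℚ < y → 0ℚ < x + y
  0≤+0< 0≤x 0<y = ℚ.+-mono-≤-< 0≤x 0<y

  0<*0< : ∀ {x y} → 0ℚ < x → 0ℚ < y → 0ℚ < x * y
  0<*0< {x} {y} 0<x 0<y = ℚ.positive⁻¹ (x * y) {{ℚ.pos*pos⇒pos x {{ℚ.positive 0<x}} y {{ℚ.positive 0<y}}}}

  0≤*0≤ : ∀ {x y} → 0ℚ ≤ x → 0ℚ ≤ y → 0ℚ ≤ x * y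
  0≤*0≤ {x} {y} 0≤x 0≤y = ℚ.nonNegative⁻¹ (x * y) {{ℚ.nonNeg*nonNeg⇒nonNeg x {{ℚ.nonNegative 0≤x}} y
      {{ℚ.nonNegative 0≤y}}}}

  0≤neg : ∀ {x} → x ≤ 0ℚ → 0ℚ ≤ - x
  0≤neg x≤0 = ℚ.neg-antimono-≤ x≤0

  0<neg : ∀ {x} → x < 0ℚ → 0ℚ < - x
  0<neg x<0 = ℚ.neg-antimono-< x<0

  0≤square : ∀ x → 0ℚ ≤ x * x
  0≤square x with ℚ.≤-total 0ℚ x
  ... | inj₁ 0≤x = 0≤*0≤ 0≤x 0≤x
  ... | inj₂ x≤0 = subst (0ℚ ≤_) (identity x) (0≤*0≤ (0≤neg x≤0) (0≤neg x≤0))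
    where
    identity : ∀ x → (- x) * (- x) ≡ x * x
    identity = solve-∀ ℚ-ring

  0<difference : ∀ {x y} → x < y → 0ℚ < y - x
  0<difference {x} {y} x<y = subst (_< y - x) (ℚ.+-inverseʳ x) (ℚ.+-monoˡ-< (- x) x<y)

  0<difference⇒< : ∀ {x y} → 0ℚ < y - x → x < y
  0<difference⇒< {x} {y} 0<y-x = subst₂ _<_ (ℚ.+-identityˡ x) (identity x y) (ℚ.+-monoˡ-< x 0<y-x)
    where
    identity : ∀ x y → y - x + x ≡ y
    identity = solve-∀ ℚ-ring

  double-injective : ∀ {x y} → x + x ≡ y + y → x ≡ y
  double-injective {x} {y} eq = trans (identity x) (trans (cong (_* ℚ.½) eq) (sym (identity y)))
    where
    identity : ∀ x → x ≡ (x + x) * ℚ.½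
    identity x = trans (sym (ℚ.*-identityʳ x)) (trans (ℚ.*-distribˡ-+ x ℚ.½ ℚ.½) (sym (ℚ.*-distribʳ-+ ℚ.½ x x)))

  0≤ι : ∀ n → 0ℚ ≤ ι (+ n)
  0≤ι n = subst (0ℚ ≤_) (sym (ι≡mkι (+ n))) (ℚ.nonNegative⁻¹ (mkι (+ n)))

  ι-cancel-< : ∀ {i j} → ι i < ι j → i ℤ.< j
  ι-cancel-< {i} {j} h = subst₂ ℤ._<_ (ℤ.*-identityʳ i) (ℤ.*-identityʳ j) (ℚ.drop-*<* (subst₂ _<_ (ι≡mkι i) (ι≡mkι j)
      h))

  -- With s = b l − c > 0, the numbers s² + 2 s c, (D − l²) b² and c² − a² + 1 add up to 0.
  norm1⇒bl≤c : ∀ D a b l c → a * a - D * (b * b) ≡ 1ℚ → l * l < D → 0ℚ ≤ c → 0ℚ < c * c - a * a + 1ℚ → ¬ (0ℚ < b * l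
      - c)
  norm1⇒bl≤c D a b l c norm≡1 l²<D 0≤c 0<e 0<s = ℚ.<-irrefl refl (subst (0ℚ <_) sum≡0
    (0≤+0< (0≤*0≤ (ℚ.<⇒≤ (0<difference l²<D)) (0≤square b)) (0<+0< (0≤+0< (0≤*0≤ 0≤sc 0≤2) (0<*0< 0<s 0<s)) 0<e)))
    where
    s = b * l - c
    0≤2 : 0ℚ ≤ 1ℚ + 1ℚ
    0≤2 = from-yes (0ℚ ℚ.≤? 1ℚ + 1ℚ)
    0≤sc : 0ℚ ≤ s * c
    0≤sc = 0≤*0≤ (ℚ.<⇒≤ 0<s) 0≤c
    identity : ∀ D a b l c → (D - l * l) * (b * b) + ((b * l - c) * c * (1ℚ + 1ℚ) + (b * l - c) * (b * l - c) +
        (c * c - a * a + 1ℚ)) ≡ 1ℚ - (a * a - D * (b * b))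
    identity = solve-∀ ℚ-ring
    sum≡0 : (D - l * l) * (b * b) + (s * c * (1ℚ + 1ℚ) + s * s + (c * c - a * a + 1ℚ)) ≡ 0ℚ
    sum≡0 = trans (identity D a b l c) (cong (λ n → 1ℚ - n) norm≡1)

  module _ {d : ℕ} (1<d : 1 ℕ.< d) {a b : ℚ} (norm≡1 : norm {d} (a ⊕ b √d) ≡ 1ℚ) (0<u : 0# {d} K.< (a ⊕ b √d)) (u≢1 : (a ⊕ b √d) ≢ 1# {d}) where

    private
      D : ℚ
      D = + d / 1

    0<D : 0ℚ < D
    0<D = subst (0ℚ <_) (sym (ι≡mkι (+ d))) (positive d 1<d)
      where
      positive : ∀ d → 1 ℕ.< d → 0ℚ < mkι (+ d)
      positive (suc d) _ = ℚ.positive⁻¹ (mkι (+ suc d))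

    -- A positive u of norm 1 has a positive conjugate, so 2a is a sum of positive numbers. In
    -- rational terms: if a ≤ 0, then c = -a turns the last summand of `norm1⇒bl≤c` into 1.
    0<a : 0ℚ < a
    0<a = from 0<u
      where
      from : 0# {d} K.< (a ⊕ b √d) → 0ℚ < a
      id₁ : ∀ a → 1ℚ ≡ (- a) * (- a) - a * a + 1ℚ
      id₁ = solve-∀ ℚ-ring
      id₂ : ∀ a b l → (a + (- 0ℚ)) + (b + (- 0ℚ)) * l ≡ b * l - (- a)
      id₂ = solve-∀ ℚ-ring
      from (l , r , (0<l , l²<D) , _ , 0<a+bl , _) = ℚ.≰⇒> λ a≤0 →
        norm1⇒bl≤c D a b l (- a) norm≡1 l²<D (0≤neg a≤0) (subst (0ℚ <_) (id₁ a) (from-yes (0ℚ ℚ.<? 1ℚ)))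
            (subst (0ℚ <_) (id₂ a b l) 0<a+bl)

    b≢0 : b ≢ 0ℚ
    b≢0 b≡0 = contradict (ℚ.<-cmp a 1ℚ)
      where
      a²≡1 : a * a - D * (0ℚ * 0ℚ) ≡ 1ℚ
      a²≡1 = trans (cong (λ b → a * a - D * (b * b)) (sym b≡0)) norm≡1
      0<a+1 : 0ℚ < a + 1ℚ
      0<a+1 = 0<+0< 0<a (from-yes (0ℚ ℚ.<? 1ℚ))
      id₁ : ∀ D a → (1ℚ - a) * (a + 1ℚ) ≡ 1ℚ - (a * a - D * (0ℚ * 0ℚ))
      id₁ = solve-∀ ℚ-ring
      id₂ : ∀ D a → (a - 1ℚ) * (a + 1ℚ) ≡ (a * a - D * (0ℚ * 0ℚ)) - 1ℚ
      id₂ = solve-∀ ℚ-ring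
      contradict : Tri (a < 1ℚ) (a ≡ 1ℚ) (1ℚ < a) → ⊥
      contradict (tri≈ _ a≡1 _) = u≢1 (cong₂ _⊕_√d a≡1 b≡0)
      contradict (tri< a<1 _ _) = ℚ.<-irrefl refl (subst (0ℚ <_) (trans (id₁ D a) (cong (λ n → 1ℚ - n) a²≡1))
          (0<*0< (0<difference a<1) 0<a+1))
      contradict (tri> _ _ 1<a) = ℚ.<-irrefl refl (subst (0ℚ <_) (trans (id₂ D a) (cong (λ n → n - 1ℚ) a²≡1))
          (0<*0< (0<difference 1<a) 0<a+1))

    0<b² : 0ℚ < b * b
    0<b² with ℚ.<-cmp 0ℚ b
    ... | tri< 0<b _ _ = 0<*0< 0<b 0<b
    ... | tri≈ _ 0≡b _ = ⊥-elim (b≢0 (sym 0≡b))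
    ... | tri> _ _ b<0 = subst (0ℚ <_) (identity b) (0<*0< (0<neg b<0) (0<neg b<0))
      where
      identity : ∀ x → (- x) * (- x) ≡ x * x
      identity = solve-∀ ℚ-ring

    1<a : 1ℚ < a
    1<a = ℚ.≰⇒> λ a≤1 → ℚ.<-irrefl refl (subst (0ℚ <_) (trans (identity D a b) (cong (λ n → 1ℚ - n) norm≡1))
      (0≤+0< (0≤*0≤ (subst (_≤ 1ℚ - a) (ℚ.+-inverseʳ a) (ℚ.+-monoˡ-≤ (- a) a≤1))
          (ℚ.<⇒≤ (0<+0< 0<a (from-yes (0ℚ ℚ.<? 1ℚ))))) (0<*0< 0<D 0<b²)))
      where
      identity : ∀ D a b → (1ℚ - a) * (a + 1ℚ) + D * (b * b) ≡ 1ℚ - (a * a - D * (b * b))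
      identity = solve-∀ ℚ-ring

    trace≥3 : IsInt (a + a) → ∃[ k ] a + a ≡ ι (+ (3 ℕ.+ k))
    trace≥3 (i , eq) = from i eq (ι-cancel-< {+ 2} {i} (subst (ι (+ 2) <_) eq (ℚ.+-mono-< 1<a 1<a)))
      where
      from : ∀ i → a + a ≡ ι i → + 2 ℤ.< i → ∃[ k ] a + a ≡ ι (+ (3 ℕ.+ k))
      from (+ suc (suc (suc k))) eq _ = k , eq
      from (+ 0) _ (ℤ.+<+ ())
      from (+ 1) _ (ℤ.+<+ (s≤s ()))
      from (+ 2) _ (ℤ.+<+ (s≤s (s≤s ())))

  -- √D lies between l = (a − 3/20) / c and r = a / c because D c² = a² − 1.
  record Bracket (D a c : ℚ) : Set where
    field
      l r : ℚ
      0<l : 0ℚ < l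
      l²<D : l * l < D
      0<r : 0ℚ < r
      D<r² : D < r * r
      cl≡ : c * l ≡ a - (+ 3 / 20)
      cr≡ : c * r ≡ a

  bracket : ∀ D a c w → 1ℚ < a → 0ℚ < c → 0ℚ ≤ w → a + a ≡ ι (+ 7) + w → a * a - D * (c * c) ≡ 1ℚ → Bracket D a c
  bracket D a c w 1<a 0<c 0≤w 2a≡ norm≡1 = record
    { l = (a - e) * i ; r = a * i
    ; 0<l = 0<*0< (subst (0ℚ <_) (id₁ a e) (0<+0< (0<difference 1<a) (from-yes (0ℚ ℚ.<? 1ℚ - e)))) 0<i
    ; l²<D = 0<difference⇒< (subst (0ℚ <_) l²≡ (0<*0< (0<*0< 0<i 0<i) (0≤+0< (0≤*0≤ (from-yes (0ℚ ℚ.≤? e)) 0≤w)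
        (from-yes (0ℚ ℚ.<? κ)))))
    ; 0<r = 0<*0< (ℚ.<-trans (from-yes (0ℚ ℚ.<? 1ℚ)) 1<a) 0<i
    ; D<r² = 0<difference⇒< (subst (0ℚ <_) r²≡ (0<*0< 0<i 0<i))
    ; cl≡ = trans (id₅ c (a - e) i) (trans (cong ((a - e) *_) ci≡1) (ℚ.*-identityʳ (a - e)))
    ; cr≡ = trans (id₅ c a i) (trans (cong (a *_) ci≡1) (ℚ.*-identityʳ a))
    }
    where
    e κ : ℚ
    -- Since √(a² - 1) = a - 1/v for the larger v of u and 1/u, e has to exceed 1/v, at most
    -- 0.1459... for traces from 7 on, and to stay below the 1/6 of the application. The first
    -- condition is the positivity of `κ`.
    e = + 3 / 20
    κ = e * ι (+ 7) - e * e - 1ℚ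
    instance
      c-positive : ℚ.Positive c
      c-positive = ℚ.positive 0<c
      c≢0 : ℚ.NonZero c
      c≢0 = ℚ.pos⇒nonZero c
    i : ℚ
    i = ℚ.1/ c
    0<i : 0ℚ < i
    0<i = ℚ.positive⁻¹ i {{ℚ.1/pos⇒pos c}}
    ci≡1 : c * i ≡ 1ℚ
    ci≡1 = ℚ.*-inverseʳ c
    id₁ : ∀ a e → (a - 1ℚ) + (1ℚ - e) ≡ a - e
    id₁ = solve-∀ ℚ-ring
    id₂ : ∀ D a c i → D * ((c * i) * (c * i)) ≡ (a * a - (a * a - D * (c * c))) * (i * i)
    id₂ = solve-∀ ℚ-ring
    D≡ : D ≡ (a * a - 1ℚ) * (i * i)
    D≡ = begin
      D ≡⟨ ℚ.*-identityʳ D ⟨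
      D * (1ℚ * 1ℚ) ≡⟨ cong (λ x → D * (x * x)) ci≡1 ⟨
      D * ((c * i) * (c * i)) ≡⟨ id₂ D a c i ⟩
      (a * a - (a * a - D * (c * c))) * (i * i) ≡⟨ cong (λ n → (a * a - n) * (i * i)) norm≡1 ⟩
      (a * a - 1ℚ) * (i * i) ∎
      where open ≡-Reasoning
    id₃ : ∀ a e i s w → a + a ≡ s + w → i * i * (e * w + (e * s - e * e - 1ℚ)) ≡ (a * a - 1ℚ) * (i * i) - (a - e) * i
        * ((a - e) * i)
    id₃ a e i s w eq = trans (poly₁ e i s w) (trans (cong (λ t → i * i * (e * t - e * e - 1ℚ)) (sym eq))
        (poly₂ a e i))
      where
      poly₁ : ∀ e i s w → i * i * (e * w + (e * s - e * e - 1ℚ)) ≡ i * i * (e * (s + w) - e * e - 1ℚ)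
      poly₁ = solve-∀ ℚ-ring
      poly₂ : ∀ a e i → i * i * (e * (a + a) - e * e - 1ℚ) ≡ (a * a - 1ℚ) * (i * i) - (a - e) * i * ((a - e) * i)
      poly₂ = solve-∀ ℚ-ring
    l²≡ : i * i * (e * w + κ) ≡ D - (a - e) * i * ((a - e) * i)
    l²≡ = trans (id₃ a e i (ι (+ 7)) w 2a≡) (cong (λ x → x - (a - e) * i * ((a - e) * i)) (sym D≡))
    id₄ : ∀ a i → i * i ≡ a * i * (a * i) - (a * a - 1ℚ) * (i * i)
    id₄ = solve-∀ ℚ-ring
    r²≡ : i * i ≡ a * i * (a * i) - D
    r²≡ = trans (id₄ a i) (cong (λ x → a * i * (a * i) - x) (sym D≡))
    id₅ : ∀ c x i → c * (x * i) ≡ x * (c * i)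
    id₅ = solve-∀ ℚ-ring

  module _ {d : ℕ} {a b : ℚ} (norm≡1 : norm {d} (a ⊕ b √d) ≡ 1ℚ) (1<a : 1ℚ < a) (b≢0 : b ≢ 0ℚ) where

    private
      D : ℚ
      D = + d / 1

    -- The sign of b tells whether u is the larger or the smaller root of X² - tX + 1. The larger
    -- root exceeds 6 exactly when t > 6 + 1/6, so 7 is the first such integer trace.
    7≤trace⇒outside : ∀ k → a + a ≡ ι (+ (7 ℕ.+ k)) → (a ⊕ b √d) K.< fromℚ {d} (+ 1 / 6) ⊎ fromℤ {d} (+ 6) K.<
        (a ⊕ b √d)
    7≤trace⇒outside k 2a≡ with ℚ.<-cmp 0ℚ b
    ... | tri≈ _ 0≡b _ = ⊥-elim (b≢0 (sym 0≡b))
    ... | tri< 0<b _ _ = inj₂ (l , r , (0<l , l²<D) , (0<r , D<r²) ,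
            subst (0ℚ <_) (sym (trans (id₁ a (- ι (+ 6)) b l) (trans (cong (λ x → a + (- ι (+ 6)) + x) cl≡)
                (above (+ 3 / 20)))))
              (0≤+0< (0≤ι k) (from-yes (0ℚ ℚ.<? ι (+ 7) - ι (+ 6) - (+ 3 / 20)))) ,
            subst (0ℚ <_) (sym (trans (id₁ a (- ι (+ 6)) b r) (trans (cong (λ x → a + (- ι (+ 6)) + x)
                (trans cr≡ (sym (id₀ a)))) (above 0ℚ))))
              (0≤+0< (0≤ι k) (from-yes (0ℚ ℚ.<? ι (+ 7) - ι (+ 6) - 0ℚ))))
      where
      w = ι (+ k)
      2a≡′ : a + a ≡ ι (+ 7) + w
      2a≡′ = trans 2a≡ (ι-+ (+ 7) (+ k))
      open Bracket (bracket D a b w 1<a 0<b (0≤ι k) 2a≡′ norm≡1)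
      id₀ : ∀ a → a - 0ℚ ≡ a
      id₀ = solve-∀ ℚ-ring
      id₁ : ∀ a m b l → (a + m) + (b + (- 0ℚ)) * l ≡ a + m + b * l
      id₁ = solve-∀ ℚ-ring
      id₂ : ∀ a m e → a + (- m) + (a - e) ≡ (a + a) + (- m) + (- e)
      id₂ = solve-∀ ℚ-ring
      id₃ : ∀ s w m e → s + w + (- m) + (- e) ≡ w + (s - m - e)
      id₃ = solve-∀ ℚ-ring
      above : ∀ e → a + (- ι (+ 6)) + (a - e) ≡ w + (ι (+ 7) - ι (+ 6) - e)
      above e = trans (id₂ a (ι (+ 6)) e) (trans (cong (λ x → x + (- ι (+ 6)) + (- e)) 2a≡′) (id₃ (ι (+ 7)) w
          (ι (+ 6)) e))
    ... | tri> _ _ b<0 = inj₁ (l , r , (0<l , l²<D) , (0<r , D<r²) ,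
            subst (0ℚ <_) (sym (trans (id₁ (+ 1 / 6) a b l) (trans (cong (λ x → (+ 1 / 6) - a + x) cl≡)
                (id₂ (+ 1 / 6) a (+ 3 / 20))))) (from-yes (0ℚ ℚ.<? (+ 1 / 6) - (+ 3 / 20))) ,
            subst (0ℚ <_) (sym (trans (id₁ (+ 1 / 6) a b r) (trans (cong (λ x → (+ 1 / 6) - a + x) cr≡)
                (id₃ (+ 1 / 6) a)))) (from-yes (0ℚ ℚ.<? (+ 1 / 6))))
      where
      w = ι (+ k)
      id₀ : ∀ D a b → a * a - D * ((- b) * (- b)) ≡ a * a - D * (b * b)
      id₀ = solve-∀ ℚ-ring
      open Bracket (bracket D a (- b) w 1<a (0<neg b<0) (0≤ι k) (trans 2a≡ (ι-+ (+ 7) (+ k))) (trans (id₀ D a b) norm≡1))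
      id₁ : ∀ s a b l → (s + (- a)) + (0ℚ + (- b)) * l ≡ s - a + (- b) * l
      id₁ = solve-∀ ℚ-ring
      id₂ : ∀ s a e → s - a + (a - e) ≡ s - e
      id₂ = solve-∀ ℚ-ring
      id₃ : ∀ s a → s - a + a ≡ s
      id₃ = solve-∀ ℚ-ring

  -- Here Z is 12, so the bound 6 can only be reconciled with the trace 3 by showing that u lies in
  -- the middle range.
  trace≡3⇒inside : ∀ {d a b} → norm {d} (a ⊕ b √d) ≡ 1ℚ → a + a ≡ ι (+ 3) → ¬ ((a ⊕ b √d) K.< fromℚ {d} (+ 1 / 6) ⊎
      fromℤ {d} (+ 6) K.< (a ⊕ b √d))
  trace≡3⇒inside {d} {a} {b} norm≡1 2a≡ with double-injective {a} {+ 3 / 2} 2a≡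
  ... | refl = [ below , above ]′
    where
    D : ℚ
    D = + d / 1
    above : fromℤ {d} (+ 6) K.< (a ⊕ b √d) → ⊥
    above (l , r , (0<l , l²<D) , _ , 0<s , _) = norm1⇒bl≤c D a b l (ι (+ 6) - a) norm≡1 l²<D
      (from-yes (0ℚ ℚ.≤? ι (+ 6) - a)) (from-yes (0ℚ ℚ.<? (ι (+ 6) - a) * (ι (+ 6) - a) - a * a + 1ℚ)) (subst (0ℚ <_)
          (identity (ι (+ 6)) a b l) 0<s)
      where
      identity : ∀ s a b l → (a + (- s)) + (b + (- 0ℚ)) * l ≡ b * l - (s - a)
      identity = solve-∀ ℚ-ring
    below : (a ⊕ b √d) K.< fromℚ {d} (+ 1 / 6) → ⊥
    below (l , r , (0<l , l²<D) , _ , 0<s , _) = norm1⇒bl≤c D a (- b) l (a - (+ 1 / 6)) (trans (id₀ D a b) norm≡1)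
        l²<D
      (from-yes (0ℚ ℚ.≤? a - (+ 1 / 6))) (from-yes (0ℚ ℚ.<? (a - (+ 1 / 6)) * (a - (+ 1 / 6)) - a * a + 1ℚ))
          (subst (0ℚ <_) (identity (+ 1 / 6) a b l) 0<s)
      where
      id₀ : ∀ D a b → a * a - D * ((- b) * (- b)) ≡ a * a - D * (b * b)
      id₀ = solve-∀ ℚ-ring
      identity : ∀ s a b l → (s + (- a)) + (0ℚ + (- b)) * l ≡ (- b) * l - (a - s)
      identity = solve-∀ ℚ-ring

-- Units of trace 3 to 6 and the final case distinction

open import Data.Empty using (⊥-elim)
open import Data.Integer as ℤ using (ℤ; +_; -[1+_])
import Data.Integer.Properties as ℤ
open import Data.List using ([]; _∷_)
open import Data.Nat as ℕ using (ℕ; suc; z≤n; s≤s; NonZero)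
open import Data.Nat.Coprimality using (Coprime; coprime-divisor)
open import Data.Nat.Divisibility as ℕ using (divides)
open import Data.Nat.Primality using (Prime; euclidsLemma)
import Data.Nat.Properties as ℕ
open import Data.Product using (Σ-syntax; ∃-syntax; _×_; _,_; proj₁; proj₂)
open import Data.Rational as ℚ using (ℚ; 1ℚ; _/_; ↥_; ↧_; ↧ₙ_)
import Data.Rational.Properties as ℚ
import Data.Sum as Sum
open import Data.Sum using (_⊎_; inj₁; inj₂; [_,_]′)
open import Defs
open import Function using (_∘_; id)
open import Relation.Binary.PropositionalEquality using (_≡_; _≢_; refl; sym; trans; cong; cong₂; subst; module ≡-Reasoning)
open import Relation.Nullary using (¬_; contradiction)
open import Relation.Nullary.Decidable using (from-no)
open import Tactic.RingSolver using (solve-∀)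
open PrimeFactors using (coprimeByPrimes; prime∤1)
open PrimitiveDivisors using (Δ; Z≤6)
open ExceptionalTraces
open IntegralTraces
open TraceSequence
open RealEmbedding
open RationalSolver

coprime-squares : ∀ {p q} .{{_ : NonZero p}} → Coprime p q → Coprime (p ℕ.* p) (q ℕ.* q)
coprime-squares {p} {q} cop = coprimeByPrimes (p ℕ.* p) (q ℕ.* q) {{ℕ.m*n≢0 p p}} λ {r} pr r∣p² r∣q² →
  prime∤1 pr (subst (r ℕ.∣_) (cop (divisor pr p r∣p² , divisor pr q r∣q²)) ℕ.∣-refl)
  where
  divisor : ∀ {r} → Prime r → ∀ x → r ℕ.∣ x ℕ.* x → r ℕ.∣ x
  divisor pr x = [ id , id ]′ ∘ euclidsLemma x x pr

-- In lowest terms B = ± p / q, and the equation is d p² = m q² with p² prime to q². Hence m = c p²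
-- and d = c q² for some c, and squarefreeness forces q = 1.
squareClass : ∀ {d m B} .{{_ : NonZero m}} → Squarefree d → ι (+ d) ℚ.* (B ℚ.* B) ≡ ι (+ m) →
              ∃[ p ] m ≡ d ℕ.* (p ℕ.* p) × (B ≡ ι (+ p) ⊎ B ≡ ι (ℤ.- (+ p)))
squareClass {d} {m} {B} squarefree dB²≡m = p , trans m≡cp² (cong (ℕ._* (p ℕ.* p)) (sym d≡c)) , sign (↥ B) refl
  where
  p q : ℕ
  p = ℤ.∣ ↥ B ∣
  q = ↧ₙ B
  identity : ∀ d b q → d ℚ.* ((b ℚ.* q) ℚ.* (b ℚ.* q)) ≡ (d ℚ.* (b ℚ.* b)) ℚ.* (q ℚ.* q)
  identity = solve-∀ ℚ-ring
  ι-*² : ∀ i j → ι (i ℤ.* (j ℤ.* j)) ≡ ι i ℚ.* (ι j ℚ.* ι j)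
  ι-*² i j = trans (ι-* i (j ℤ.* j)) (cong (ι i ℚ.*_) (ι-* j j))
  integral : + d ℤ.* (↥ B ℤ.* ↥ B) ≡ + m ℤ.* (↧ B ℤ.* ↧ B)
  integral = ι-injective (begin
    ι (+ d ℤ.* (↥ B ℤ.* ↥ B)) ≡⟨ ι-*² (+ d) (↥ B) ⟩
    ι (+ d) ℚ.* (ι (↥ B) ℚ.* ι (↥ B)) ≡⟨ cong (λ x → ι (+ d) ℚ.* (x ℚ.* x)) (x*↧x B) ⟨
    ι (+ d) ℚ.* ((B ℚ.* ι (↧ B)) ℚ.* (B ℚ.* ι (↧ B))) ≡⟨ identity (ι (+ d)) B (ι (↧ B)) ⟩
    ι (+ d) ℚ.* (B ℚ.* B) ℚ.* (ι (↧ B) ℚ.* ι (↧ B)) ≡⟨ cong (ℚ._* (ι (↧ B) ℚ.* ι (↧ B))) dB²≡m ⟩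
    ι (+ m) ℚ.* (ι (↧ B) ℚ.* ι (↧ B)) ≡⟨ ι-*² (+ m) (↧ B) ⟨
    ι (+ m ℤ.* (↧ B ℤ.* ↧ B)) ∎)
    where open ≡-Reasoning
  abs-*² : ∀ i j → ℤ.∣ i ℤ.* (j ℤ.* j) ∣ ≡ ℤ.∣ i ∣ ℕ.* (ℤ.∣ j ∣ ℕ.* ℤ.∣ j ∣)
  abs-*² i j = trans (ℤ.abs-* i (j ℤ.* j)) (cong (ℤ.∣ i ∣ ℕ.*_) (ℤ.abs-* j j))
  dp²≡mq² : d ℕ.* (p ℕ.* p) ≡ m ℕ.* (q ℕ.* q)
  dp²≡mq² = trans (sym (abs-*² (+ d) (↥ B))) (trans (cong ℤ.∣_∣ integral) (abs-*² (+ m) (↧ B)))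
  p²≢0 : NonZero (p ℕ.* p)
  p²≢0 = ℕ.m*n≢0⇒n≢0 d {{subst NonZero (sym dp²≡mq²) (ℕ.m*n≢0 m (q ℕ.* q))}}
  p²∣m : p ℕ.* p ℕ.∣ m
  p²∣m = coprime-divisor (coprime-squares {{ℕ.m*n≢0⇒m≢0 p {{p²≢0}}}} (↥-↧-coprime B))
    (divides d (trans (ℕ.*-comm (q ℕ.* q) m) (sym dp²≡mq²)))
  c : ℕ
  c = ℕ.quotient p²∣m
  m≡cp² : m ≡ c ℕ.* (p ℕ.* p)
  m≡cp² = ℕ._∣_.equality p²∣m
  d≡cq² : d ≡ c ℕ.* (q ℕ.* q)
  d≡cq² = ℕ.*-cancelʳ-≡ d _ (p ℕ.* p) {{p²≢0}} (begin
    d ℕ.* (p ℕ.* p) ≡⟨ dp²≡mq² ⟩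
    m ℕ.* (q ℕ.* q) ≡⟨ cong (ℕ._* (q ℕ.* q)) m≡cp² ⟩
    c ℕ.* (p ℕ.* p) ℕ.* (q ℕ.* q) ≡⟨ ℕ.*-assoc c (p ℕ.* p) (q ℕ.* q) ⟩
    c ℕ.* ((p ℕ.* p) ℕ.* (q ℕ.* q)) ≡⟨ cong (c ℕ.*_) (ℕ.*-comm (p ℕ.* p) (q ℕ.* q)) ⟩
    c ℕ.* ((q ℕ.* q) ℕ.* (p ℕ.* p)) ≡⟨ ℕ.*-assoc c (q ℕ.* q) (p ℕ.* p) ⟨
    c ℕ.* (q ℕ.* q) ℕ.* (p ℕ.* p) ∎)
    where open ≡-Reasoning
  q≡1 : q ≡ 1
  q≡1 = squarefree q (divides c d≡cq²)
  d≡c : d ≡ c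
  d≡c = trans d≡cq² (trans (cong (λ q → c ℕ.* (q ℕ.* q)) q≡1) (ℕ.*-identityʳ c))
  B≡ : B ≡ ι (↥ B)
  B≡ = trans (sym (ℚ.*-identityʳ B)) (trans (cong (λ q → B ℚ.* ι (+ q)) (sym q≡1)) (x*↧x B))
  sign : ∀ i → ↥ B ≡ i → B ≡ ι (+ p) ⊎ B ≡ ι (ℤ.- (+ p))
  sign (+ n) eq = inj₁ (trans B≡ (cong ι (trans eq (cong (+_ ∘ ℤ.∣_∣) (sym eq)))))
  sign -[1+ n ] eq = inj₂ (trans B≡ (cong ι (trans eq (cong (λ i → ℤ.- (+ ℤ.∣ i ∣)) (sym eq)))))

-- 5, 12, 21 and 32 are the values of t² − 4 at t = 3, 4, 5, 6.
solution-5 : ∀ {d} p → 5 ≡ d ℕ.* (p ℕ.* p) → d ≡ 5 × p ≡ 1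
solution-5 {d} p eq = from p (ℕ.∣⇒≤ (divides d eq)) eq
  where
  from : ∀ p → p ℕ.* p ℕ.≤ 5 → 5 ≡ d ℕ.* (p ℕ.* p) → d ≡ 5 × p ≡ 1
  from 0 _ eq = contradiction (trans eq (ℕ.*-zeroʳ d)) λ ()
  from 1 _ eq = trans (sym (ℕ.*-identityʳ d)) (sym eq) , refl
  from 2 _ eq = ⊥-elim (from-no (4 ℕ.∣? 5) (divides d eq))
  from (suc (suc (suc p))) h _ = ⊥-elim (from-no (9 ℕ.≤? 5) (ℕ.≤-trans (ℕ.*-mono-≤ {3} {3 ℕ.+ p} (ℕ.m≤m+n 3 p)
      (ℕ.m≤m+n 3 p)) h))

solution-12 : ∀ {d} p → Squarefree d → 12 ≡ d ℕ.* (p ℕ.* p) → d ≡ 3 × p ≡ 2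
solution-12 {d} p squarefree eq = from p (ℕ.∣⇒≤ (divides d eq)) eq
  where
  from : ∀ p → p ℕ.* p ℕ.≤ 12 → 12 ≡ d ℕ.* (p ℕ.* p) → d ≡ 3 × p ≡ 2
  from 0 _ eq = contradiction (trans eq (ℕ.*-zeroʳ d)) λ ()
  from 1 _ eq = contradiction (squarefree 2 (divides 3 (trans (sym (ℕ.*-identityʳ d)) (sym eq)))) λ ()
  from 2 _ eq = ℕ.*-cancelʳ-≡ d 3 4 (sym eq) , refl
  from 3 _ eq = ⊥-elim (from-no (9 ℕ.∣? 12) (divides d eq))
  from (suc (suc (suc (suc p)))) h _ = ⊥-elim (from-no (16 ℕ.≤? 12) (ℕ.≤-trans (ℕ.*-mono-≤ {4} {4 ℕ.+ p}
      (ℕ.m≤m+n 4 p) (ℕ.m≤m+n 4 p)) h))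

solution-21 : ∀ {d} p → 21 ≡ d ℕ.* (p ℕ.* p) → d ≡ 21 × p ≡ 1
solution-21 {d} p eq = from p (ℕ.∣⇒≤ (divides d eq)) eq
  where
  from : ∀ p → p ℕ.* p ℕ.≤ 21 → 21 ≡ d ℕ.* (p ℕ.* p) → d ≡ 21 × p ≡ 1
  from 0 _ eq = contradiction (trans eq (ℕ.*-zeroʳ d)) λ ()
  from 1 _ eq = trans (sym (ℕ.*-identityʳ d)) (sym eq) , refl
  from 2 _ eq = ⊥-elim (from-no (4 ℕ.∣? 21) (divides d eq))
  from 3 _ eq = ⊥-elim (from-no (9 ℕ.∣? 21) (divides d eq))
  from 4 _ eq = ⊥-elim (from-no (16 ℕ.∣? 21) (divides d eq))
  from (suc (suc (suc (suc (suc p))))) h _ = ⊥-elim (from-no (25 ℕ.≤? 21) (ℕ.≤-trans (ℕ.*-mono-≤ {5} {5 ℕ.+ p}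
      (ℕ.m≤m+n 5 p) (ℕ.m≤m+n 5 p)) h))

solution-32 : ∀ {d} p → Squarefree d → 32 ≡ d ℕ.* (p ℕ.* p) → d ≡ 2 × p ≡ 4
solution-32 {d} p squarefree eq = from p (ℕ.∣⇒≤ (divides d eq)) eq
  where
  from : ∀ p → p ℕ.* p ℕ.≤ 32 → 32 ≡ d ℕ.* (p ℕ.* p) → d ≡ 2 × p ≡ 4
  from 0 _ eq = contradiction (trans eq (ℕ.*-zeroʳ d)) λ ()
  from 1 _ eq = contradiction (squarefree 2 (divides 8 (trans (sym (ℕ.*-identityʳ d)) (sym eq)))) λ ()
  from 2 _ eq = contradiction (squarefree 2 (divides 2 (ℕ.*-cancelʳ-≡ d 8 4 (sym eq)))) λ ()
  from 3 _ eq = ⊥-elim (from-no (9 ℕ.∣? 32) (divides d eq))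
  from 4 _ eq = ℕ.*-cancelʳ-≡ d 2 16 (sym eq) , refl
  from 5 _ eq = ⊥-elim (from-no (25 ℕ.∣? 32) (divides d eq))
  from (suc (suc (suc (suc (suc (suc p)))))) h _ = ⊥-elim (from-no (36 ℕ.≤? 32) (ℕ.≤-trans (ℕ.*-mono-≤ {6} {6 ℕ.+ p}
      (ℕ.m≤m+n 6 p) (ℕ.m≤m+n 6 p)) h))

discriminant : ∀ {d a b} t → norm {d} (a ⊕ b √d) ≡ 1ℚ → a ℚ.+ a ≡ t → ι (+ d) ℚ.* ((b ℚ.+ b) ℚ.* (b ℚ.+ b)) ≡ t ℚ.* t
    ℚ.- (1ℚ ℚ.+ 1ℚ) ℚ.* (1ℚ ℚ.+ 1ℚ)
discriminant {d} {a} {b} t norm≡1 2a≡ = trans (identity (ι (+ d)) a b) (cong₂ (λ t n → t ℚ.* t ℚ.- (1ℚ ℚ.+ 1ℚ) ℚ.*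
    (1ℚ ℚ.+ 1ℚ) ℚ.* n) 2a≡ norm≡1)
  where
  identity : ∀ D a b → D ℚ.* ((b ℚ.+ b) ℚ.* (b ℚ.+ b)) ≡ (a ℚ.+ a) ℚ.* (a ℚ.+ a) ℚ.- (1ℚ ℚ.+ 1ℚ) ℚ.* (1ℚ ℚ.+ 1ℚ) ℚ.*
      (a ℚ.* a ℚ.- D ℚ.* (b ℚ.* b))
  identity = solve-∀ ℚ-ring

module _ {d : ℕ} {a b : ℚ} (norm≡1 : norm {d} (a ⊕ b √d) ≡ 1ℚ) (squarefree : Squarefree d) where

  private
    u : ℚ[√ d ]
    u = a ⊕ b √d

  -- Doubling clears the possible denominator 2 of b: the norm equation becomes d (2b)² = t² - 4,
  -- and `squareClass` shows that 2b is an integer.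
  doubles : ∀ m .{{_ : NonZero m}} t → a ℚ.+ a ≡ t → t ℚ.* t ℚ.- (1ℚ ℚ.+ 1ℚ) ℚ.* (1ℚ ℚ.+ 1ℚ) ≡ ι (+ m) →
            ∃[ p ] m ≡ d ℕ.* (p ℕ.* p) × (b ℚ.+ b ≡ ι (+ p) ⊎ b ℚ.+ b ≡ ι (ℤ.- (+ p)))
  doubles m t 2a≡ t²-4≡ = squareClass squarefree (trans (discriminant {d} {a} {b} t norm≡1 2a≡) t²-4≡)

  halves : ∀ x y y′ → a ℚ.+ a ≡ x ℚ.+ x → b ℚ.+ b ≡ y ℚ.+ y ⊎ b ℚ.+ b ≡ y′ ℚ.+ y′ → u ≡ (x ⊕ y √d) ⊎ u ≡ (x ⊕ y′ √d)
  halves x y y′ 2a≡ = Sum.map (λ 2b≡ → cong₂ _⊕_√d (double-injective 2a≡) (double-injective 2b≡)) (λ 2b≡ → cong₂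
      _⊕_√d (double-injective 2a≡) (double-injective 2b≡))

  solved : ∀ {p₀ m d₀} {A : Set} → (2b : ∃[ p ] m ≡ d ℕ.* (p ℕ.* p) × (b ℚ.+ b ≡ ι (+ p) ⊎ b ℚ.+ b ≡ ι (ℤ.- (+ p)))) →
           d ≡ d₀ × proj₁ 2b ≡ p₀ → (b ℚ.+ b ≡ ι (+ p₀) ⊎ b ℚ.+ b ≡ ι (ℤ.- (+ p₀)) → A) → d ≡ d₀ × A
  solved (p , _ , 2b≡) (d≡ , p≡) f = d≡ , f (subst (λ p → b ℚ.+ b ≡ ι (+ p) ⊎ b ℚ.+ b ≡ ι (ℤ.- (+ p))) p≡ 2b≡)

  trace≡3 : a ℚ.+ a ≡ ι (+ 3) → d ≡ 5 × (u ≡ (+ 3 / 2 ⊕ + 1 / 2 √d) ⊎ u ≡ (+ 3 / 2 ⊕ -[1+ 0 ] / 2 √d))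
  trace≡3 2a≡ = solved {1} 2b (solution-5 (proj₁ 2b) (proj₁ (proj₂ 2b))) λ h → halves (+ 3 / 2) (+ 1 / 2) (-[1+ 0 ] /
      2) 2a≡ h
    where
    2b = doubles 5 (ι (+ 3)) 2a≡ refl

  trace≡4 : a ℚ.+ a ≡ ι (+ 4) → d ≡ 3 × (u ≡ (+ 2 / 1 ⊕ + 1 / 1 √d) ⊎ u ≡ (+ 2 / 1 ⊕ -[1+ 0 ] / 1 √d))
  trace≡4 2a≡ = solved {2} 2b (solution-12 (proj₁ 2b) squarefree (proj₁ (proj₂ 2b))) λ h → halves (+ 2 / 1) (+ 1 / 1)
      (-[1+ 0 ] / 1) 2a≡ h
    where
    2b = doubles 12 (ι (+ 4)) 2a≡ refl

  trace≡5 : a ℚ.+ a ≡ ι (+ 5) → d ≡ 21 × (u ≡ (+ 5 / 2 ⊕ + 1 / 2 √d) ⊎ u ≡ (+ 5 / 2 ⊕ -[1+ 0 ] / 2 √d))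
  trace≡5 2a≡ = solved {1} 2b (solution-21 (proj₁ 2b) (proj₁ (proj₂ 2b))) λ h → halves (+ 5 / 2) (+ 1 / 2)
      (-[1+ 0 ] / 2) 2a≡ h
    where
    2b = doubles 21 (ι (+ 5)) 2a≡ refl

  trace≡6 : a ℚ.+ a ≡ ι (+ 6) → d ≡ 2 × (u ≡ (+ 3 / 1 ⊕ + 2 / 1 √d) ⊎ u ≡ (+ 3 / 1 ⊕ -[1+ 1 ] / 1 √d))
  trace≡6 2a≡ = solved {4} 2b (solution-32 (proj₁ 2b) squarefree (proj₁ (proj₂ 2b))) λ h → halves (+ 3 / 1) (+ 2 / 1)
      (-[1+ 1 ] / 1) 2a≡ h
    where
    2b = doubles 32 (ι (+ 6)) 2a≡ refl

theorem3p1 : (d : ℕ) → 1 ℕ.< d → Squarefree d →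
    (u : ℚ[√ d ]) → IsUnit u → norm u ≡ 1ℚ → 0# < u → u ≢ 1# →
    Σ[ Δ ∈ (ℕ → ℤ) ]
    (∀ n → 1 ℕ.≤ n → Δ n / 1 ≡ norm (u ^ n - 1#)) ×
    (u < fromℚ (+ 1 / 6) ⊎ fromℤ (+ 6) < u → Z[ Δ ]≤ 6) ×
    (¬ (u < fromℚ (+ 1 / 6) ⊎ fromℤ (+ 6) < u) →
    ( d ≡ 2
    × (u ≡ (+ 3 / 1 ⊕ + 2 / 1 √d) ⊎ u ≡ (+ 3 / 1 ⊕ -[1+ 1 ] / 1 √d))
    × Z[ Δ ]≡ 2)
    ⊎
    ( d ≡ 3
    × (u ≡ (+ 2 / 1 ⊕ + 1 / 1 √d) ⊎ u ≡ (+ 2 / 1 ⊕ -[1+ 0 ] / 1 √d))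
    × Z[ Δ ]≡ 6
    × NoPrimitiveExactlyAt Δ (4 ∷ 6 ∷ []))
    ⊎
    -- index 1 is listed because Δ₁ = -1 has no prime divisor at all
    ( d ≡ 5
    × (u ≡ (+ 3 / 2 ⊕ + 1 / 2 √d) ⊎ u ≡ (+ 3 / 2 ⊕ -[1+ 0 ] / 2 √d))
    × Z[ Δ ]≡ 12
    × NoPrimitiveExactlyAt Δ (1 ∷ 6 ∷ 10 ∷ 12 ∷ []))
    ⊎
    ( d ≡ 21
    × (u ≡ (+ 5 / 2 ⊕ + 1 / 2 √d) ⊎ u ≡ (+ 5 / 2 ⊕ -[1+ 0 ] / 2 √d))
    × Z[ Δ ]≡ 6
    × NoPrimitiveExactlyAt Δ (6 ∷ [])))
theorem3p1 d 1<d squarefree u@(a ⊕ b √d) (integral , _) norm≡1 0<u u≢1 = byTrace traceInt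
  where
  traceInt : ∃[ k ] a ℚ.+ a ≡ ι (+ (3 ℕ.+ k))
  traceInt = trace≥3 {d} 1<d {a} {b} norm≡1 0<u u≢1 (integral⇒traceInt {d} a b norm≡1 integral)
  Outside : Set
  Outside = u < fromℚ (+ 1 / 6) ⊎ fromℤ (+ 6) < u
  Exceptional : (ℕ → ℤ) → Set
  Exceptional Δ =
    (d ≡ 2 × (u ≡ (+ 3 / 1 ⊕ + 2 / 1 √d) ⊎ u ≡ (+ 3 / 1 ⊕ -[1+ 1 ] / 1 √d)) × Z[ Δ ]≡ 2)
    ⊎ (d ≡ 3 × (u ≡ (+ 2 / 1 ⊕ + 1 / 1 √d) ⊎ u ≡ (+ 2 / 1 ⊕ -[1+ 0 ] / 1 √d)) × Z[ Δ ]≡ 6 × NoPrimitiveExactlyAt Δ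
        (4 ∷ 6 ∷ []))
    ⊎ (d ≡ 5 × (u ≡ (+ 3 / 2 ⊕ + 1 / 2 √d) ⊎ u ≡ (+ 3 / 2 ⊕ -[1+ 0 ] / 2 √d)) × Z[ Δ ]≡ 12 × NoPrimitiveExactlyAt Δ
        (1 ∷ 6 ∷ 10 ∷ 12 ∷ []))
    ⊎ (d ≡ 21 × (u ≡ (+ 5 / 2 ⊕ + 1 / 2 √d) ⊎ u ≡ (+ 5 / 2 ⊕ -[1+ 0 ] / 2 √d)) × Z[ Δ ]≡ 6 × NoPrimitiveExactlyAt Δ
        (6 ∷ []))
  Claim : (ℕ → ℤ) → Set
  Claim Δ = (∀ n → 1 ℕ.≤ n → Δ n / 1 ≡ norm (u ^ n - 1#)) × (Outside → Z[ Δ ]≤ 6) × (¬ Outside → Exceptional Δ)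
  norms : ∀ z → a ℚ.+ a ≡ ι (+ (2 ℕ.+ z)) → ∀ n → 1 ℕ.≤ n → Δ z n / 1 ≡ norm (u ^ n - 1#)
  norms z 2a≡ n _ = Δ≡norm {d} a b norm≡1 z (trans 2a≡ (cong (λ t → ι (+ t)) (ℕ.+-comm 2 z))) n
  claim₁ : a ℚ.+ a ≡ ι (+ 3) → Claim (Δ 1)
  claim₁ 2a≡ = norms 1 2a≡ , (λ out → ⊥-elim (trace≡3⇒inside {d} {a} {b} norm≡1 2a≡ out)) ,
    λ _ → inj₂ (inj₂ (inj₁ (proj₁ found , proj₂ found , Z₁ , noPrimitive₁)))
    where found = trace≡3 {d} {a} {b} norm≡1 squarefree 2a≡
  -- For the traces 4, 5 and 6 both Z ≤ 6 and the exceptional description hold, so each implication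
  -- is proved from its conclusion. Only the trace 3 and the traces from 7 on are compared with 1/6
  -- and 6.
  claim₂ : a ℚ.+ a ≡ ι (+ 4) → Claim (Δ 2)
  claim₂ 2a≡ = norms 2 2a≡ , (λ _ → Z≤6 2 (s≤s (s≤s z≤n))) ,
    λ _ → inj₂ (inj₁ (proj₁ found , proj₂ found , Z₂ , noPrimitive₂))
    where found = trace≡4 {d} {a} {b} norm≡1 squarefree 2a≡
  claim₃ : a ℚ.+ a ≡ ι (+ 5) → Claim (Δ 3)
  claim₃ 2a≡ = norms 3 2a≡ , (λ _ → Z≤6 3 (s≤s (s≤s z≤n))) ,
    λ _ → inj₂ (inj₂ (inj₂ (proj₁ found , proj₂ found , Z₃ , noPrimitive₃)))
    where found = trace≡5 {d} {a} {b} norm≡1 squarefree 2a≡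
  claim₄ : a ℚ.+ a ≡ ι (+ 6) → Claim (Δ 4)
  claim₄ 2a≡ = norms 4 2a≡ , (λ _ → Z≤6 4 (s≤s (s≤s z≤n))) ,
    λ _ → inj₁ (proj₁ found , proj₂ found , Z₄)
    where found = trace≡6 {d} {a} {b} norm≡1 squarefree 2a≡
  claim₅ : ∀ k → a ℚ.+ a ≡ ι (+ (7 ℕ.+ k)) → Claim (Δ (5 ℕ.+ k))
  claim₅ k 2a≡ = norms (5 ℕ.+ k) 2a≡ , (λ _ → Z≤6 (5 ℕ.+ k) (s≤s (s≤s z≤n))) ,
    λ inside → ⊥-elim (inside (7≤trace⇒outside {d} {a} {b} norm≡1 (1<a {d} 1<d {a} {b} norm≡1 0<u u≢1) (b≢0 {d} 1<d
        {a} {b} norm≡1 0<u u≢1) k 2a≡))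
  byTrace : ∃[ k ] a ℚ.+ a ≡ ι (+ (3 ℕ.+ k)) → Σ[ Δ ∈ (ℕ → ℤ) ] Claim Δ
  byTrace (0 , 2a≡) = Δ 1 , claim₁ 2a≡
  byTrace (1 , 2a≡) = Δ 2 , claim₂ 2a≡
  byTrace (2 , 2a≡) = Δ 3 , claim₃ 2a≡
  byTrace (3 , 2a≡) = Δ 4 , claim₄ 2a≡
  byTrace (suc (suc (suc (suc k))) , 2a≡) = Δ (5 ℕ.+ k) , claim₅ k 2a≡
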